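{- Let $m \geq 0$, $n \geq 1$ be integers. Consider the following algorithm with input a stable configuration $c = (c^t; c^b)$ on $K_{m,n}^0$: (1) replace $c^b$ by its non-decreasing rearrangement $(\tilde c^b_1, \ldots, \tilde c^b_n)$, computed by counting sort (using that all entries lie in $\{0, \ldots, m\}$); (2) compute $k_j := |\{ i \in \{1,\ldots,m\} : c^t_i < j\}|$ for $j = 1, \ldots, n$ by first counting, for each $0 \le \ell \le n-1$, the number $k'_\ell$ of indices $i$ with $c^t_i = \ell$, and then taking prefix sums $k_j = k'_0 + \cdots + k'_{j-1}$; (3) set $\mathrm{sumK} = \mathrm{sumC} = 0$, and for $j = 1, \ldots, n$ update $\mathrm{sumK} \gets \mathrm{sumK} + k_j$, $\mathrm{sumC} \gets \mathrm{sumC} + \tilde c^b_j$, and return False if $\mathrm{sumC} < \mathrm{sumK}$; (4) if the loop completes, return True. Then this algorithm returns True if and only if $c$ is stochastically recurrent, and it runs in $O(m+n)$ time.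
   Context: $K_{m,n}^0$ is the complete bipartite graph with "top" vertices $v^t_0, v^t_1, \ldots, v^t_m$ and "bottom" vertices $v^b_1, \ldots, v^b_n$, with an edge between every top vertex and every bottom vertex; $v^t_0$ is called the sink. A configuration is a vector $c = (c^t_1, \ldots, c^t_m; c^b_1, \ldots, c^b_n)$ of non-negative integers ($c^*_i$ = number of grains at $v^*_i$). A non-sink vertex is stable if its number of grains is less than its degree, i.e. $c^t_i < n$, resp. $c^b_j < m+1$; $c$ is stable if all non-sink vertices are stable. Stochastic sandpile model (SSM) with a fixed parameter $p \in (0,1)$: an unstable vertex topples as follows: for each of its neighbours (for a bottom vertex this includes the sink), independently (and independently of all previous topplings), with probability $p$ it sends one grain to that neighbour, and otherwise keeps that grain; grains sent to the sink disappear. Starting from any configuration and repeatedly toppling unstable vertices, one reaches a (random) stable configuration whose law does not depend on the toppling order. Consider the Markov chain on stable configurations which at each step adds a grain to a non-sink vertex chosen uniformly at random and then stabilises according to the SSM. A stable configuration is stochastically recurrent if it is a recurrent state of this Markov chain (appears infinitely often in its long-time running). -}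

module Defs where

open import Level using (suc; _⊔_)
open import Algebra.Apartness.Bundles using (HeytingField)
import Algebra.Apartness.Properties.HeytingCommutativeRing as HCR
open import Data.Bool using (Bool; true; false; if_then_else_)
open import Data.Fin using (Fin)
open import Data.Fin.Subset using (Subset; ∣_∣)
import Data.Fin.Properties as Fin
open import Data.List as List using (List; []; _∷_)
open import Data.Maybe using (Maybe; just; nothing; maybe′)
open import Data.Nat as ℕ using (ℕ; NonZero; _∸_; _≡ᵇ_; _<ᵇ_; _≤ᵇ_)
import Data.Nat.Properties as ℕ
open import Data.Product using (_×_; _,_; proj₁; ∃-syntax)
open import Data.Sum using (_⊎_; inj₁; inj₂; [_,_])
open import Data.Vec as Vec using (Vec; []; _∷_; lookup; _[_]%=_; zipWith)
import Data.Vec.Properties as Vec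
open import Function using (_⇔_; module Equivalence)
open import Relation.Binary using (Rel; IsStrictPartialOrder; DecidableEquality)
open import Relation.Binary.PropositionalEquality using (_≡_; refl; cong)
open import Relation.Nullary using (¬_; Dec; yes; no)
open import Relation.Nullary.Decidable using (map′; _×-dec_)

record OrderedField a ℓ₁ ℓ₂ ℓ₃ : Set (suc (a ⊔ ℓ₁ ⊔ ℓ₂ ⊔ ℓ₃)) where
  infix 4 _<_
  field
    heytingField : HeytingField a ℓ₁ ℓ₂
  open HeytingField heytingField public

  field
    _<_                  : Rel Carrier ℓ₃
    isStrictPartialOrder : IsStrictPartialOrder _≈_ _<_
    #⇔<⊎>                : ∀ {x y} → x # y ⇔ (x < y ⊎ y < x)
    0<1                  : 0# < 1#
    +-monoˡ-<            : ∀ z {x y} → x < y → x + z < y + z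
    *-pos                : ∀ {x y} → 0# < x → 0# < y → 0# < x * y

  fromℕ : ℕ → Carrier
  fromℕ ℕ.zero    = 0#
  fromℕ (ℕ.suc k) = 1# + fromℕ k

  private
    module < = IsStrictPartialOrder isStrictPartialOrder

  0<fromℕ : ∀ k → .{{NonZero k}} → 0# < fromℕ k
  0<fromℕ (ℕ.suc ℕ.zero) = <.<-respʳ-≈ (sym (+-identityʳ 1#)) 0<1
  0<fromℕ (ℕ.suc (ℕ.suc k)) =
    <.trans (0<fromℕ (ℕ.suc k))
            (<.<-respˡ-≈ (+-identityˡ _) (+-monoˡ-< (fromℕ (ℕ.suc k)) 0<1))

  1/ℕ : ∀ k → .{{NonZero k}} → Carrier
  1/ℕ k = proj₁ (#⇒invertible (Equivalence.from #⇔<⊎> (inj₂ (0<fromℕ k))))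

  fromℕ*1/ℕ : ∀ k → .{{_ : NonZero k}} → fromℕ k * 1/ℕ k ≈ 1#
  fromℕ*1/ℕ k with #⇒invertible (Equivalence.from #⇔<⊎> (inj₂ (0<fromℕ k)))
  ... | _ , _ , inverseʳ = trans (*-congʳ (sym (HCR.x-0≈x heytingCommutativeRing _))) inverseʳ

-- The library has no real numbers, so they enter axiomatically, as a Cauchy
-- complete Archimedean ordered field.  The order is not assumed decidable.
record Reals a ℓ₁ ℓ₂ ℓ₃ : Set (suc (a ⊔ ℓ₁ ⊔ ℓ₂ ⊔ ℓ₃)) where
  field
    orderedField : OrderedField a ℓ₁ ℓ₂ ℓ₃
  open OrderedField orderedField public

  Cauchy : (ℕ → Carrier) → Set _
  Cauchy s = ∀ ε → 0# < ε → ∃[ N ] ∀ i j → N ℕ.≤ i → N ℕ.≤ j → s i - s j < ε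

  _⟶_ : (ℕ → Carrier) → Carrier → Set _
  s ⟶ l = ∀ ε → 0# < ε → ∃[ N ] ∀ i → N ℕ.≤ i → s i - l < ε × l - s i < ε

  field
    archimedean : ∀ x → ∃[ k ] x < fromℕ k
    complete    : ∀ s → Cauchy s → ∃[ l ] s ⟶ l

InUnitInterval : ∀ {a ℓ₁ ℓ₂ ℓ₃} (ℝ : Reals a ℓ₁ ℓ₂ ℓ₃) → Reals.Carrier ℝ → Set ℓ₃
InUnitInterval ℝ p = 0# < p × p < 1#
  where open Reals ℝ

record Config (m n : ℕ) : Set where
  constructor ⟨_,_⟩
  field
    tops    : Vec ℕ m
    bottoms : Vec ℕ n
open Config public

-- The non-sink vertices: inj₁ i is a top vertex, inj₂ j a bottom vertex.
Vertex : ℕ → ℕ → Set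
Vertex m n = Fin m ⊎ Fin n

module _ {m n : ℕ} where

  degree : Vertex m n → ℕ
  degree (inj₁ _) = n
  degree (inj₂ _) = ℕ.suc m

  grains : Config m n → Vertex m n → ℕ
  grains c (inj₁ i) = lookup (tops c) i
  grains c (inj₂ j) = lookup (bottoms c) j

  Unstable : Config m n → Vertex m n → Set
  Unstable c v = degree v ℕ.≤ grains c v

  Stable : Config m n → Set
  Stable c = ∀ v → grains c v ℕ.< degree v

  stable? : ∀ c → Dec (Stable c)
  stable? c = map′ (λ { (f , g) → [ f , g ] })
                   (λ s → (λ i → s (inj₁ i)) , (λ j → s (inj₂ j)))
                   (Fin.all? (λ i → lookup (tops c) i ℕ.<? n)
                    ×-dec Fin.all? (λ j → lookup (bottoms c) j ℕ.<? ℕ.suc m))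

  _≟_ : DecidableEquality (Config m n)
  ⟨ t , b ⟩ ≟ ⟨ t′ , b′ ⟩ =
    map′ (λ { (refl , refl) → refl })
         (λ e → cong tops e , cong bottoms e)
         (Vec.≡-dec ℕ._≟_ t t′ ×-dec Vec.≡-dec ℕ._≟_ b b′)

  addGrain : Vertex m n → Config m n → Config m n
  addGrain (inj₁ i) c = record c { tops    = tops c    [ i ]%= ℕ.suc }
  addGrain (inj₂ j) c = record c { bottoms = bottoms c [ j ]%= ℕ.suc }

  receive : ∀ {k} → Subset k → Vec ℕ k → Vec ℕ k
  receive = zipWith (λ b x → if b then ℕ.suc x else x)

  -- The set of neighbours receiving a grain when v topples is a subset of
  -- Fin (degree v).  For a top vertex, these are the bottom vertices; for a
  -- bottom vertex, index zero is the sink and index suc i is top vertex i.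
  send : (v : Vertex m n) → Subset (degree v) → Config m n → Config m n
  send (inj₁ i) S ⟨ t , b ⟩ = ⟨ t [ i ]%= (_∸ ∣ S ∣) , receive S b ⟩
  send (inj₂ j) S ⟨ t , b ⟩ = ⟨ receive (Vec.tail S) t , b [ j ]%= (_∸ ∣ S ∣) ⟩

-- An order of toppling: which unstable vertex to topple next.
record TopplingRule (m n : ℕ) : Set where
  field
    pick  : Config m n → Vertex m n
    legal : ∀ c → ¬ Stable c → Unstable c (pick c)

module SSM {a ℓ₁ ℓ₂ ℓ₃} (ℝ : Reals a ℓ₁ ℓ₂ ℓ₃) (p : Reals.Carrier ℝ) where
  open Reals ℝ

  -- Finitely supported distributions, as lists of weighted outcomes.
  Dist : ∀ {b} → Set b → Set (a ⊔ b)
  Dist A = List (Carrier × A)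

  module _ {b c} {A : Set b} {B : Set c} where

    infixl 1 _>>=_
    _>>=_ : Dist A → (A → Dist B) → Dist B
    d >>= f = List.concatMap (λ { (w , x) → List.map (λ { (w′ , y) → w * w′ , y }) (f x) }) d

  return : ∀ {b} {A : Set b} → A → Dist A
  return x = (1# , x) ∷ []

  prob : ∀ {b} {A : Set b} → (A → Bool) → Dist A → Carrier
  prob E d = List.foldr (λ { (w , x) s → (if E x then w else 0#) + s }) 0# d

  bernoulli : Dist Bool
  bernoulli = (p , true) ∷ (1# - p , false) ∷ []

  -- Each element is selected independently with probability p.
  randomSubset : ∀ k → Dist (Subset k)
  randomSubset ℕ.zero    = return []
  randomSubset (ℕ.suc k) = bernoulli >>= λ b → randomSubset k >>= λ S → return (b ∷ S)

  randomVertex : ∀ m n → .{{NonZero n}} → Dist (Vertex m n)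
  randomVertex m n@(ℕ.suc _) =
    List.map (λ v → 1/ℕ (m ℕ.+ n) {{m+n≢0}} , v)
             (List.map inj₁ (List.allFin m) List.++ List.map inj₂ (List.allFin n))
    where
      m+n≢0 : NonZero (m ℕ.+ n)
      m+n≢0 = ℕ.>-nonZero (ℕ.<-≤-trans ℕ.z<s (ℕ.m≤n+m n m))

  module _ {m n : ℕ} where

    topple : Vertex m n → Config m n → Dist (Config m n)
    topple v c = randomSubset (degree v) >>= λ S → return (send v S c)

    -- Stabilisation, abandoned (nothing) if it takes more than T topplings.
    -- The probability that c stabilises to d is the supremum over T of the
    -- probability of just d.
    stabilise : TopplingRule m n → (T : ℕ) → Config m n → Dist (Maybe (Config m n))
    stabilise rule T c with stable? c
    stabilise rule T         c | yes _ = return (just c)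
    stabilise rule ℕ.zero    c | no _  = return nothing
    stabilise rule (ℕ.suc T) c | no _  =
      topple (TopplingRule.pick rule c) c >>= stabilise rule T

    module _ .{{_ : NonZero n}} (rule : TopplingRule m n) where

      step : (T : ℕ) → Config m n → Dist (Maybe (Config m n))
      step T c = randomVertex m n >>= λ v → stabilise rule T (addGrain v c)

      -- The states X₁ , … , X_N of the chain started at X₀ = c; the list ends
      -- early if some stabilisation takes more than T topplings.
      trajectory : (T N : ℕ) → Config m n → Dist (List (Config m n))
      trajectory T ℕ.zero    c = return []
      trajectory T (ℕ.suc N) c =
        step T c >>= maybe′ (λ c′ → trajectory T N c′ >>= λ X → return (c′ ∷ X)) (return [])

      visits : Config m n → List (Config m n) → ℕ
      visits c X = List.length (List.filter (c ≟_) X)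

      -- The chain started at c almost surely returns to c infinitely often.
      -- This event is the decreasing intersection over k of the events "at
      -- least k visits", and each of these is the increasing union over T and
      -- N of the events whose probability appears below; so by continuity of
      -- measure its probability is 1 if and only if all these suprema are 1.
      StochasticallyRecurrent : Config m n → Set _
      StochasticallyRecurrent c =
        ∀ k ε → 0# < ε →
        ∃[ T ] ∃[ N ] 1# - ε < prob (λ X → k ≤ᵇ visits c X) (trajectory T N c)

module RAM where

  -- Programs are written in a small imperative language with natural-number
  -- variables and arrays.  Every variable access, literal, addition, array read,
  -- array write, assignment, comparison, return and loop iteration costs one
  -- unit of time, and entering a loop costs one unit besides its bound.

  data Var : Set where
    m n i j l v r pos acc sumK sumC : Var

  data Arr : Set where
    cᵗ cᵇ cnt k′ k : Arr

  codeV : Var → ℕ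
  codeV m = 0
  codeV n = 1
  codeV i = 2
  codeV j = 3
  codeV l = 4
  codeV v = 5
  codeV r = 6
  codeV pos = 7
  codeV acc = 8
  codeV sumK = 9
  codeV sumC = 10

  codeA : Arr → ℕ
  codeA cᵗ = 0
  codeA cᵇ = 1
  codeA cnt = 2
  codeA k′ = 3
  codeA k = 4

  record Memory : Set where
    constructor memory
    field
      vars : Var → ℕ
      arrs : Arr → ℕ → ℕ
  open Memory public

  setVar : Var → ℕ → Memory → Memory
  setVar x a μ = record μ { vars = λ y → if codeV y ≡ᵇ codeV x then a else vars μ y }

  setArr : Arr → ℕ → ℕ → Memory → Memory
  setArr A p a μ = record μ
    { arrs = λ B q → if codeA B ≡ᵇ codeA A
                     then (if q ≡ᵇ p then a else arrs μ B q)
                     else arrs μ B q }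

  infixl 6 _⊕_
  infix  8 _!_
  data Expr : Set where
    lit : ℕ → Expr
    var : Var → Expr
    _!_ : Arr → Expr → Expr
    _⊕_ : Expr → Expr → Expr

  eval : Memory → Expr → ℕ
  eval μ (lit a) = a
  eval μ (var x) = vars μ x
  eval μ (A ! e) = arrs μ A (eval μ e)
  eval μ (e ⊕ f) = eval μ e ℕ.+ eval μ f

  cost : Expr → ℕ
  cost (lit a) = 1
  cost (var x) = 1
  cost (A ! e) = 1 ℕ.+ cost e
  cost (e ⊕ f) = 1 ℕ.+ cost e ℕ.+ cost f

  infixr 1 _⨾_
  infix  3 _≔_ _⟦_⟧≔_
  infix  2 for_below_do[_] if_≺_thenReturn_
  data Program : Set where
    _≔_              : Var → Expr → Program
    _⟦_⟧≔_          : Arr → Expr → Expr → Program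
    _⨾_              : Program → Program → Program
    for_below_do[_]  : Var → Expr → Program → Program
    if_≺_thenReturn_ : Expr → Expr → Bool → Program
    return           : Bool → Program

  -- A run that has not executed a return statement has result nothing.
  record Run : Set where
    constructor run
    field
      result : Maybe Bool
      time   : ℕ
      final  : Memory
  open Run public

  infixl 1 _then_
  _then_ : Run → (Memory → Run) → Run
  run (just b) t μ then f = run (just b) t μ
  run nothing  t μ then f = record (f μ) { time = t ℕ.+ time (f μ) }

  -- loop x body d a runs body with x = a , a + 1 , … , a + d − 1.
  loop : Var → (Memory → Run) → (d a : ℕ) → Memory → Run
  loop x body ℕ.zero    a μ = run nothing 0 μ
  loop x body (ℕ.suc d) a μ =
    run nothing 1 (setVar x a μ) then body then loop x body d (ℕ.suc a)

  -- The bound of a for loop is evaluated once, on entry.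
  exec : Program → Memory → Run
  exec (x ≔ e)                 μ = run nothing (1 ℕ.+ cost e) (setVar x (eval μ e) μ)
  exec (A ⟦ e ⟧≔ f)            μ = run nothing (1 ℕ.+ cost e ℕ.+ cost f)
                                       (setArr A (eval μ e) (eval μ f) μ)
  exec (P ⨾ Q)                 μ = exec P μ then exec Q
  exec (for x below e do[ P ]) μ =
    run nothing (1 ℕ.+ cost e) μ then loop x (exec P) (eval μ e) 0
  exec (if e ≺ f thenReturn b) μ =
    run (if eval μ e <ᵇ eval μ f then just b else nothing) (1 ℕ.+ cost e ℕ.+ cost f) μ
  exec (return b)              μ = run (just b) 1 μ

  -- Arrays are indexed from 0: cell i of cᵗ holds cᵗ_{i+1}, cell j of cᵇ holds
  -- cᵇ_{j+1} and cell j of k holds k_{j+1}; cell ℓ of k′ holds k′_ℓ.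

  sortBottoms : Program
  sortBottoms =
    for v below var m ⊕ lit 1 do[ cnt ⟦ var v ⟧≔ lit 0 ] ⨾
    for j below var n do[ cnt ⟦ cᵇ ! var j ⟧≔ cnt ! (cᵇ ! var j) ⊕ lit 1 ] ⨾
    pos ≔ lit 0 ⨾
    for v below var m ⊕ lit 1 do[
      for r below cnt ! var v do[
        cᵇ ⟦ var pos ⟧≔ var v ⨾
        pos ≔ var pos ⊕ lit 1 ] ]

  computeK : Program
  computeK =
    for l below var n do[ k′ ⟦ var l ⟧≔ lit 0 ] ⨾
    for i below var m do[ k′ ⟦ cᵗ ! var i ⟧≔ k′ ! (cᵗ ! var i) ⊕ lit 1 ] ⨾
    acc ≔ lit 0 ⨾
    for j below var n do[
      acc ≔ var acc ⊕ k′ ! var j ⨾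
      k ⟦ var j ⟧≔ var acc ]

  compareSums : Program
  compareSums =
    sumK ≔ lit 0 ⨾
    sumC ≔ lit 0 ⨾
    for j below var n do[
      sumK ≔ var sumK ⊕ k ! var j ⨾
      sumC ≔ var sumC ⊕ cᵇ ! var j ⨾
      if var sumC ≺ var sumK thenReturn false ] ⨾
    return true

  algorithm : Program
  algorithm = sortBottoms ⨾ computeK ⨾ compareSums

  toArray : ∀ {d} → Vec ℕ d → ℕ → ℕ
  toArray []       _         = 0
  toArray (x ∷ xs) ℕ.zero    = x
  toArray (x ∷ xs) (ℕ.suc q) = toArray xs q

  -- Working memory is initially zero; the algorithm does not rely on this.
  load : ∀ {M N} → Config M N → Memory
  load {M} {N} c = memory vars₀ arrs₀
    where
      vars₀ : Var → ℕ
      vars₀ m = M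
      vars₀ n = N
      vars₀ _ = 0

      arrs₀ : Arr → ℕ → ℕ
      arrs₀ cᵗ = toArray (tops c)
      arrs₀ cᵇ = toArray (bottoms c)
      arrs₀ _  = λ _ → 0

  runAlgorithm : ∀ {M N} → Config M N → Run
  runAlgorithm c = exec algorithm (load c)

-- Idea.  Call c good if |I||J| ≤ t(I) + b(J) for all sets I of top and J of
-- bottom vertices.  Minimising over I and over the sets J of size j, this says
-- that the sum of the j smallest bottom entries is at least
-- ∑ᵢ max(0, j − tᵢ) = k₁ + … + kⱼ, which is what the algorithm tests.
--
-- Goodness survives adding grains and toppling, and every configuration with at
-- least m grains on each bottom vertex is good.  Hence a bad c can be left for
-- ever: with positive probability grains are added to stable bottom vertices
-- until the configuration is good.
--
-- Conversely a good c can be untoppled: bottom vertex j takes back a grain from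
-- the sink and from the richest top vertices, and the result is again good.
-- Repeating this, and then untoppling top vertices, gives configurations z,
-- arbitrarily large everywhere, which can topple down to c.  Any x below z
-- reaches c under every toppling rule when the added grains and the toppling
-- outcomes are chosen well, since the topplings leading from z to c commute.
-- So, from every state that occurs, c is reached within a bounded number of
-- steps with probability bounded below, and the number of visits is almost
-- surely infinite.

module Submission where

open import Defs using (Reals; InUnitInterval; Config; Stable; TopplingRule; module SSM; module RAM)
open import Data.Nat using (ℕ; NonZero)

-- The least value of b(J) over sets J of size j is handled by duality: for every threshold v it is
-- at least `j * v` minus the shortfall below v, with equality as soon as v separates J from its
-- complement. This formula takes the place of sorted lists: counting sort is verified only through
-- its prefix sums, and the set of richest top vertices used in an untoppling is cut off by such a
-- threshold.
--
-- The order on the reals is not decidable, so no minima are taken: lower bounds for several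
-- probabilities are combined as products, and estimates have the form 1 ≤ P + e. A stabilisation
-- has no bounded length, so recurrence is proved for a finer chain, each of whose steps adds one
-- grain or makes one toppling. There every further attempt to reach c shrinks the excess error by a
-- fixed factor. Only afterwards is the estimate transferred to the truncated distributions of
-- `trajectory`.

-- Finite sums, thresholds and sets of least weight

module Sums where
  open import Data.Bool using (Bool; true; false; T; not)
  open import Data.Bool.Properties using (T?)
  open import Data.Fin using (Fin; zero; suc; toℕ)
  open import Data.Nat
  open import Data.Nat.Properties
  open import Data.Nat.Tactic.RingSolver using (solve-∀)
  open import Data.Product using (_×_; _,_; ∃-syntax)
  open import Data.Sum using (inj₁; inj₂)
  open import Function using (_∘_)
  open import Relation.Binary.PropositionalEquality
  open import Relation.Nullary using (¬_; yes; no; contradiction)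
  open import Algebra.Properties.Semiring.Sum +-*-semiring public
    using (sum-cong-≗; ∑-distrib-+) renaming (sum to ∑)

  χ : Bool → ℕ
  χ true  = 1
  χ false = 0

  χ-T : ∀ {b} → T b → χ b ≡ 1
  χ-T {true} _ = refl

  χ-¬T : ∀ {b} → ¬ T b → χ b ≡ 0
  χ-¬T {true}  h = contradiction _ h
  χ-¬T {false} h = refl

  χ≤1 : ∀ b → χ b ≤ 1
  χ≤1 true  = ≤-refl
  χ≤1 false = z≤n

  ∑-mono : ∀ {k} {f g : Fin k → ℕ} → (∀ i → f i ≤ g i) → ∑ f ≤ ∑ g
  ∑-mono {zero}  h = z≤n
  ∑-mono {suc k} h = +-mono-≤ (h zero) (∑-mono (h ∘ suc))

  ∑-zero : ∀ {k} → ∑ {k} (λ _ → 0) ≡ 0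
  ∑-zero {zero}  = refl
  ∑-zero {suc k} = ∑-zero {k}

  ∑-≥ : ∀ {k} (f : Fin k → ℕ) i → f i ≤ ∑ f
  ∑-≥ f zero    = m≤m+n (f zero) _
  ∑-≥ f (suc i) = ≤-trans (∑-≥ (f ∘ suc) i) (m≤n+m _ (f zero))

  ∑-const : ∀ k x → ∑ {k} (λ _ → x) ≡ k * x
  ∑-const zero    x = refl
  ∑-const (suc k) x = cong (x +_) (∑-const k x)

  ∑-+-cong : ∀ {k} {f g h : Fin k → ℕ} → (∀ i → f i ≡ g i + h i) → ∑ f ≡ ∑ g + ∑ h
  ∑-+-cong {g = g} {h} e = trans (sum-cong-≗ e) (∑-distrib-+ g h)

  ∑-+-mono : ∀ {k} {f g h : Fin k → ℕ} → (∀ i → f i ≤ g i + h i) → ∑ f ≤ ∑ g + ∑ h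
  ∑-+-mono {g = g} {h} e = ≤-trans (∑-mono e) (≤-reflexive (∑-distrib-+ g h))

  ∑-update : ∀ {k} (f g : Fin k → ℕ) j → (∀ i → i ≢ j → f i ≡ g i) → ∑ f + g j ≡ ∑ g + f j
  ∑-update f g zero    e = trans (cong (λ s → f zero + s + g zero) (sum-cong-≗ (λ i → e (suc i) λ ())))
                                 (swap (f zero) (∑ (g ∘ suc)) (g zero))
    where
      swap : ∀ a s b → a + s + b ≡ b + s + a
      swap = solve-∀
  ∑-update f g (suc j) e = begin
    f zero + ∑ (f ∘ suc) + g (suc j)   ≡⟨ +-assoc (f zero) _ _ ⟩
    f zero + (∑ (f ∘ suc) + g (suc j)) ≡⟨ cong₂ _+_ (e zero λ ()) (∑-update (f ∘ suc) (g ∘ suc) j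
                                            (λ i i≢j → e (suc i) λ { refl → i≢j refl })) ⟩
    g zero + (∑ (g ∘ suc) + f (suc j)) ≡⟨ +-assoc (g zero) _ _ ⟨
    g zero + ∑ (g ∘ suc) + f (suc j)   ∎
    where open ≡-Reasoning

  ∑< : ℕ → (ℕ → ℕ) → ℕ
  ∑< k f = ∑ {k} (f ∘ toℕ)

  ∑<-suc : ∀ k (f : ℕ → ℕ) → ∑< (suc k) f ≡ ∑< k f + f k
  ∑<-suc zero    f = +-identityʳ (f 0)
  ∑<-suc (suc k) f = trans (cong (f 0 +_) (∑<-suc k (f ∘ suc))) (sym (+-assoc (f 0) _ _))

  ∑<-cong : ∀ k {f g : ℕ → ℕ} → (∀ i → i < k → f i ≡ g i) → ∑< k f ≡ ∑< k g
  ∑<-cong zero    e = refl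
  ∑<-cong (suc k) e = cong₂ _+_ (e 0 z<s) (∑<-cong k (λ i i<k → e (suc i) (s<s i<k)))

  size : ∀ {k} → (Fin k → Bool) → ℕ
  size J = ∑ (χ ∘ J)

  size-not : ∀ {k} (J : Fin k → Bool) → size (not ∘ J) + size J ≡ k
  size-not {zero}  J = refl
  size-not {suc k} J with J zero
  ... | true  = trans (+-suc _ _) (cong suc (size-not (J ∘ suc)))
  ... | false = cong suc (size-not (J ∘ suc))

  size≤ : ∀ {k} (J : Fin k → Bool) → size J ≤ k
  size≤ J = subst (size J ≤_) (size-not J) (m≤n+m (size J) _)

  weight : ∀ {k} → (Fin k → Bool) → (Fin k → ℕ) → ℕ
  weight J f = ∑ (λ i → χ (J i) * f i)

  weight-mono : ∀ {k} (J : Fin k → Bool) {f g : Fin k → ℕ} → (∀ i → f i ≤ g i) → weight J f ≤ weight J g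
  weight-mono J h = ∑-mono (λ i → *-monoʳ-≤ (χ (J i)) (h i))

  shortfall : ∀ {k} → ℕ → (Fin k → ℕ) → ℕ
  shortfall v f = ∑ (λ i → v ∸ f i)

  shortfall-anti : ∀ {k} v {f g : Fin k → ℕ} → (∀ i → f i ≤ g i) → shortfall v g ≤ shortfall v f
  shortfall-anti v h = ∑-mono (λ i → ∸-monoʳ-≤ v (h i))

  below : ∀ {k} → ℕ → (Fin k → ℕ) → ℕ
  below v f = size (λ i → f i <ᵇ v)

  suc-∸-split : ∀ v x → suc v ∸ x ≡ v ∸ x + χ (x <ᵇ suc v)
  suc-∸-split v x with T? (x <ᵇ suc v)
  ... | yes x<v = trans (+-∸-assoc 1 (≤-pred (<ᵇ⇒< x (suc v) x<v)))
                        (trans (+-comm 1 _) (cong (v ∸ x +_) (sym (χ-T x<v))))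
  ... | no  x≮v = trans (m≤n⇒m∸n≡0 v<x)
                        (sym (cong₂ _+_ (m≤n⇒m∸n≡0 (<⇒≤ v<x)) (χ-¬T x≮v)))
    where
      v<x : v < x
      v<x = ≮⇒≥ (x≮v ∘ <⇒<ᵇ)

  -- On the top vertices `below j t` is k_j, so iterating this identifies `shortfall j t` with k_1 +
  -- ... + k_j, the running value of `sumK`.
  shortfall-suc : ∀ {k} v (f : Fin k → ℕ) → shortfall (suc v) f ≡ shortfall v f + below (suc v) f
  shortfall-suc v f = ∑-+-cong (λ i → suc-∸-split v (f i))

  size-*≤ : ∀ {k} v (J : Fin k → Bool) f → size J * v ≤ weight J f + shortfall v f
  size-*≤ {zero}  v J f = z≤n
  size-*≤ {suc k} v J f = begin
    (χ (J zero) + size (J ∘ suc)) * v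
      ≡⟨ *-distribʳ-+ v (χ (J zero)) _ ⟩
    χ (J zero) * v + size (J ∘ suc) * v
      ≤⟨ +-mono-≤ (head (J zero)) (size-*≤ v (J ∘ suc) (f ∘ suc)) ⟩
    χ (J zero) * f zero + (v ∸ f zero) + (weight (J ∘ suc) (f ∘ suc) + shortfall v (f ∘ suc))
      ≡⟨ shuffle (χ (J zero) * f zero) (v ∸ f zero) _ _ ⟩
    weight J f + shortfall v f ∎
    where
      open ≤-Reasoning
      shuffle : ∀ a b c d → a + b + (c + d) ≡ a + c + (b + d)
      shuffle = solve-∀
      head : ∀ b → χ b * v ≤ χ b * f zero + (v ∸ f zero)
      head true  = subst₂ (λ x y → x ≤ y + (v ∸ f zero)) (sym (*-identityˡ v)) (sym (*-identityˡ (f zero)))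
                          (m≤n+m∸n v (f zero))
      head false = z≤n

  -- Complementary slackness: the condition under which `size-*≤` is an equality in each term.
  Separates : ∀ {k} → ℕ → (Fin k → Bool) → (Fin k → ℕ) → Set
  Separates v J f = ∀ i → (T (J i) → f i ≤ v) × (T (not (J i)) → v ≤ f i)

  size-*≡ : ∀ {k} v (J : Fin k → Bool) f → Separates v J f → size J * v ≡ weight J f + shortfall v f
  size-*≡ {zero}  v J f sep = refl
  size-*≡ {suc k} v J f sep = begin
    (χ (J zero) + size (J ∘ suc)) * v
      ≡⟨ *-distribʳ-+ v (χ (J zero)) _ ⟩
    χ (J zero) * v + size (J ∘ suc) * v
      ≡⟨ cong₂ _+_ (head (J zero) (sep zero)) (size-*≡ v (J ∘ suc) (f ∘ suc) (sep ∘ suc)) ⟩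
    χ (J zero) * f zero + (v ∸ f zero) + (weight (J ∘ suc) (f ∘ suc) + shortfall v (f ∘ suc))
      ≡⟨ shuffle (χ (J zero) * f zero) (v ∸ f zero) _ _ ⟩
    weight J f + shortfall v f ∎
    where
      open ≡-Reasoning
      shuffle : ∀ a b c d → a + b + (c + d) ≡ a + c + (b + d)
      shuffle = solve-∀
      head : ∀ b → (T b → f zero ≤ v) × (T (not b) → v ≤ f zero) → χ b * v ≡ χ b * f zero + (v ∸ f zero)
      head true  (f≤v , _) = trans (*-identityˡ v) (trans (sym (m+[n∸m]≡n (f≤v _)))
                               (cong (_+ (v ∸ f zero)) (sym (*-identityˡ (f zero)))))
      head false (_ , v≤f) = sym (m≤n⇒m∸n≡0 (v≤f _))

  between : ∀ {k} (A B : Fin k → Bool) → (∀ i → T (A i) → T (B i)) → ∀ s → size A ≤ s → s ≤ size B →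
            ∃[ J ] size {k} J ≡ s × (∀ i → T (A i) → T (J i)) × (∀ i → T (J i) → T (B i))
  between {zero}  A B A⊆B s lo hi = A , sym (n≤0⇒n≡0 hi) , (λ ()) , λ ()
  between {suc k} A B A⊆B s lo hi = go (A zero) (B zero) refl refl s lo hi
    where
      module _ {x : Bool} {J : Fin k → Bool} where
        cons : Fin (suc k) → Bool
        cons zero    = x
        cons (suc i) = J i
      tail = between (A ∘ suc) (B ∘ suc) (A⊆B ∘ suc)
      extend : ∀ x {s s′} → s ≡ χ x + s′ → (T (A zero) → T x) → (T x → T (B zero)) →
               (∃[ J ] size {k} J ≡ s′ × (∀ i → T (A (suc i)) → T (J i)) × (∀ i → T (J i) → T (B (suc i)))) →
               ∃[ J ] size {suc k} J ≡ s × (∀ i → T (A i) → T (J i)) × (∀ i → T (J i) → T (B i))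
      extend x s≡ l h (J , sz , lJ , hJ) =
        cons {x} {J} , trans (cong (χ x +_) sz) (sym s≡) ,
        (λ { zero → l ; (suc i) → lJ i }) , (λ { zero → h ; (suc i) → hJ i })
      go : ∀ a b → A zero ≡ a → B zero ≡ b → ∀ s → χ a + size (A ∘ suc) ≤ s → s ≤ χ b + size (B ∘ suc) →
           ∃[ J ] size {suc k} J ≡ s × (∀ i → T (A i) → T (J i)) × (∀ i → T (J i) → T (B i))
      go true  b     a≡ b≡ (suc s) (s≤s lo) hi =
        extend true refl _ (λ _ → A⊆B zero (subst T (sym a≡) _))
          (tail s lo (≤-pred (≤-trans hi (+-monoˡ-≤ (size (B ∘ suc)) (χ≤1 b)))))
      go false false a≡ b≡ s lo hi = extend false refl (λ t → subst T a≡ t) (λ ()) (tail s lo hi)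
      -- The free element is left out as long as the rest of B can supply s elements alone.
      go false true  a≡ b≡ s lo hi with s ≤? size (B ∘ suc)
      ... | yes s≤ = extend false refl (λ t → subst T a≡ t) (λ ()) (tail s lo s≤)
      go false true  a≡ b≡ zero lo hi    | no s≰ = contradiction z≤n s≰
      go false true  a≡ b≡ (suc s) lo (s≤s hi) | no s≰ =
        extend true refl (λ _ → _) (λ _ → subst T (sym b≡) _)
          (tail s (≤-trans (∑-mono (λ i → χ-mono (A⊆B (suc i)))) (≤-pred (≰⇒> s≰))) hi)
        where
          χ-mono : ∀ {a b} → (T a → T b) → χ a ≤ χ b
          χ-mono {true}  {b} h = ≤-reflexive (sym (χ-T (h _)))
          χ-mono {false} h = z≤n

  T-not : ∀ b → T (not b) → ¬ T b
  T-not false _ ()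

  -- Every J between { f < v } and { f ≤ v } separates, and `between` realises every intermediate
  -- size.
  separator : ∀ {k} v (f : Fin k → ℕ) s → below v f ≤ s → s ≤ below (suc v) f →
              ∃[ J ] size J ≡ s × Separates v J f
  separator v f s lo hi
    with J , sz , l , h ← between (λ i → f i <ᵇ v) (λ i → f i <ᵇ suc v)
                            (λ i t → <⇒<ᵇ (m<n⇒m<1+n (<ᵇ⇒< (f i) v t))) s lo hi
    = J , sz , λ i → (λ t → ≤-pred (<ᵇ⇒< (f i) (suc v) (h i t))) ,
                     (λ t → ≮⇒≥ (λ f<v → T-not (J i) t (l i (<⇒<ᵇ f<v))))

  ∃-crossing : ∀ (g : ℕ → ℕ) s N → g 0 ≤ s → s ≤ g (suc N) → ∃[ v ] g v ≤ s × s ≤ g (suc v)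
  ∃-crossing g s zero    lo hi = 0 , lo , hi
  ∃-crossing g s (suc N) lo hi with ≤-total s (g (suc N))
  ... | inj₁ s≤ = ∃-crossing g s N lo s≤
  ... | inj₂ ≤s = suc N , ≤s , hi

  -- The sum serves as a bound on all entries, which gives the search for a crossing its end point.
  below-suc-∑ : ∀ {k} (f : Fin k → ℕ) → below (suc (∑ f)) f ≡ k
  below-suc-∑ {k} f = trans (sum-cong-≗ (λ i → χ-T (<⇒<ᵇ (s≤s (∑-≥ f i)))))
                            (trans (∑-const k 1) (*-identityʳ k))

  ∃-separator : ∀ {k} (f : Fin k → ℕ) s → s ≤ k → ∃[ v ] ∃[ J ] size J ≡ s × Separates v J f
  ∃-separator {k} f s s≤k
    with v , lo , hi ← ∃-crossing (λ v → below v f) s (∑ f)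
           (≤-trans (≤-reflexive (∑-zero {k})) z≤n)
           (subst (s ≤_) (sym (below-suc-∑ f)) s≤k)
    = v , separator v f s lo hi

-- Good configurations and sums of smallest entries

module Goodness where
  open import Data.Bool using (Bool)
  open import Data.Fin using (Fin)
  open import Data.Nat
  open import Data.Nat.Properties
  open import Data.Product using (_×_; _,_; ∃-syntax)
  open import Function using (_⇔_; mk⇔)
  open import Relation.Binary.PropositionalEquality
  open Sums

  -- For a set J of bottom vertices, the best choice of a set I of top vertices
  -- in the condition |I||J| ≤ t(I) + b(J) is { i : t i < |J| }.
  Good : ∀ {m n} → (Fin m → ℕ) → (Fin n → ℕ) → Set
  Good {m} {n} t b = ∀ (J : Fin n → Bool) → shortfall (size J) t ≤ weight J b

  good-mono : ∀ {m n} {t t′ : Fin m → ℕ} {b b′ : Fin n → ℕ} →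
              (∀ i → t i ≤ t′ i) → (∀ j → b j ≤ b′ j) → Good t b → Good t′ b′
  good-mono t≤ b≤ good J =
    ≤-trans (shortfall-anti (size J) t≤) (≤-trans (good J) (weight-mono J b≤))

  -- Each of the m top vertices falls short by at most |J|, while J holds at least m grains per
  -- member.
  good-full : ∀ {m n} {t : Fin m → ℕ} {b : Fin n → ℕ} → (∀ j → m ≤ b j) → Good t b
  good-full {m} {n} {t} {b} m≤b J = begin
    shortfall (size J) t       ≤⟨ ∑-mono (λ i → m∸n≤m (size J) (t i)) ⟩
    ∑ {m} (λ _ → size J)       ≡⟨ ∑-const m (size J) ⟩
    m * size J                 ≡⟨ *-comm m (size J) ⟩
    -- A constant function is separated by its own value, so duality turns the product into a
    -- weight, with vanishing shortfall.
    size J * m                 ≡⟨ size-*≡ m J (λ _ → m) (λ _ → (λ _ → ≤-refl) , (λ _ → ≤-refl)) ⟩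
    weight J (λ _ → m) + shortfall {n} m (λ _ → m)
                               ≡⟨ cong (weight J (λ _ → m) +_) (trans (sum-cong-≗ {n} (λ _ → n∸n≡0 m)) (∑-zero {n})) ⟩
    weight J (λ _ → m) + 0     ≡⟨ +-identityʳ _ ⟩
    weight J (λ _ → m)         ≤⟨ weight-mono J m≤b ⟩
    weight J b                 ∎
    where open ≤-Reasoning

  -- Determines C as the sum of the j smallest values of b, without reference
  -- to a sorted rearrangement.
  IsPrefixSum : ∀ {n} → (Fin n → ℕ) → ℕ → ℕ → Set
  IsPrefixSum b j C = ∃[ v ] below v b ≤ j × j ≤ below (suc v) b × C + shortfall v b ≡ j * v

  -- By duality `C j` is the least weight of a set of j bottom vertices: `size-*≤` compares it with
  -- an arbitrary J, and `separator` yields a J that attains it.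
  prefix⇔good : ∀ {m n} (t : Fin m → ℕ) (b : Fin n → ℕ) (C : ℕ → ℕ) →
                (∀ j → j ≤ n → IsPrefixSum b j (C j)) →
                (∀ j → j ≤ n → shortfall j t ≤ C j) ⇔ Good t b
  prefix⇔good {m} {n} t b C isPrefix = mk⇔ to from
    where
      to : (∀ j → j ≤ n → shortfall j t ≤ C j) → Good t b
      to h J with v , _ , _ , e ← isPrefix (size J) (size≤ J) =
        ≤-trans (h (size J) (size≤ J))
                (+-cancelʳ-≤ (shortfall v b) (C (size J)) (weight J b)
                  (≤-trans (≤-reflexive e) (size-*≤ v J b)))
      from : Good t b → ∀ j → j ≤ n → shortfall j t ≤ C j
      from good j j≤n
        with v , lo , hi , e ← isPrefix j j≤n
        with J , refl , sep ← separator v b j lo hi =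
        ≤-trans (good J) (≤-reflexive (+-cancelʳ-≡ (shortfall v b) (weight J b) (C j)
                                        (sym (trans e (size-*≡ v J b sep)))))

-- A Hoare logic with a clock, and verification of the algorithm

module RAMProgram where
  open import Data.Bool using (Bool; true; false; T; if_then_else_)
  open import Data.Fin using (Fin; toℕ)
  open import Data.Maybe using (just; nothing)
  open import Data.Maybe.Properties using (just-injective)
  open import Data.Nat
  open import Data.Nat.Properties
  open import Data.Nat.Tactic.RingSolver using (solve-∀)
  open import Data.Product using (_×_; _,_; proj₁; proj₂; ∃-syntax)
  open import Data.Empty using (⊥)
  open import Data.Vec using (Vec; _∷_; lookup)
  open import Function using (_⇔_; mk⇔; _∘_; module Equivalence)
  open import Relation.Binary.PropositionalEquality
  open import Relation.Nullary using (yes; no; contradiction)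
  open import Defs using (Config; tops; bottoms; grains; Stable; module RAM)
  open import Data.Sum using (inj₁; inj₂)
  open RAM
  open Sums
  open Goodness

  Assertion : Set₁
  Assertion = ℕ → Memory → Set

  data Outcome (X : ℕ → Bool → Set) (Q : Assertion) : Run → Set where
    normal   : ∀ {s μ} → Q s μ → Outcome X Q (run nothing s μ)
    returned : ∀ {b s μ} → X s b → Outcome X Q (run (just b) s μ)

  -- The first argument of an assertion is the time elapsed so far.  X is the
  -- postcondition of a return statement, Q that of normal termination.
  record Hoare (X : ℕ → Bool → Set) (P : Assertion) (prog : Program) (Q : Assertion) : Set where
    constructor hoare
    field
      outcome : ∀ s μ → P s μ → Outcome (λ s′ → X (s + s′)) (λ s′ → Q (s + s′)) (exec prog μ)
  open Hoare

  delay : ∀ {X : ℕ → Bool → Set} {Q} s {r} → Outcome (λ s′ → X (s + s′)) (λ s′ → Q (s + s′)) r →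
          Outcome X Q (record r { time = s + time r })
  delay s (normal q)   = normal q
  delay s (returned x) = returned x

  then-outcome : ∀ {X : ℕ → Bool → Set} {P Q r f} → Outcome X P r →
                 (∀ s μ → P s μ → Outcome (λ s′ → X (s + s′)) (λ s′ → Q (s + s′)) (f μ)) →
                 Outcome X Q (r then f)
  then-outcome {X} {Q = Q} (normal {s} {μ} p) h = delay {X} {Q} s (h s μ p)
  then-outcome             (returned x)       h = returned x

  reassoc : ∀ (X : ℕ → Bool → Set) (Q : Assertion) {r} s s₁ →
            Outcome (λ s′ → X (s + s₁ + s′)) (λ s′ → Q (s + s₁ + s′)) r →
            Outcome (λ s′ → X (s + (s₁ + s′))) (λ s′ → Q (s + (s₁ + s′))) r
  reassoc X Q s s₁ (normal {s′} {μ} q)       = normal (subst (λ t → Q t μ) (+-assoc s s₁ s′) q)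
  reassoc X Q s s₁ (returned {b} {s′} {μ} x) = returned {μ = μ} (subst (λ t → X t b) (+-assoc s s₁ s′) x)

  module _ {X : ℕ → Bool → Set} where

    infixr 1 _⨟_
    _⨟_ : ∀ {P Q R p q} → Hoare X P p R → Hoare X R q Q → Hoare X P (p ⨾ q) Q
    outcome (_⨟_ {Q = Q} hp hq) s μ pre =
      then-outcome (outcome hp s μ pre) (λ s₁ ν r → reassoc X Q s s₁ (outcome hq (s + s₁) ν r))

    consequence : ∀ {P P′ Q Q′ p} → (∀ s μ → P s μ → P′ s μ) → (∀ s μ → Q′ s μ → Q s μ) →
                  Hoare X P′ p Q′ → Hoare X P p Q
    outcome (consequence {Q = Q} {Q′} {p} f g hp) s μ pre = weaken (outcome hp s μ (f s μ pre))
      where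
        weaken : ∀ {r} → Outcome (λ s′ → X (s + s′)) (λ s′ → Q′ (s + s′)) r →
                         Outcome (λ s′ → X (s + s′)) (λ s′ → Q (s + s′)) r
        weaken (normal {s′} {ν} q) = normal (g (s + s′) ν q)
        weaken (returned x)        = returned x

    assign : ∀ {x e Q} → Hoare X (λ s μ → Q (s + (1 + cost e)) (setVar x (eval μ e) μ)) (x ≔ e) Q
    outcome assign s μ q = normal q

    store : ∀ {A e f Q} → Hoare X (λ s μ → Q (s + (1 + cost e + cost f)) (setArr A (eval μ e) (eval μ f) μ))
                                  (A ⟦ e ⟧≔ f) Q
    outcome store s μ q = normal q

    module _ {x : Var} {body : Program} (Inv : ℕ → Assertion) {Pre : ℕ → Assertion} {bound : ℕ}
             (enter : ∀ d s μ → d < bound → Inv d s μ → Pre d (s + 1) (setVar x d μ))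
             (iterate : ∀ d → Hoare X (Pre d) body (Inv (suc d))) where

      loop-outcome : ∀ c d s μ → c + d ≡ bound → Inv d s μ →
                     Outcome (λ s′ → X (s + s′)) (λ s′ → Inv bound (s + s′)) (loop x (exec body) c d μ)
      loop-outcome zero    d s μ refl inv = normal (subst (λ t → Inv d t μ) (sym (+-identityʳ s)) inv)
      loop-outcome (suc c) d s μ refl inv =
        then-outcome
          (delay {λ s′ → X (s + s′)} {λ s′ → Inv (suc d) (s + s′)} 1
            (reassoc X (Inv (suc d)) s 1
              (outcome (iterate d) (s + 1) (setVar x d μ) (enter d s μ (s≤s (m≤n+m d c)) inv))))
          (λ s₁ ν inv′ → reassoc X (Inv bound) s s₁ (loop-outcome c (suc d) (s + s₁) ν (+-suc c d) inv′))

      -- `Inv d` holds before the iteration with counter d, and `Pre d` once the counter is set and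
      -- the unit of overhead is charged. In applications `Pre` is found by unification: the rules
      -- for the body compute it as the weakest precondition of `Inv (suc d)`, so that only `enter`
      -- and `start` carry content.
      for-do : ∀ {P e} → (∀ s μ → P s μ → eval μ e ≡ bound × Inv 0 (s + (1 + cost e)) μ) →
               Hoare X P (for x below e do[ body ]) (Inv bound)
      outcome (for-do {P} {e} start) s μ pre with start s μ pre
      ... | refl , inv =
        delay {λ s′ → X (s + s′)} {λ s′ → Inv bound (s + s′)} (1 + cost e)
          (reassoc X (Inv bound) s (1 + cost e)
            (loop-outcome (eval μ e) 0 (s + (1 + cost e)) μ (+-identityʳ _) inv))

    return-if : ∀ {e f b Q} → Hoare X
      (λ s μ → (eval μ e < eval μ f → X (s + (1 + cost e + cost f)) b) ×
               (eval μ f ≤ eval μ e → Q (s + (1 + cost e + cost f)) μ))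
      (if e ≺ f thenReturn b) Q
    outcome (return-if {e} {f}) s μ (x , q) with eval μ e <ᵇ eval μ f in eq
    ... | true  = returned (x (<ᵇ⇒< (eval μ e) (eval μ f) (subst T (sym eq) _)))
    ... | false = normal (q (≮⇒≥ (λ e<f → subst T eq (<⇒<ᵇ e<f))))

    return-now : ∀ {b Q} → Hoare X (λ s μ → X (s + 1) b) (return b) Q
    outcome return-now s μ x = returned x

  if-same : ∀ p {x y : ℕ} → (if p ≡ᵇ p then x else y) ≡ x
  if-same zero    = refl
  if-same (suc p) = if-same p

  if-other : ∀ {q p} {x y : ℕ} → q ≢ p → (if q ≡ᵇ p then x else y) ≡ y
  if-other {zero}  {zero}  q≢p = contradiction refl q≢p
  if-other {zero}  {suc p} q≢p = refl
  if-other {suc q} {zero}  q≢p = refl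
  if-other {suc q} {suc p} q≢p = if-other (q≢p ∘ cong suc)

  if-zero : ∀ b {x} → x ≡ 0 → (if b then 0 else x) ≡ 0
  if-zero true  _ = refl
  if-zero false e = e

  if-count : ∀ (f : ℕ → ℕ) q p → (if q ≡ᵇ p then f p + 1 else f q) ≡ f q + χ (p ≡ᵇ q)
  if-count f zero    zero    = refl
  if-count f zero    (suc p) = sym (+-identityʳ _)
  if-count f (suc q) zero    = sym (+-identityʳ _)
  if-count f (suc q) (suc p) = if-count (f ∘ suc) q p

  multiplicity : ∀ {K} → ℕ → (Fin K → ℕ) → ℕ
  multiplicity w f = size (λ y → f y ≡ᵇ w)

  -- Turns histograms into prefix sums. On the top vertices it computes k_j from the counts in `k′`;
  -- on the bottom vertices it gives the number of cells filled once all values up to w are written.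
  below-suc : ∀ {K} w (f : Fin K → ℕ) → below (suc w) f ≡ below w f + multiplicity w f
  below-suc w f = ∑-+-cong (λ y → split (f y) w)
    where
      split : ∀ x w → χ (x <ᵇ suc w) ≡ χ (x <ᵇ w) + χ (x ≡ᵇ w)
      split zero    zero    = refl
      split zero    (suc w) = refl
      split (suc x) zero    = refl
      split (suc x) (suc w) = split x w

  below-all : ∀ {K} w {f : Fin K → ℕ} → (∀ y → f y < w) → below w f ≡ K
  below-all {K} w h = trans (sum-cong-≗ (λ y → χ-T (<⇒<ᵇ (h y)))) (trans (∑-const K 1) (*-identityʳ K))

  below-0 : ∀ {K} (f : Fin K → ℕ) → below 0 f ≡ 0
  below-0 {K} f = ∑-zero {K}

  shortfall-0 : ∀ {K} (f : Fin K → ℕ) → shortfall 0 f ≡ 0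
  shortfall-0 {K} f = trans (sum-cong-≗ (λ y → 0∸n≡0 (f y))) (∑-zero {K})

  toArray-lookup : ∀ {K} (xs : Vec ℕ K) y → toArray xs (toℕ y) ≡ lookup xs y
  toArray-lookup (x ∷ xs) Fin.zero    = refl
  toArray-lookup (x ∷ xs) (Fin.suc y) = toArray-lookup xs y

  module Analysis {M N : ℕ} (c : Config M N) (stable : Stable c) where

    cells : (ℕ → ℕ) → (K : ℕ) → Fin K → ℕ
    cells f K = f ∘ toℕ {K}

    t₀ b₀ : ℕ → ℕ
    t₀ = toArray (tops c)
    b₀ = toArray (bottoms c)

    τ : Fin M → ℕ
    τ = cells t₀ M

    β : Fin N → ℕ
    β = cells b₀ N

    β≤M : ∀ x → β x < suc M
    β≤M x = subst (_< suc M) (sym (toArray-lookup (bottoms c) x)) (stable (inj₂ x))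

    Frame : Memory → Set
    Frame μ = vars μ m ≡ M × vars μ n ≡ N × (∀ q → arrs μ cᵗ q ≡ t₀ q)

    Fresh : Memory → Set
    Fresh μ = Frame μ × (∀ q → arrs μ cᵇ q ≡ b₀ q) × (∀ q → arrs μ k′ q ≡ 0)

    prefix : Memory → ℕ → ℕ
    prefix μ x = ∑< x (arrs μ cᵇ)

    prefix-store : ∀ μ p x a → x ≤ p → prefix (setArr cᵇ p a μ) x ≡ prefix μ x
    prefix-store μ p x a x≤p = ∑<-cong x {g = arrs μ cᵇ} (λ q q<x → if-other (<⇒≢ (<-≤-trans q<x x≤p)))

    SortedTo : Memory → ℕ → Set
    SortedTo μ p = ∀ x → x ≤ p → IsPrefixSum β x (prefix μ x)

    -- The state while value x is being written and p cells are filled. The equation is the dual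
    -- formula for the sum of the p smallest entries at threshold x. Writing one more x adds x to
    -- both sides; passing from x to x + 1 when p = `below (suc x) β` adds p to both sides. The
    -- counts refer to the original entries β, so overwriting `cᵇ` does not disturb them.
    Sorting : ℕ → ℕ → Memory → Set
    Sorting x p μ = Frame μ × (∀ q → arrs μ k′ q ≡ 0) × (∀ q → arrs μ cnt q ≡ multiplicity q β) ×
                    vars μ pos ≡ p × prefix μ p + shortfall x β ≡ p * x × SortedTo μ p

    Sorted : Memory → Set
    Sorted μ = Frame μ × SortedTo μ N

    HasK : ℕ → Memory → Set
    HasK d μ = ∀ q → q < d → arrs μ k q ≡ below (suc q) τ

    module _ {X : ℕ → Bool → Set} where

      -- All cells are zero at the start, so the invariant can speak of every cell instead of a
      -- range; the loop preserves this, and its running time remains to be counted.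
      clearCounts : Hoare X (λ s μ → s ≡ 0 × Fresh μ × (∀ q → arrs μ cnt q ≡ 0))
                      (for v below var m ⊕ lit 1 do[ cnt ⟦ var v ⟧≔ lit 0 ])
                      (λ s μ → s ≡ 4 + (M + 1) * 4 × Fresh μ × (∀ q → arrs μ cnt q ≡ 0))
      clearCounts = for-do
        (λ d s μ → s ≡ 4 + d * 4 × Fresh μ × (∀ q → arrs μ cnt q ≡ 0))
        (λ { d _ μ _ (refl , fr , z) → time≡ d , fr , λ q → if-zero (q ≡ᵇ d) (z q) })
        (λ d → store)
        (λ { _ μ (refl , fr@((m≡ , _) , _) , z) → cong (_+ 1) m≡ , refl , fr , z })
        where
          time≡ : ∀ d → 4 + d * 4 + 1 + 3 ≡ 4 + (4 + d * 4)
          time≡ = solve-∀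

      countBottoms : ∀ s₀ → Hoare X (λ s μ → s ≡ s₀ × Fresh μ × (∀ q → arrs μ cnt q ≡ 0))
                      (for j below var n do[ cnt ⟦ cᵇ ! var j ⟧≔ cnt ! (cᵇ ! var j) ⊕ lit 1 ])
                      (λ s μ → s ≡ s₀ + 2 + N * 9 × Fresh μ × (∀ q → arrs μ cnt q ≡ multiplicity q β))
      countBottoms s₀ = for-do
        (λ d s μ → s ≡ s₀ + 2 + d * 9 × Fresh μ × (∀ q → arrs μ cnt q ≡ multiplicity q (cells b₀ d)))
        enter
        (λ d → store)
        (λ { _ μ (refl , fr@((_ , n≡ , _) , _) , z) → n≡ , sym (+-identityʳ (s₀ + 2)) , fr , z })
        where
          time≡ : ∀ d s₀ → s₀ + 2 + d * 9 + 1 + 8 ≡ s₀ + 2 + (9 + d * 9)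
          time≡ = solve-∀
          enter : ∀ d s μ → d < N →
                  s ≡ s₀ + 2 + d * 9 × Fresh μ × (∀ q → arrs μ cnt q ≡ multiplicity q (cells b₀ d)) →
                  let μ′ = setArr cnt (arrs μ cᵇ d) (arrs μ cnt (arrs μ cᵇ d) + 1) (setVar j d μ) in
                  s + 1 + 8 ≡ s₀ + 2 + suc d * 9 × Fresh μ′ × (∀ q → arrs μ′ cnt q ≡ multiplicity q (cells b₀ (suc d)))
          enter d s μ _ (refl , fr@(_ , b≡ , _) , z) = time≡ d s₀ , fr , count
            where
              count : ∀ q → (if q ≡ᵇ arrs μ cᵇ d then arrs μ cnt (arrs μ cᵇ d) + 1 else arrs μ cnt q) ≡
                            ∑< (suc d) (λ x → χ (b₀ x ≡ᵇ q))
              count q = begin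
                _                                                   ≡⟨ if-count (arrs μ cnt) q (arrs μ cᵇ d) ⟩
                arrs μ cnt q + χ (arrs μ cᵇ d ≡ᵇ q)                 ≡⟨ cong₂ (λ x y → x + χ (y ≡ᵇ q)) (z q) (b≡ d) ⟩
                ∑< d (λ x → χ (b₀ x ≡ᵇ q)) + χ (b₀ d ≡ᵇ q)          ≡⟨ ∑<-suc d (λ x → χ (b₀ x ≡ᵇ q)) ⟨
                ∑< (suc d) (λ x → χ (b₀ x ≡ᵇ q))                    ∎
                where open ≡-Reasoning

      writeRun : ∀ x s₀ → Hoare X
        (λ s μ → s ≡ s₀ × Sorting x (below x β) μ × vars μ v ≡ x)
        (for r below cnt ! var v do[ cᵇ ⟦ var pos ⟧≔ var v ⨾ pos ≔ var pos ⊕ lit 1 ])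
        (λ s μ → s ≡ s₀ + 3 + multiplicity x β * 8 × Sorting x (below x β + multiplicity x β) μ × vars μ v ≡ x)
      writeRun x s₀ = for-do
        (λ d s μ → s ≡ s₀ + 3 + d * 8 × Sorting x (below x β + d) μ × vars μ v ≡ x)
        enter
        (λ d → store ⨟ assign)
        (λ { _ μ (refl , so@(_ , _ , cnt≡ , _) , refl) →
             cnt≡ (vars μ v) , sym (+-identityʳ (s₀ + 3)) ,
             subst (λ p → Sorting (vars μ v) p μ) (sym (+-identityʳ _)) so , refl })
        where
          time≡ : ∀ d s₀ → s₀ + 3 + d * 8 + 1 + 3 + 4 ≡ s₀ + 3 + (8 + d * 8)
          time≡ = solve-∀
          step : ∀ C a D p x → C + D ≡ p * x → a ≡ x → C + a + D ≡ suc p * x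
          step C a D p x e refl = trans (lemma C a D) (cong (a +_) e)
            where
              lemma : ∀ C a D → C + a + D ≡ a + (C + D)
              lemma = solve-∀
          enter : ∀ d s μ → d < multiplicity x β →
                  s ≡ s₀ + 3 + d * 8 × Sorting x (below x β + d) μ × vars μ v ≡ x →
                  s + 1 + 3 + 4 ≡ s₀ + 3 + suc d * 8 ×
                  Sorting x (below x β + suc d) (setVar pos (vars μ pos + 1) (setArr cᵇ (vars μ pos) (vars μ v) (setVar r d μ))) ×
                  vars μ v ≡ x
          enter d s μ d<mult (refl , (fr , kz , cnt≡ , pos≡ , C≡ , sorted) , refl) =
            time≡ d s₀ ,
            (fr , kz , cnt≡ , pos≡′ , C≡′ , sorted′) , refl
            where
              p = below x β + d
              μ′ = setArr cᵇ (vars μ pos) x (setVar r d μ)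
              pos≡′ : vars μ pos + 1 ≡ below x β + suc d
              pos≡′ = trans (cong (_+ 1) pos≡) (trans (+-assoc (below x β) d 1) (cong (below x β +_) (+-comm d 1)))
              old : ∀ y → y ≤ p → prefix μ′ y ≡ prefix μ y
              old y y≤p = prefix-store (setVar r d μ) (vars μ pos) y x (subst (y ≤_) (sym pos≡) y≤p)
              C≡″ : prefix μ′ (suc p) + shortfall x β ≡ suc p * x
              C≡″ = trans (cong (_+ shortfall x β) (∑<-suc p (arrs μ′ cᵇ)))
                      (step (prefix μ′ p) (arrs μ′ cᵇ p) (shortfall x β) p x
                        (trans (cong (_+ shortfall x β) (old p ≤-refl)) C≡)
                        (trans (cong (λ q → if p ≡ᵇ q then x else arrs μ cᵇ p) pos≡) (if-same p)))
              C≡′ : prefix μ′ (below x β + suc d) + shortfall x β ≡ (below x β + suc d) * x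
              C≡′ = subst (λ p → prefix μ′ p + shortfall x β ≡ p * x) (sym (+-suc (below x β) d)) C≡″
              sorted′ : ∀ y → y ≤ below x β + suc d → IsPrefixSum β y (prefix μ′ y)
              sorted′ y y≤ with y ≤? p
              ... | yes y≤p = subst (IsPrefixSum β y) (sym (old y y≤p)) (sorted y y≤p)
              -- The one new prefix has length p + 1. Its threshold is x, and p + 1 ≤
              -- `below (suc x) β` because only d < `multiplicity x β` copies of x were written
              -- before.
              ... | no  y≰p
                with refl ← ≤-antisym (≤-trans y≤ (≤-reflexive (+-suc (below x β) d))) (≰⇒> y≰p) =
                x , m≤n⇒m≤1+n (m≤m+n (below x β) d) ,
                subst₂ _≤_ (+-suc (below x β) d) (sym (below-suc x β)) (+-monoʳ-≤ (below x β) d<mult) , C≡″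

      -- The time of the inner loops is charged to the cells written so far, `below x β` of them,
      -- and not to a bound per value. This makes the nested loops linear in total.
      writeSorted : ∀ s₀ → Hoare X
        (λ s μ → s ≡ s₀ × Sorting 0 0 μ)
        (for v below var m ⊕ lit 1 do[
          for r below cnt ! var v do[ cᵇ ⟦ var pos ⟧≔ var v ⨾ pos ≔ var pos ⊕ lit 1 ] ])
        (λ s μ → s ≡ s₀ + 4 + (M + 1) * 4 + below (M + 1) β * 8 × Sorting (M + 1) (below (M + 1) β) μ)
      writeSorted s₀ = for-do
        (λ x s μ → s ≡ s₀ + 4 + x * 4 + below x β * 8 × Sorting x (below x β) μ)
        (λ { x _ μ _ (refl , so) → refl , so , refl })
        (λ x → consequence (λ _ _ pre → pre) (advance x) (writeRun x (s₀ + 4 + x * 4 + below x β * 8 + 1)))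
        (λ { _ μ (refl , so@((m≡ , _) , _)) → cong (_+ 1) m≡ ,
             trans (lemma s₀) (cong (λ y → s₀ + 4 + 0 + y * 8) (sym (below-0 β))) ,
             subst (λ p → Sorting 0 p μ) (sym (below-0 β)) so })
        where
          lemma : ∀ s → s + 4 ≡ s + 4 + 0 + 0
          lemma = solve-∀
          time≡ : ∀ x s₀ a b → s₀ + 4 + x * 4 + a * 8 + 1 + 3 + b * 8 ≡ s₀ + 4 + (4 + x * 4) + (a + b) * 8
          time≡ = solve-∀
          step : ∀ C D P x D′ → C + D ≡ P * x → D′ ≡ D + P → C + D′ ≡ P * suc x
          step C D P x D′ e refl = trans (sym (+-assoc C D P)) (trans (cong (_+ P) e) (trans (+-comm (P * x) P) (sym (*-suc P x))))
          advance : ∀ x s μ →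
            s ≡ s₀ + 4 + x * 4 + below x β * 8 + 1 + 3 + multiplicity x β * 8 ×
              Sorting x (below x β + multiplicity x β) μ × vars μ v ≡ x →
            s ≡ s₀ + 4 + suc x * 4 + below (suc x) β * 8 × Sorting (suc x) (below (suc x) β) μ
          advance x _ μ (refl , (fr , kz , cnt≡ , pos≡ , C≡ , sorted) , _) =
            trans (time≡ x s₀ (below x β) (multiplicity x β))
                  (cong (λ y → s₀ + 4 + suc x * 4 + y * 8) (sym (below-suc x β))) ,
            subst (λ p → Sorting (suc x) p μ) (sym (below-suc x β))
              (fr , kz , cnt≡ , pos≡ ,
               step (prefix μ (below x β + multiplicity x β)) (shortfall x β) _ x (shortfall (suc x) β) C≡
                 (trans (shortfall-suc x β) (cong (shortfall x β +_) (below-suc x β))) , sorted)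

      sort : Hoare X (λ s μ → s ≡ 0 × Fresh μ × (∀ q → arrs μ cnt q ≡ 0)) sortBottoms
                     (λ s μ → s ≡ 14 + M * 8 + N * 17 + 6 × (∀ q → arrs μ k′ q ≡ 0) × Sorted μ)
      sort = clearCounts ⨟ countBottoms _ ⨟ consequence begin-sorting (λ _ _ q → q) assign ⨟
             consequence (λ _ _ p → p) finish (writeSorted s₁)
        where
          s₁ = 4 + (M + 1) * 4 + 2 + N * 9 + 2
          begin-sorting : ∀ s μ → s ≡ 4 + (M + 1) * 4 + 2 + N * 9 × Fresh μ × (∀ q → arrs μ cnt q ≡ multiplicity q β) →
                          s + 2 ≡ s₁ × Sorting 0 0 (setVar pos 0 μ)
          begin-sorting s μ (refl , (fr , _ , kz) , cnt≡) =
            refl , fr , kz , cnt≡ , refl , shortfall-0 β ,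
            λ { zero z≤n → 0 , ≤-reflexive (below-0 β) , z≤n , shortfall-0 β }
          time≡ : ∀ A B → 4 + (A + 1) * 4 + 2 + B * 9 + 2 + 4 + (A + 1) * 4 + B * 8 ≡ 14 + A * 8 + B * 17 + 6
          time≡ = solve-∀
          finish : ∀ s μ → s ≡ s₁ + 4 + (M + 1) * 4 + below (M + 1) β * 8 × Sorting (M + 1) (below (M + 1) β) μ →
                   s ≡ 14 + M * 8 + N * 17 + 6 × (∀ q → arrs μ k′ q ≡ 0) × Sorted μ
          finish s μ (refl , fr , kz , _ , _ , _ , sorted) =
            trans (cong (λ y → s₁ + 4 + (M + 1) * 4 + y * 8) all) (time≡ M N) ,
            kz , fr , subst (SortedTo μ) all sorted
            where
              -- Stability bounds the entries by M, so the values 0, ..., M account for all N of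
              -- them.
              all : below (M + 1) β ≡ N
              all = below-all (M + 1) (λ x → subst (β x <_) (+-comm 1 M) (β≤M x))

      clearK : ∀ s₀ → Hoare X (λ s μ → s ≡ s₀ × (∀ q → arrs μ k′ q ≡ 0) × Sorted μ)
                      (for l below var n do[ k′ ⟦ var l ⟧≔ lit 0 ])
                      (λ s μ → s ≡ s₀ + 2 + N * 4 × (∀ q → arrs μ k′ q ≡ 0) × Sorted μ)
      clearK s₀ = for-do
        (λ d s μ → s ≡ s₀ + 2 + d * 4 × (∀ q → arrs μ k′ q ≡ 0) × Sorted μ)
        (λ { d _ μ _ (refl , z , so) → time≡ d s₀ , (λ q → if-zero (q ≡ᵇ d) (z q)) , so })
        (λ d → store)
        (λ { _ μ (refl , z , so@((_ , n≡ , _) , _)) → n≡ , sym (+-identityʳ (s₀ + 2)) , z , so })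
        where
          time≡ : ∀ d s₀ → s₀ + 2 + d * 4 + 1 + 3 ≡ s₀ + 2 + (4 + d * 4)
          time≡ = solve-∀

      countTops : ∀ s₀ → Hoare X (λ s μ → s ≡ s₀ × (∀ q → arrs μ k′ q ≡ 0) × Sorted μ)
                      (for i below var m do[ k′ ⟦ cᵗ ! var i ⟧≔ k′ ! (cᵗ ! var i) ⊕ lit 1 ])
                      (λ s μ → s ≡ s₀ + 2 + M * 9 × (∀ q → arrs μ k′ q ≡ multiplicity q τ) × Sorted μ)
      countTops s₀ = for-do
        (λ d s μ → s ≡ s₀ + 2 + d * 9 × (∀ q → arrs μ k′ q ≡ multiplicity q (cells t₀ d)) × Sorted μ)
        enter
        (λ d → store)
        (λ { _ μ (refl , z , so@((m≡ , _) , _)) → m≡ , sym (+-identityʳ (s₀ + 2)) , z , so })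
        where
          time≡ : ∀ d s₀ → s₀ + 2 + d * 9 + 1 + 8 ≡ s₀ + 2 + (9 + d * 9)
          time≡ = solve-∀
          enter : ∀ d s μ → d < M →
                  s ≡ s₀ + 2 + d * 9 × (∀ q → arrs μ k′ q ≡ multiplicity q (cells t₀ d)) × Sorted μ →
                  let μ′ = setArr k′ (arrs μ cᵗ d) (arrs μ k′ (arrs μ cᵗ d) + 1) (setVar i d μ) in
                  s + 1 + 8 ≡ s₀ + 2 + suc d * 9 × (∀ q → arrs μ′ k′ q ≡ multiplicity q (cells t₀ (suc d))) × Sorted μ′
          enter d s μ _ (refl , z , so@((_ , _ , t≡) , _)) = time≡ d s₀ , count , so
            where
              count : ∀ q → (if q ≡ᵇ arrs μ cᵗ d then arrs μ k′ (arrs μ cᵗ d) + 1 else arrs μ k′ q) ≡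
                            ∑< (suc d) (λ x → χ (t₀ x ≡ᵇ q))
              count q = begin
                _                                                   ≡⟨ if-count (arrs μ k′) q (arrs μ cᵗ d) ⟩
                arrs μ k′ q + χ (arrs μ cᵗ d ≡ᵇ q)                  ≡⟨ cong₂ (λ x y → x + χ (y ≡ᵇ q)) (z q) (t≡ d) ⟩
                ∑< d (λ x → χ (t₀ x ≡ᵇ q)) + χ (t₀ d ≡ᵇ q)          ≡⟨ ∑<-suc d (λ x → χ (t₀ x ≡ᵇ q)) ⟨
                ∑< (suc d) (λ x → χ (t₀ x ≡ᵇ q))                    ∎
                where open ≡-Reasoning

      accumulate : ∀ s₀ → Hoare X
        (λ s μ → s ≡ s₀ × vars μ acc ≡ 0 × (∀ q → arrs μ k′ q ≡ multiplicity q τ) × Sorted μ)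
        (for j below var n do[ acc ≔ var acc ⊕ k′ ! var j ⨾ k ⟦ var j ⟧≔ var acc ])
        (λ s μ → s ≡ s₀ + 2 + N * 9 × HasK N μ × Sorted μ)
      accumulate s₀ = consequence (λ _ _ p → p) (λ { _ _ (s≡ , _ , hk , _ , so) → s≡ , hk , so }) (for-do
        (λ d s μ → s ≡ s₀ + 2 + d * 9 × vars μ acc ≡ below d τ × HasK d μ ×
                   (∀ q → arrs μ k′ q ≡ multiplicity q τ) × Sorted μ)
        enter
        (λ d → assign ⨟ store)
        (λ { _ μ (refl , acc≡ , z , so@((_ , n≡ , _) , _)) →
             n≡ , sym (+-identityʳ (s₀ + 2)) , trans acc≡ (sym (below-0 τ)) , (λ _ ()) , z , so }))
        where
          time≡ : ∀ d s₀ → s₀ + 2 + d * 9 + 1 + 5 + 3 ≡ s₀ + 2 + (9 + d * 9)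
          time≡ = solve-∀
          enter : ∀ d s μ → d < N → s ≡ s₀ + 2 + d * 9 × vars μ acc ≡ below d τ × HasK d μ ×
                      (∀ q → arrs μ k′ q ≡ multiplicity q τ) × Sorted μ →
                  let a  = vars μ acc + arrs μ k′ d
                      μ′ = setArr k d a (setVar acc a (setVar j d μ))
                  in s + 1 + 5 + 3 ≡ s₀ + 2 + suc d * 9 × vars μ′ acc ≡ below (suc d) τ × HasK (suc d) μ′ ×
                     (∀ q → arrs μ′ k′ q ≡ multiplicity q τ) × Sorted μ′
          enter d s μ d<N (refl , acc≡ , hk , z , so) = time≡ d s₀ , acc≡′ , hk′ , z , so
            where
              a  = vars μ acc + arrs μ k′ d
              acc≡′ : a ≡ below (suc d) τ
              acc≡′ = trans (cong₂ _+_ acc≡ (z d)) (sym (below-suc d τ))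
              hk′ : ∀ q → q < suc d → (if q ≡ᵇ d then a else arrs μ k q) ≡ below (suc q) τ
              hk′ q q<1+d with q ≟ d
              ... | yes refl = trans (if-same q) acc≡′
              ... | no q≢d   = trans (if-other q≢d) (hk q (≤∧≢⇒< (≤-pred q<1+d) q≢d))

      computed : ∀ s₀ → Hoare X (λ s μ → s ≡ s₀ × (∀ q → arrs μ k′ q ≡ 0) × Sorted μ) computeK
                                (λ s μ → s ≡ s₀ + 8 + M * 9 + N * 13 × HasK N μ × Sorted μ)
      computed s₀ = clearK s₀ ⨟ countTops _ ⨟
        consequence {Q = λ s μ → s ≡ s₀ + 2 + N * 4 + 2 + M * 9 + 2 × vars μ acc ≡ 0 × (∀ q → arrs μ k′ q ≡ multiplicity q τ) × Sorted μ}
          (λ { _ μ (refl , z , so) → refl , refl , z , so }) (λ _ _ q → q) assign ⨟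
        consequence (λ _ _ p → p) (λ { _ _ (refl , post) → time≡ s₀ M N , post }) (accumulate _)
        where
          time≡ : ∀ s A B → s + 2 + B * 4 + 2 + A * 9 + 2 + 2 + B * 9 ≡ s + 8 + A * 9 + B * 13
          time≡ = solve-∀

    -- The time is bounded and not determined, because the comparison may stop early.
    Verdict : ℕ → ℕ → Bool → Set
    Verdict bound s b = s ≤ bound × (b ≡ true ⇔ Good τ β)

    compared : ∀ s₀ → Hoare (Verdict (s₀ + 7 + N * 14)) (λ s μ → s ≡ s₀ × HasK N μ × Sorted μ)
                            compareSums (λ _ _ → ⊥)
    compared s₀ = consequence start (λ _ _ q → q)
      (assign ⨟ assign ⨟
      for-do Inv enter (λ d → assign ⨟ assign ⨟ return-if) {P = λ s μ → Inv 0 (s + 2) μ} (λ { _ _ inv@(_ , _ , _ , _ , _ , (_ , n≡ , _) , _) → n≡ , inv }) ⨟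
      consequence finish (λ _ _ q → q) return-now)
      where
        Inv : ℕ → Assertion
        Inv d s μ = s ≡ s₀ + 6 + d * 14 × vars μ sumK ≡ shortfall d τ × vars μ sumC ≡ prefix μ d ×
                    (∀ x → x ≤ d → shortfall x τ ≤ prefix μ x) × HasK N μ × Sorted μ
        start : ∀ s μ → s ≡ s₀ × HasK N μ × Sorted μ → Inv 0 (s + 2 + 2 + 2) (setVar sumC 0 (setVar sumK 0 μ))
        start s μ (refl , hk , so) =
          time≡ s₀ , sym (shortfall-0 τ) , refl ,
          (λ { zero z≤n → ≤-reflexive (shortfall-0 τ) }) , hk , so
          where
            time≡ : ∀ s → s + 2 + 2 + 2 ≡ s + 6 + 0
            time≡ = solve-∀
        enter : ∀ d s μ → d < N → Inv d s μ →
          let C  = vars μ sumC + arrs μ cᵇ d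
              K  = vars μ sumK + arrs μ k d
              s′ = s + 1 + 5 + 5 + 3
          in (C < K → Verdict (s₀ + 7 + N * 14) s′ false) ×
             (K ≤ C → Inv (suc d) s′ (setVar sumC C (setVar sumK K (setVar j d μ))))
        enter d s μ d<N (refl , sumK≡ , sumC≡ , ok , hk , so@(_ , sorted)) =
          (λ C<K → ≤-trans (≤-trans (≤-reflexive (time≡ d s₀)) (+-monoʳ-≤ (s₀ + 6) (*-monoˡ-≤ 14 d<N)))
                           (+-monoˡ-≤ (N * 14) (+-monoʳ-≤ s₀ (n≤1+n 6))) ,
                   -- Here the prefix condition fails at length d + 1, which goodness would
                   -- guarantee.
                   mk⇔ (λ ()) (λ good → contradiction
                     (from (prefix⇔good τ β (prefix μ) sorted) good (suc d) d<N)
                     (<⇒≱ (subst₂ _<_ C≡ K≡ C<K)))) ,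
          (λ K≤C → time≡ d s₀ , K≡ , C≡ , extend K≤C , hk , so)
          where
            time≡ : ∀ d s → s + 6 + d * 14 + 1 + 5 + 5 + 3 ≡ s + 6 + (14 + d * 14)
            time≡ = solve-∀
            open Equivalence
            C≡ : vars μ sumC + arrs μ cᵇ d ≡ prefix μ (suc d)
            C≡ = trans (cong (_+ arrs μ cᵇ d) sumC≡) (sym (∑<-suc d (arrs μ cᵇ)))
            K≡ : vars μ sumK + arrs μ k d ≡ shortfall (suc d) τ
            K≡ = trans (cong₂ _+_ sumK≡ (hk d d<N)) (sym (shortfall-suc d τ))
            extend : vars μ sumK + arrs μ k d ≤ vars μ sumC + arrs μ cᵇ d →
                     ∀ x → x ≤ suc d → shortfall x τ ≤ prefix μ x
            extend K≤C x x≤ with x ≟ suc d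
            ... | yes refl = subst₂ _≤_ K≡ C≡ K≤C
            ... | no  x≢   = ok x (≤-pred (≤∧≢⇒< x≤ x≢))
        finish : ∀ s μ → Inv N s μ → Verdict (s₀ + 7 + N * 14) (s + 1) true
        finish s μ (refl , _ , _ , ok , _ , (_ , sorted)) =
          ≤-reflexive (time≡ s₀ N) ,
          mk⇔ (λ _ → Equivalence.to (prefix⇔good τ β (prefix μ) sorted) ok) (λ _ → refl)
          where
            time≡ : ∀ s B → s + 6 + B * 14 + 1 ≡ s + 7 + B * 14
            time≡ = solve-∀

    verified : Hoare (Verdict (35 + M * 17 + N * 44)) (λ s μ → s ≡ 0 × Fresh μ × (∀ q → arrs μ cnt q ≡ 0))
                     algorithm (λ _ _ → ⊥)
    verified = sort ⨟ computed _ ⨟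
      subst (λ B → Hoare (Verdict B) (λ s μ → s ≡ s₀ × HasK N μ × Sorted μ) compareSums (λ _ _ → ⊥))
            (time≡ M N) (compared s₀)
      where
        s₀ = 14 + M * 8 + N * 17 + 6 + 8 + M * 9 + N * 13
        time≡ : ∀ A B → 14 + A * 8 + B * 17 + 6 + 8 + A * 9 + B * 13 + 7 + B * 14 ≡ 35 + A * 17 + B * 44
        time≡ = solve-∀

    verdict : ∃[ b ] result (runAlgorithm c) ≡ just b × Verdict (35 + M * 17 + N * 44) (time (runAlgorithm c)) b
    verdict = always-returns (outcome verified 0 (load c)
      (refl , ((refl , refl , λ _ → refl) , (λ _ → refl) , λ _ → refl) , λ _ → refl))
      where
        always-returns : ∀ {X r} → Outcome X (λ _ _ → ⊥) r → ∃[ b ] result r ≡ just b × X (time r) b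
        always-returns (normal ())
        always-returns (returned x) = _ , refl , x

    good⇔ : Good τ β ⇔ Good (grains c ∘ inj₁) (grains c ∘ inj₂)
    good⇔ = mk⇔ (good-mono (λ x → ≤-reflexive (toArray-lookup (tops c) x)) (λ x → ≤-reflexive (toArray-lookup (bottoms c) x)))
                (good-mono (λ x → ≤-reflexive (sym (toArray-lookup (tops c) x))) (λ x → ≤-reflexive (sym (toArray-lookup (bottoms c) x))))

    algorithm⇔good : result (runAlgorithm c) ≡ just true ⇔ Good (grains c ∘ inj₁) (grains c ∘ inj₂)
    algorithm⇔good = conclude (result (runAlgorithm c)) (proj₁ (proj₂ verdict)) (proj₂ (proj₂ (proj₂ verdict)))
      where
        open Equivalence
        conclude : ∀ {b} r → r ≡ just b → (b ≡ true ⇔ Good τ β) →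
                   r ≡ just true ⇔ Good (grains c ∘ inj₁) (grains c ∘ inj₂)
        conclude _ refl correct = mk⇔ (λ e → to good⇔ (to correct (just-injective e)))
                                      (λ good → cong just (from correct (from good⇔ good)))

    algorithm-time : .{{_ : NonZero N}} → time (runAlgorithm c) ≤ 79 * (M + N)
    algorithm-time = ≤-trans (proj₁ (proj₂ (proj₂ verdict))) (begin
      -- As N ≥ 1, the constant 35 is at most 35 N, and 35 + 44 = 79; the coefficient of M is
      -- rounded up to match.
      35 + M * 17 + N * 44     ≤⟨ +-monoˡ-≤ (N * 44) (+-mono-≤ (*-monoˡ-≤ 35 (>-nonZero⁻¹ N)) (*-monoʳ-≤ M (m≤m+n 17 62))) ⟩
      N * 35 + M * 79 + N * 44 ≡⟨ collect M N ⟩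
      79 * (M + N)             ∎)
      where
        open ≤-Reasoning
        collect : ∀ A B → B * 35 + A * 79 + B * 44 ≡ 79 * (A + B)
        collect = solve-∀

-- Goodness under toppling and untoppling

module Toppling where
  open import Data.Bool using (Bool; true; false; not; T; if_then_else_)
  open import Data.Fin as Fin using (Fin)
  open import Data.Nat
  open import Data.Nat.Properties
  open import Data.Nat.Tactic.RingSolver using (solve-∀)
  open import Data.Product using (_×_; _,_; proj₁; proj₂; ∃-syntax)
  open import Data.Sum using (_⊎_; inj₁; inj₂)
  open import Function using (_∘_)
  open import Relation.Binary.PropositionalEquality
  open import Relation.Nullary using (does; yes; no; contradiction)
  open Sums
  open Goodness

  module _ {n : ℕ} where
    insert remove : Fin n → (Fin n → Bool) → Fin n → Bool
    insert j J i = if does (i Fin.≟ j) then true  else J i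
    remove j J i = if does (i Fin.≟ j) then false else J i

    insert-self : ∀ j J → insert j J j ≡ true
    insert-self j J with j Fin.≟ j
    ... | yes _ = refl
    ... | no j≢j = contradiction refl j≢j

    remove-self : ∀ j J → remove j J j ≡ false
    remove-self j J with j Fin.≟ j
    ... | yes _ = refl
    ... | no j≢j = contradiction refl j≢j

    insert-remove : ∀ j J i → J j ≡ true → insert j (remove j J) i ≡ J i
    insert-remove j J i Jj with i Fin.≟ j
    ... | yes refl = sym Jj
    ... | no _     = refl

    module _ (J : Fin n → Bool) {j : Fin n} (j∉J : J j ≡ false) where

      insert-other : ∀ i → i ≢ j → insert j J i ≡ J i
      insert-other i i≢j with i Fin.≟ j
      ... | yes i≡j = contradiction i≡j i≢j
      ... | no _    = refl

      size-insert : size (insert j J) ≡ suc (size J)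
      size-insert = begin
        size (insert j J)              ≡⟨ +-identityʳ _ ⟨
        size (insert j J) + 0          ≡⟨ cong (λ b → size (insert j J) + χ b) j∉J ⟨
        size (insert j J) + χ (J j)    ≡⟨ ∑-update _ _ j (λ i i≢j → cong χ (insert-other i i≢j)) ⟩
        size J + χ (insert j J j)      ≡⟨ cong (λ b → size J + χ b) (insert-self j J) ⟩
        size J + 1                     ≡⟨ +-comm _ 1 ⟩
        suc (size J)                   ∎
        where open ≡-Reasoning

      weight-insert : ∀ f → weight (insert j J) f ≡ weight J f + f j
      weight-insert f = begin
        weight (insert j J) f                    ≡⟨ +-identityʳ _ ⟨
        weight (insert j J) f + 0                ≡⟨ cong (λ b → weight (insert j J) f + χ b * f j) j∉J ⟨
        weight (insert j J) f + χ (J j) * f j    ≡⟨ ∑-update _ _ j (λ i i≢j → cong (λ b → χ b * f i) (insert-other i i≢j)) ⟩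
        weight J f + χ (insert j J j) * f j      ≡⟨ cong (λ b → weight J f + χ b * f j) (insert-self j J) ⟩
        weight J f + 1 * f j                     ≡⟨ cong (weight J f +_) (*-identityˡ (f j)) ⟩
        weight J f + f j                         ∎
        where open ≡-Reasoning

      weight-elsewhere : ∀ {f g : Fin n → ℕ} → (∀ i → i ≢ j → f i ≡ g i) → weight J f ≡ weight J g
      weight-elsewhere {f} {g} same = sum-cong-≗ pointwise
        where
          pointwise : ∀ i → χ (J i) * f i ≡ χ (J i) * g i
          pointwise i with i Fin.≟ j
          ... | yes refl rewrite j∉J = refl
          ... | no  i≢j  = cong (χ (J i) *_) (same i i≢j)

    module _ {m} {t : Fin m → ℕ} {b : Fin n → ℕ} (j : Fin n) where

      good-with : Good t b → ∀ J → J j ≡ false → shortfall (suc (size J)) t ≤ weight J b + b j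
      good-with good J j∉J = subst₂ (λ a w → shortfall a t ≤ w) (size-insert J j∉J) (weight-insert J j∉J b)
                                    (good (insert j J))

      -- Isolates the bottom vertex j whose grains change: a set containing j is a set avoiding j
      -- with j inserted.
      good-cases : (∀ J → J j ≡ false → shortfall (size J) t ≤ weight J b ×
                                        shortfall (suc (size J)) t ≤ weight J b + b j) → Good t b
      good-cases h J with J j in Jj
      ... | false = proj₁ (h J Jj)
      ... | true  = subst₂ (λ a w → shortfall a t ≤ w)
        (trans (sym (size-insert J⁻ j∉J⁻)) (sum-cong-≗ (λ i → cong χ (insert-remove j J i Jj))))
        (trans (sym (weight-insert J⁻ j∉J⁻ b)) (sum-cong-≗ (λ i → cong (λ x → χ x * b i) (insert-remove j J i Jj))))
        (proj₂ (h J⁻ j∉J⁻))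
        where
          J⁻ = remove j J
          j∉J⁻ = remove-self j J

    -- Sets avoiding j only profit. When j joins J, the threshold rises by one; the top vertices in
    -- K absorb this with the grain just received, and the others cost at most one each, which the
    -- grains left on j pay for. The hypothesis on `b′ j` reflects that an unstable j has at least m
    -- + 1 grains and sends at most one to the sink.
    send-bottom-good : ∀ {m} {t t′ : Fin m → ℕ} {b b′ : Fin n → ℕ} j (K : Fin m → Bool) →
      (∀ i → t′ i ≡ t i + χ (K i)) → (∀ i → i ≢ j → b′ i ≡ b i) → size (not ∘ K) ≤ b′ j →
      Good t b → Good t′ b′
    send-bottom-good {t = t} {t′} {b} {b′} j K t′≡ b′≡ K≤ good = good-cases {t = t′} {b′} j λ J j∉J →
      let weight≡ = weight-elsewhere J j∉J b′≡ in
      ≤-trans (shortfall-anti (size J) (λ i → ≤-trans (m≤m+n (t i) _) (≤-reflexive (sym (t′≡ i)))))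
              (≤-trans (good J) (≤-reflexive (sym weight≡))) ,
      ≤-trans (∑-+-mono (λ i → ≤-trans (≤-reflexive (cong (suc (size J) ∸_) (t′≡ i))) (step (size J) (t i) (K i))))
              (+-mono-≤ (≤-trans (good J) (≤-reflexive (sym weight≡))) K≤)
      where
        step : ∀ a x k → suc a ∸ (x + χ k) ≤ a ∸ x + χ (not k)
        step a x true  = ≤-reflexive (trans (cong (suc a ∸_) (+-comm x 1)) (sym (+-identityʳ _)))
        step a x false = ≤-trans (≤-reflexive (cong (suc a ∸_) (+-identityʳ x)))
                          (≤-trans (m≤n+o⇒m∸n≤o (suc a) x (≤-trans (s≤s (m≤n+m∸n a x)) (≤-reflexive (sym (+-suc x (a ∸ x)))))) (≤-reflexive (+-comm 1 _)))

    -- With at least n grains, vertex i contributes nothing to the shortfall at |J| ≤ n. Afterwards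
    -- it contributes at most |J| - (n - |K|), and by inclusion and exclusion this is at most |J ∩
    -- K|, the number of grains that J receives.
    send-top-good : ∀ {m} {t t′ : Fin m → ℕ} {b b′ : Fin n → ℕ} i (K : Fin n → Bool) →
      (∀ i′ → i′ ≢ i → t′ i′ ≡ t i′) → t′ i ≡ t i ∸ size K → n ≤ t i → (∀ j → b′ j ≡ b j + χ (K j)) →
      Good t b → Good t′ b′
    send-top-good {t = t} {t′} {b} {b′} i K t′≡ t′i≡ n≤ b′≡ good J = begin
      shortfall a t′                       ≡⟨ +-identityʳ _ ⟨
      shortfall a t′ + 0                   ≡⟨ cong (shortfall a t′ +_) (m≤n⇒m∸n≡0 (≤-trans (size≤ J) n≤)) ⟨
      shortfall a t′ + (a ∸ t i)           ≡⟨ ∑-update _ _ i (λ i′ i′≢i → cong (a ∸_) (t′≡ i′ i′≢i)) ⟩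
      shortfall a t + (a ∸ t′ i)           ≡⟨ cong (λ x → shortfall a t + (a ∸ x)) t′i≡ ⟩
      shortfall a t + (a ∸ (t i ∸ size K)) ≤⟨ +-mono-≤ (good J) gain ⟩
      weight J b + weight J (χ ∘ K)        ≡⟨ ∑-+-cong (λ j → trans (cong (χ (J j) *_) (b′≡ j)) (*-distribˡ-+ (χ (J j)) (b j) (χ (K j)))) ⟨
      weight J b′                          ∎
      where
        open ≤-Reasoning
        a = size J
        common : a + size K ≤ n + weight J (χ ∘ K)
        common = begin
          a + size K                                  ≡⟨ ∑-distrib-+ (χ ∘ J) (χ ∘ K) ⟨
          ∑ (λ j → χ (J j) + χ (K j))                 ≤⟨ ∑-+-mono (λ j → bool (J j) (K j)) ⟩
          ∑ {n} (λ _ → 1) + weight J (χ ∘ K)          ≡⟨ cong (_+ weight J (χ ∘ K)) (trans (∑-const n 1) (*-identityʳ n)) ⟩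
          n + weight J (χ ∘ K)                        ∎
          where
            bool : ∀ x y → χ x + χ y ≤ 1 + χ x * χ y
            bool true  true  = ≤-refl
            bool true  false = ≤-refl
            bool false true  = ≤-refl
            bool false false = z≤n
        gain : a ∸ (t i ∸ size K) ≤ weight J (χ ∘ K)
        gain = ≤-trans (∸-monoʳ-≤ a (∸-monoˡ-≤ (size K) n≤))
          (m≤n+o⇒m∸n≤o a (n ∸ size K) (+-cancelʳ-≤ (size K) _ _ (≤-trans common (≤-reflexive (move n (size K) (weight J (χ ∘ K)) (size≤ K))))))
          where
            move : ∀ n k w → k ≤ n → n + w ≡ n ∸ k + w + k
            move n k w k≤n = trans (cong (_+ w) (sym (m∸n+n≡m k≤n))) (swap (n ∸ k) k w)
              where
                swap : ∀ x k w → x + k + w ≡ x + w + k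
                swap = solve-∀

    -- The last toppling of j is undone by taking a grain back from the top
    -- vertices outside J₀, which are those with the most grains.
    module Untopple {m} {t : Fin m → ℕ} {b : Fin n → ℕ} (good : Good t b) (j : Fin n)
                    {v : ℕ} {J₀ : Fin m → Bool} (sep : Separates v J₀ t)
                    (sz : size (not ∘ J₀) ≡ 0 ⊎ size J₀ ≡ b j) where

      K : Fin m → Bool
      K = not ∘ J₀

      -- The increase of the shortfall at threshold a when each vertex of K gives up a grain: a
      -- vertex holding more than a grains can lose one without effect.
      low : ℕ → ℕ
      low a = ∑ (λ i → χ (K i) * χ (t i <ᵇ suc a))

      low≤ : ∀ a → low a ≤ size K
      low≤ a = ∑-mono (λ i → ≤-trans (*-monoʳ-≤ (χ (K i)) (χ≤1 (t i <ᵇ suc a))) (≤-reflexive (*-identityʳ _)))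

      -- The slack that makes untoppling possible. If v > a := |J|, every vertex of K holds more
      -- than a grains and `low a` vanishes. If v ≤ a, all of J₀ lies at or below a, so the
      -- shortfall at a + 1 exceeds that at a by |J₀| + `low a`. With |J₀| = b j, goodness of J with
      -- j inserted gives the claim after b j is cancelled.
      good+low : ∀ J → J j ≡ false → shortfall (size J) t + low (size J) ≤ weight J b
      good+low J j∉J with v ≤? size J
      ... | no v≰a = ≤-trans (≤-reflexive (trans (cong (shortfall a t +_) none) (+-identityʳ _))) (good J)
        where
          a = size J
          none : low a ≡ 0
          none = trans (sum-cong-≗ zero-term) (∑-zero {m})
            where
              zero-term : ∀ i → χ (K i) * χ (t i <ᵇ suc a) ≡ 0
              zero-term i with J₀ i | sep i
              ... | true  | _       = refl
              ... | false | _ , v≤t = trans (*-identityˡ _)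
                (χ-¬T (λ t<1+a → v≰a (≤-trans (v≤t _) (≤-pred (<ᵇ⇒< (t i) (suc a) t<1+a)))))
      ... | yes v≤a = by-size sz
        where
          open ≤-Reasoning
          a = size J
          swap : ∀ x l b → x + l + b ≡ x + (b + l)
          swap = solve-∀
          split : ∀ i → χ (t i <ᵇ suc a) ≡ χ (J₀ i) + χ (K i) * χ (t i <ᵇ suc a)
          split i with J₀ i | sep i
          ... | true  | t≤v , _ = χ-T (<⇒<ᵇ (s≤s (≤-trans (t≤v _) v≤a)))
          ... | false | _       = sym (*-identityˡ _)
          by-size : size K ≡ 0 ⊎ size J₀ ≡ b j → shortfall a t + low a ≤ weight J b
          by-size (inj₁ K≡0)  = ≤-trans (≤-reflexive (trans (cong (shortfall a t +_)
            (n≤0⇒n≡0 (≤-trans (low≤ a) (≤-reflexive K≡0)))) (+-identityʳ _))) (good J)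
          by-size (inj₂ J₀≡b) = +-cancelʳ-≤ (b j) _ _ (begin
            shortfall a t + low a + b j       ≡⟨ swap (shortfall a t) (low a) (b j) ⟩
            shortfall a t + (b j + low a)     ≡⟨ cong (λ x → shortfall a t + (x + low a)) J₀≡b ⟨
            shortfall a t + (size J₀ + low a) ≡⟨ cong (shortfall a t +_) (∑-+-cong split) ⟨
            shortfall a t + below (suc a) t   ≡⟨ shortfall-suc a t ⟨
            shortfall (suc a) t               ≤⟨ good-with {t = t} {b} j good J j∉J ⟩
            weight J b + b j                  ∎)

      -- For sets avoiding j, `good+low` pays for the lost grains. For sets containing j the loss is
      -- at most |K|, covered by the grains that j takes back.
      untopple-good : ∀ {t′ : Fin m → ℕ} {b′ : Fin n → ℕ} → (∀ i → t′ i ≡ t i ∸ χ (K i)) →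
                      (∀ i → i ≢ j → b′ i ≡ b i) → b j + size K ≤ b′ j → Good t′ b′
      untopple-good {t′} {b′} t′≡ b′≡ grow = good-cases {t = t′} {b′} j λ J j∉J →
        let weight≡ = weight-elsewhere J j∉J b′≡ in
        ≤-trans (∑-+-mono (λ i → ≤-trans (≤-reflexive (cong (size J ∸_) (t′≡ i))) (few (size J) (t i) (K i))))
                (≤-trans (good+low J j∉J) (≤-reflexive (sym weight≡))) ,
        (begin
          shortfall (suc (size J)) t′          ≤⟨ ∑-+-mono (λ i → ≤-trans (≤-reflexive (cong (suc (size J) ∸_) (t′≡ i))) (all (suc (size J)) (t i) (K i))) ⟩
          shortfall (suc (size J)) t + size K  ≤⟨ +-monoˡ-≤ (size K) (good-with {t = t} {b} j good J j∉J) ⟩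
          weight J b + b j + size K            ≡⟨ +-assoc (weight J b) _ _ ⟩
          weight J b + (b j + size K)          ≤⟨ +-mono-≤ (≤-reflexive (sym weight≡)) grow ⟩
          weight J b′ + b′ j                   ∎)
        where
          open ≤-Reasoning
          all : ∀ a x k → a ∸ (x ∸ χ k) ≤ a ∸ x + χ k
          all a x       false = ≤-reflexive (sym (+-identityʳ _))
          all a zero    true  = m≤m+n a 1
          all a (suc x) true  = pred-step a x
            where
              pred-step : ∀ a x → a ∸ x ≤ a ∸ suc x + 1
              pred-step a x = ≤-trans (suc-pred-≤ (a ∸ x)) (≤-reflexive (trans (cong suc (pred[m∸n]≡m∸[1+n] a x)) (+-comm 1 _)))
                where
                  suc-pred-≤ : ∀ y → y ≤ suc (pred y)
                  suc-pred-≤ zero    = z≤n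
                  suc-pred-≤ (suc y) = ≤-refl
          few : ∀ a x k → a ∸ (x ∸ χ k) ≤ a ∸ x + χ k * χ (x <ᵇ suc a)
          few a x false = ≤-reflexive (sym (+-identityʳ _))
          few a x true with x ≤? a
          ... | yes x≤a = ≤-trans (all a x true) (≤-reflexive (cong (a ∸ x +_)
                            (sym (trans (*-identityˡ _) (χ-T (<⇒<ᵇ (s≤s x≤a)))))))
          ... | no  x≰a = ≤-trans (≤-reflexive (m≤n⇒m∸n≡0 (∸-monoˡ-≤ 1 (≰⇒> x≰a)))) z≤n

      -- `good+low` for the empty set forces `low 0` to vanish, so no empty vertex is asked for a
      -- grain.
      positive : ∀ i → T (K i) → 1 ≤ t i
      positive i i∈K = n≢0⇒n>0 λ t≡0 → contradiction
        (≤-trans (≤-reflexive (sym (trans (cong (λ x → x * χ (t i <ᵇ 1)) (χ-T i∈K)) (trans (*-identityˡ _) (cong (λ x → χ (x <ᵇ 1)) t≡0)))))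
          (≤-trans (∑-≥ (λ i → χ (K i) * χ (t i <ᵇ 1)) i) none))
        (λ ())
        where
          none : low 0 ≤ 0
          none = ≤-trans (m≤n+m (low 0) (shortfall 0 t))
            (subst (λ a → shortfall a t + low a ≤ 0) (∑-zero {n})
              (≤-trans (good+low (λ _ → false) refl) (≤-reflexive (∑-zero {n}))))

-- Grain counts, commuting topplings and the ascent to a dominating configuration

module Sandpile where
  open import Data.Bool using (Bool; true; false; if_then_else_)
  open import Data.Fin as Fin using (Fin; zero; suc)
  open import Data.Fin.Subset using (Subset; ∣_∣)
  open import Data.Fin.Subset.Properties using (∣p∣≤n)
  import Data.Fin.Properties as Fin
  open import Data.List as List using (List; []; _∷_)
  open import Data.Nat
  open import Data.Nat.Properties
  open import Data.Nat.Tactic.RingSolver using (solve-∀)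
  open import Data.Product using (_×_; _,_; ∃-syntax)
  open import Data.Sum using (_⊎_; inj₁; inj₂)
  open import Data.Sum.Properties using (≡-dec; inj₁-injective; inj₂-injective)
  open import Data.Vec as Vec using (Vec; []; _∷_; lookup)
  open import Data.Vec.Properties using (lookup∘updateAt; lookup∘updateAt′; lookup-zipWith)
  open import Data.Vec.Relation.Binary.Pointwise.Extensional using (ext; Pointwise-≡⇒≡)
  open import Function using (_∘_)
  open import Relation.Binary.PropositionalEquality
  open import Relation.Nullary using (¬_; Dec; yes; no; contradiction)
  open import Defs using (Config; ⟨_,_⟩; tops; bottoms; Vertex; degree; grains; Unstable; Stable; stable?; addGrain; receive; send; TopplingRule)
  open Sums
  open Goodness

  ∣S∣≡size : ∀ {k} (S : Subset k) → ∣ S ∣ ≡ size (lookup S)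
  ∣S∣≡size []          = refl
  ∣S∣≡size (true  ∷ S) = cong suc (∣S∣≡size S)
  ∣S∣≡size (false ∷ S) = ∣S∣≡size S

  module _ {m n : ℕ} where

    _≟ᵛ_ : (v w : Vertex m n) → Dec (v ≡ w)
    _≟ᵛ_ = ≡-dec Fin._≟_ Fin._≟_

    top : Config m n → Fin m → ℕ
    top c i = grains c (inj₁ i)

    bottom : Config m n → Fin n → ℕ
    bottom c j = grains c (inj₂ j)

    GoodConfig : Config m n → Set
    GoodConfig c = Good (top c) (bottom c)

    received : (v : Vertex m n) → Subset (degree v) → Vertex m n → ℕ
    received (inj₁ _) S (inj₂ j) = χ (lookup S j)
    received (inj₂ _) S (inj₁ i) = χ (lookup S (suc i))
    received _        _ _        = 0

    lookup-receive : ∀ {k} (S : Subset k) xs i → lookup (receive {m} {n} S xs) i ≡ lookup xs i + χ (lookup S i)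
    lookup-receive S xs i = trans (lookup-zipWith _ i S xs) (one (lookup S i))
      where
        one : ∀ b → (if b then suc (lookup xs i) else lookup xs i) ≡ lookup xs i + χ b
        one true  = sym (+-comm _ 1)
        one false = sym (+-identityʳ _)

    lookup-tail : ∀ {k} (S : Subset (suc k)) i → lookup (Vec.tail S) i ≡ lookup S (suc i)
    lookup-tail (_ ∷ S) i = refl

    addGrain-self : ∀ v (c : Config m n) → grains (addGrain v c) v ≡ suc (grains c v)
    addGrain-self (inj₁ i) c = lookup∘updateAt i (tops c)
    addGrain-self (inj₂ j) c = lookup∘updateAt j (bottoms c)

    addGrain-other : ∀ v w (c : Config m n) → w ≢ v → grains (addGrain v c) w ≡ grains c w
    addGrain-other (inj₁ i) (inj₁ i′) c w≢v = lookup∘updateAt′ i′ i (w≢v ∘ cong inj₁) (tops c)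
    addGrain-other (inj₁ i) (inj₂ j)  c w≢v = refl
    addGrain-other (inj₂ j) (inj₁ i)  c w≢v = refl
    addGrain-other (inj₂ j) (inj₂ j′) c w≢v = lookup∘updateAt′ j′ j (w≢v ∘ cong inj₂) (bottoms c)

    send-self : ∀ v S (c : Config m n) → grains (send v S c) v ≡ grains c v ∸ ∣ S ∣
    send-self (inj₁ i) S ⟨ t , b ⟩ = lookup∘updateAt i t
    send-self (inj₂ j) S ⟨ t , b ⟩ = lookup∘updateAt j b

    send-other : ∀ v S w (c : Config m n) → w ≢ v → grains (send v S c) w ≡ grains c w + received v S w
    send-other (inj₁ i) S (inj₁ i′) ⟨ t , b ⟩ w≢v =
      trans (lookup∘updateAt′ i′ i (w≢v ∘ cong inj₁) t) (sym (+-identityʳ _))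
    send-other (inj₁ i) S (inj₂ j)  ⟨ t , b ⟩ w≢v = lookup-receive S b j
    send-other (inj₂ j) S (inj₁ i)  ⟨ t , b ⟩ w≢v =
      trans (lookup-receive (Vec.tail S) t i) (cong (λ x → lookup t i + χ x) (lookup-tail S i))
    send-other (inj₂ j) S (inj₂ j′) ⟨ t , b ⟩ w≢v =
      trans (lookup∘updateAt′ j′ j (w≢v ∘ cong inj₂) b) (sym (+-identityʳ _))

    config-ext : {c d : Config m n} → (∀ v → grains c v ≡ grains d v) → c ≡ d
    config-ext h = cong₂ ⟨_,_⟩ (Pointwise-≡⇒≡ (ext (h ∘ inj₁))) (Pointwise-≡⇒≡ (ext (h ∘ inj₂)))

    total : Config m n → ℕ
    total c = ∑ (top c) + ∑ (bottom c)

    bottoms-changed : ∀ (c d : Config m n) j → (∀ w → w ≢ inj₂ j → grains c w ≡ grains d w) →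
                      total c + bottom d j ≡ total d + bottom c j
    bottoms-changed c d j same = begin
      ∑ (top c) + ∑ (bottom c) + bottom d j   ≡⟨ +-assoc (∑ (top c)) _ _ ⟩
      ∑ (top c) + (∑ (bottom c) + bottom d j) ≡⟨ cong₂ _+_ (sum-cong-≗ (λ i → same (inj₁ i) λ ()))
                                                   (∑-update (bottom c) (bottom d) j (λ i i≢j → same (inj₂ i) (i≢j ∘ inj₂-injective))) ⟩
      ∑ (top d) + (∑ (bottom d) + bottom c j) ≡⟨ +-assoc (∑ (top d)) _ _ ⟨
      total d + bottom c j                    ∎
      where open ≡-Reasoning

    total-addGrain : ∀ v (c : Config m n) → total (addGrain v c) ≡ suc (total c)
    total-addGrain (inj₁ i) c = cong (_+ ∑ (bottom c)) (+-cancelʳ-≡ (top c i) _ _ (trans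
      (∑-update (top (addGrain (inj₁ i) c)) (top c) i (λ i′ i′≢i → addGrain-other (inj₁ i) (inj₁ i′) c (i′≢i ∘ inj₁-injective)))
      (trans (cong (∑ (top c) +_) (addGrain-self (inj₁ i) c)) (+-suc _ _))))
    total-addGrain (inj₂ j) c = +-cancelʳ-≡ (bottom c j) _ _ (trans
      (bottoms-changed (addGrain (inj₂ j) c) c j (λ w → addGrain-other (inj₂ j) w c))
      (trans (cong (total c +_) (addGrain-self (inj₂ j) c)) (+-suc _ _)))

    -- The part of S that stays in the system; only a grain for the sink is left out.
    delivered : (v : Vertex m n) → Subset (degree v) → ℕ
    delivered (inj₁ i) S = ∑ (λ j → received (inj₁ i) S (inj₂ j))
    delivered (inj₂ j) S = ∑ (λ i → received (inj₂ j) S (inj₁ i))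

    delivered≤ : ∀ v S → delivered v S ≤ ∣ S ∣
    delivered≤ (inj₁ i) S = ≤-reflexive (sym (∣S∣≡size S))
    delivered≤ (inj₂ j) S = ≤-trans (m≤n+m _ _) (≤-reflexive (sym (∣S∣≡size S)))

    ∑-withdraw : ∀ {k} (f g : Fin k → ℕ) i s → (∀ i′ → i′ ≢ i → g i′ ≡ f i′) → g i ≡ f i ∸ s → s ≤ f i →
                 ∑ g + s ≡ ∑ f
    ∑-withdraw f g i s same gi s≤ = +-cancelʳ-≡ (f i ∸ s) _ _ (begin
      ∑ g + s + (f i ∸ s)   ≡⟨ +-assoc (∑ g) s _ ⟩
      ∑ g + (s + (f i ∸ s)) ≡⟨ cong (∑ g +_) (m+[n∸m]≡n s≤) ⟩
      ∑ g + f i             ≡⟨ ∑-update g f i same ⟩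
      ∑ f + g i             ≡⟨ cong (∑ f +_) gi ⟩
      ∑ f + (f i ∸ s)       ∎)
      where open ≡-Reasoning

    total-send : ∀ v S (c : Config m n) → ∣ S ∣ ≤ grains c v → total (send v S c) + ∣ S ∣ ≡ total c + delivered v S
    total-send v@(inj₁ i) S c s≤ = begin
      ∑ (top c′) + ∑ (bottom c′) + ∣ S ∣                ≡⟨ shuffle (∑ (top c′)) (∑ (bottom c′)) ∣ S ∣ ⟩
      ∑ (top c′) + ∣ S ∣ + ∑ (bottom c′)                ≡⟨ cong₂ _+_
        (∑-withdraw (top c) (top c′) i ∣ S ∣ (λ i′ i′≢i → trans (send-other v S (inj₁ i′) c (i′≢i ∘ inj₁-injective)) (+-identityʳ _)) (send-self v S c) s≤)
        (∑-+-cong (λ j → send-other v S (inj₂ j) c λ ())) ⟩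
      ∑ (top c) + (∑ (bottom c) + delivered v S)        ≡⟨ +-assoc (∑ (top c)) _ _ ⟨
      total c + delivered v S                           ∎
      where
        open ≡-Reasoning
        c′ = send v S c
        shuffle : ∀ a b s → a + b + s ≡ a + s + b
        shuffle = solve-∀
    total-send v@(inj₂ j) S c s≤ = begin
      ∑ (top c′) + ∑ (bottom c′) + ∣ S ∣                ≡⟨ +-assoc (∑ (top c′)) _ _ ⟩
      ∑ (top c′) + (∑ (bottom c′) + ∣ S ∣)              ≡⟨ cong₂ _+_
        (∑-+-cong (λ i → send-other v S (inj₁ i) c λ ()))
        (∑-withdraw (bottom c) (bottom c′) j ∣ S ∣ (λ j′ j′≢j → trans (send-other v S (inj₂ j′) c (j′≢j ∘ inj₂-injective)) (+-identityʳ _)) (send-self v S c) s≤) ⟩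
      ∑ (top c) + delivered v S + ∑ (bottom c)          ≡⟨ shuffle (∑ (top c)) (delivered v S) _ ⟩
      total c + delivered v S                           ∎
      where
        open ≡-Reasoning
        c′ = send v S c
        shuffle : ∀ a s b → a + s + b ≡ a + b + s
        shuffle = solve-∀

    affordable : ∀ {c : Config m n} v (S : Subset (degree v)) → Unstable c v → ∣ S ∣ ≤ grains c v
    affordable v S unst = ≤-trans (∣p∣≤n S) unst

    total-send-≤ : ∀ v S (c : Config m n) → Unstable c v → total (send v S c) ≤ total c
    total-send-≤ v S c unst = +-cancelʳ-≤ ∣ S ∣ _ _
      (≤-trans (≤-reflexive (total-send v S c (affordable v S unst))) (+-monoʳ-≤ (total c) (delivered≤ v S)))

    grains≤total : ∀ v (c : Config m n) → grains c v ≤ total c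
    grains≤total (inj₁ i) c = ≤-trans (∑-≥ (top c) i) (m≤m+n _ _)
    grains≤total (inj₂ j) c = ≤-trans (∑-≥ (bottom c) j) (m≤n+m _ _)

    total-stable : ∀ {c : Config m n} → Stable c → total c ≤ m * n + n * suc m
    total-stable s = +-mono-≤ (≤-trans (∑-mono (λ i → <⇒≤ (s (inj₁ i)))) (≤-reflexive (∑-const m n)))
                              (≤-trans (∑-mono (λ j → <⇒≤ (s (inj₂ j)))) (≤-reflexive (∑-const n (suc m))))

    infix 4 _≼_
    _≼_ : Config m n → Config m n → Set
    c ≼ d = ∀ v → grains c v ≤ grains d v

    total-mono : ∀ {c d : Config m n} → c ≼ d → total c ≤ total d
    total-mono h = +-mono-≤ (∑-mono (h ∘ inj₁)) (∑-mono (h ∘ inj₂))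

    addGrain-≽ : ∀ v (c : Config m n) → c ≼ addGrain v c
    addGrain-≽ v c w with w ≟ᵛ v
    ... | yes refl = ≤-trans (n≤1+n _) (≤-reflexive (sym (addGrain-self w c)))
    ... | no  w≢v  = ≤-reflexive (sym (addGrain-other v w c w≢v))

    addGrain-≼ : ∀ v {c d : Config m n} → c ≼ d → grains c v < grains d v → addGrain v c ≼ d
    addGrain-≼ v {c} c≼d c<d w with w ≟ᵛ v
    ... | yes refl = ≤-trans (≤-reflexive (addGrain-self w c)) c<d
    ... | no  w≢v  = ≤-trans (≤-reflexive (addGrain-other v w c w≢v)) (c≼d w)

    send-≼ : ∀ v S {c d : Config m n} → c ≼ d → send v S c ≼ send v S d
    send-≼ v S {c} {d} c≼d w with w ≟ᵛ v
    ... | yes refl = subst₂ _≤_ (sym (send-self w S c)) (sym (send-self w S d)) (∸-monoˡ-≤ ∣ S ∣ (c≼d w))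
    ... | no  w≢v  = subst₂ _≤_ (sym (send-other v S w c w≢v)) (sym (send-other v S w d w≢v))
                       (+-monoˡ-≤ _ (c≼d w))

    -- An unstable vertex can afford every S, so at both vertices the truncated subtraction is
    -- genuine and commutes with receiving grains.
    send-comm : ∀ {c : Config m n} v S w S′ → v ≢ w → Unstable c v → Unstable c w →
                send v S (send w S′ c) ≡ send w S′ (send v S c)
    send-comm {c} v S w S′ v≢w cv cw = config-ext pointwise
      where
        at : ∀ {c : Config m n} v S w S′ → v ≢ w → Unstable c v →
             grains (send v S (send w S′ c)) v ≡ grains (send w S′ (send v S c)) v
        at {c} v S w S′ v≢w cv = begin
          grains (send v S (send w S′ c)) v            ≡⟨ send-self v S (send w S′ c) ⟩
          grains (send w S′ c) v ∸ ∣ S ∣               ≡⟨ cong (_∸ ∣ S ∣) (send-other w S′ v c v≢w) ⟩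
          grains c v + received w S′ v ∸ ∣ S ∣         ≡⟨ +-∸-comm (received w S′ v) (affordable v S cv) ⟩
          grains c v ∸ ∣ S ∣ + received w S′ v         ≡⟨ cong (_+ received w S′ v) (send-self v S c) ⟨
          grains (send v S c) v + received w S′ v      ≡⟨ send-other w S′ v (send v S c) v≢w ⟨
          grains (send w S′ (send v S c)) v            ∎
          where open ≡-Reasoning
        shuffle : ∀ x a b → x + a + b ≡ x + b + a
        shuffle = solve-∀
        pointwise : ∀ u → grains (send v S (send w S′ c)) u ≡ grains (send w S′ (send v S c)) u
        pointwise u with u ≟ᵛ v | u ≟ᵛ w
        ... | yes refl | _        = at u S w S′ v≢w cv
        ... | no _     | yes refl = sym (at u S′ v S (v≢w ∘ sym) cw)
        ... | no u≢v   | no u≢w   = begin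
          grains (send v S (send w S′ c)) u                    ≡⟨ send-other v S u (send w S′ c) u≢v ⟩
          grains (send w S′ c) u + received v S u              ≡⟨ cong (_+ received v S u) (send-other w S′ u c u≢w) ⟩
          grains c u + received w S′ u + received v S u        ≡⟨ shuffle (grains c u) (received w S′ u) _ ⟩
          grains c u + received v S u + received w S′ u        ≡⟨ cong (_+ received w S′ u) (send-other v S u c u≢v) ⟨
          grains (send v S c) u + received w S′ u              ≡⟨ send-other w S′ u (send v S c) u≢w ⟨
          grains (send w S′ (send v S c)) u                    ∎
          where open ≡-Reasoning

    send-unstable : ∀ {c : Config m n} v S w → w ≢ v → Unstable c w → Unstable (send v S c) w
    send-unstable {c} v S w w≢v cw = ≤-trans (≤-trans cw (m≤m+n _ _)) (≤-reflexive (sym (send-other v S w c w≢v)))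

    data Topples (c : Config m n) : ℕ → Config m n → Set where
      done   : Topples c 0 c
      toppling : ∀ {l x} v S → Unstable x v → Topples c l (send v S x) → Topples c (suc l) x

    -- The abelian property: a vertex which is unstable now topples at some
    -- point, and its first toppling can be moved to the front.
    exchange : ∀ {c l x} v → Stable c → Unstable x v → Topples c l x →
               ∃[ S ] ∃[ l′ ] l ≡ suc l′ × Topples c l′ (send v S x)
    exchange v st xv done = contradiction xv (<⇒≱ (st v))
    exchange {c} v st xv (toppling w S xw p) with v ≟ᵛ w
    ... | yes refl = S , _ , refl , p
    ... | no  v≢w with S′ , l′ , refl , q ← exchange v st (send-unstable w S v v≢w xv) p =
      S′ , _ , refl , toppling w S (send-unstable v S′ w (v≢w ∘ sym) xw)
                        (subst (Topples c l′) (send-comm v S′ w S v≢w xv xw) q)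

    -- One step adds a grain to a stable configuration or topples the vertex
    -- chosen by the rule.
    data Reaches (rule : TopplingRule m n) (c : Config m n) : ℕ → Config m n → Set where
      done   : Reaches rule c 0 c
      add    : ∀ {l x} v → Stable x → Reaches rule c l (addGrain v x) → Reaches rule c (suc l) x
      toppling : ∀ {l x} S → ¬ Stable x → Reaches rule c l (send (TopplingRule.pick rule x) S x) →
               Reaches rule c (suc l) x

    ≼-cases : ∀ {x z : Config m n} → x ≼ z → x ≡ z ⊎ ∃[ v ] grains x v < grains z v
    ≼-cases {x} {z} x≼z with Fin.any? (λ i → top x i <? top z i) | Fin.any? (λ j → bottom x j <? bottom z j)
    ... | yes (i , lt) | _            = inj₂ (inj₁ i , lt)
    ... | no _         | yes (j , lt) = inj₂ (inj₂ j , lt)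
    ... | no ¬t        | no ¬b        = inj₁ (config-ext λ
      { (inj₁ i) → ≤-antisym (x≼z (inj₁ i)) (≮⇒≥ (λ lt → ¬t (i , lt)))
      ; (inj₂ j) → ≤-antisym (x≼z (inj₂ j)) (≮⇒≥ (λ lt → ¬b (j , lt))) })

    -- The same S loses equally many grains to the sink in x and in z, so the difference of their
    -- totals is unchanged.
    send-budget : ∀ l f v S {x z : Config m n} → x ≼ z → Unstable x v → l + total z ≤ f + total x →
                  l + total (send v S z) ≤ f + total (send v S x)
    send-budget l f v S {x} {z} x≼z xv enough = +-cancelʳ-≤ ∣ S ∣ _ _ (begin
      l + total (send v S z) + ∣ S ∣      ≡⟨ +-assoc l _ _ ⟩
      l + (total (send v S z) + ∣ S ∣)    ≡⟨ cong (l +_) (total-send v S z (affordable v S (≤-trans xv (x≼z v)))) ⟩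
      l + (total z + delivered v S)       ≡⟨ +-assoc l _ _ ⟨
      l + total z + delivered v S         ≤⟨ +-monoˡ-≤ (delivered v S) enough ⟩
      f + total x + delivered v S         ≡⟨ +-assoc f _ _ ⟩
      f + (total x + delivered v S)       ≡⟨ cong (f +_) (total-send v S x (affordable v S xv)) ⟨
      f + (total (send v S x) + ∣ S ∣)    ≡⟨ +-assoc f _ _ ⟨
      f + total (send v S x) + ∣ S ∣      ∎)
      where open ≤-Reasoning

    -- The number l + (total z - total x) drops in each step, and f bounds it. If x is stable and
    -- below z, a missing grain is added. If x is unstable, the vertex picked by the rule is
    -- unstable in z too; `exchange` brings its toppling in z to the front, and x copies it with the
    -- same set. If x is stable and equal to z, no toppling can remain, so x is c.
    reaches : ∀ (rule : TopplingRule m n) {c} → Stable c → ∀ f {l x z} → x ≼ z → Topples c l z →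
              l + total z ≤ f + total x → ∃[ k ] k ≤ f × Reaches rule c k x
    reaches rule {c} st f {x = x} x≼z p enough with stable? x
    reaches rule {c} st f {x = x} x≼z p enough | yes sx with ≼-cases x≼z
    reaches rule {c} st f x≼z done enough               | yes sx | inj₁ refl = 0 , z≤n , done
    reaches rule {c} st f x≼z (toppling v _ xv _) enough  | yes sx | inj₁ refl = contradiction xv (<⇒≱ (sx v))
    reaches rule {c} st zero {l} {x} {z} x≼z p enough   | yes sx | inj₂ (v , lt) =
      contradiction (≤-trans (m≤n+m (total z) l) enough)
        (<⇒≱ (subst (_≤ total z) (total-addGrain v x) (total-mono (addGrain-≼ v x≼z lt))))
    reaches rule {c} st (suc f) {l} {x} {z} x≼z p enough | yes sx | inj₂ (v , lt)
      with k , k≤ , r ← reaches rule st f (addGrain-≼ v x≼z lt) p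
             (≤-trans enough (≤-reflexive (trans (sym (+-suc f (total x))) (cong (f +_) (sym (total-addGrain v x))))))
      = suc k , s≤s k≤ , add v sx r
    reaches rule {c} st f {l} {x} {z} x≼z p enough | no ¬sx
      with exchange (TopplingRule.pick rule x) st (≤-trans (TopplingRule.legal rule x ¬sx) (x≼z (TopplingRule.pick rule x))) p
    reaches rule {c} st zero {l} {x} {z} x≼z p enough | no ¬sx | S , l′ , refl , q =
      contradiction enough (<⇒≱ (s≤s (≤-trans (total-mono x≼z) (m≤n+m (total z) l′))))
    reaches rule {c} st (suc f) {l} {x} {z} x≼z p enough | no ¬sx | S , l′ , refl , q
      with k , k≤ , r ← reaches rule st f (send-≼ (TopplingRule.pick rule x) S x≼z) q
             (send-budget l′ f (TopplingRule.pick rule x) S x≼z (TopplingRule.legal rule x ¬sx) (≤-pred enough))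
      = suc k , s≤s k≤ , toppling S ¬sx r

-- Untoppling good configurations up to arbitrary height

module Reachability where
  open import Data.Bool using (Bool; true; false; not; T)
  open import Data.Fin as Fin using (Fin; zero; suc)
  open import Data.Fin.Subset using (Subset; ∣_∣; ⊤)
  open import Data.Fin.Subset.Properties using (∣⊤∣≡n)
  import Data.Fin.Properties as Fin
  open import Data.List as List using (List; []; _∷_; length)
  open import Data.List.Membership.Propositional using (_∈_)
  open import Data.List.Membership.Propositional.Properties using (∈-allFin)
  open import Data.List.Relation.Unary.Any using (here; there)
  open import Data.Nat
  open import Data.Nat.Properties
  open import Data.Product using (_×_; _,_; ∃-syntax)
  open import Data.Sum using (_⊎_; inj₁; inj₂)
  open import Data.Sum.Properties using (inj₁-injective; inj₂-injective)
  open import Data.Vec as Vec using (_∷_; lookup; tabulate)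
  open import Data.Vec.Properties using (lookup∘tabulate)
  open import Function using (_∘_)
  open import Relation.Binary.PropositionalEquality
  open import Relation.Nullary using (yes; no; contradiction)
  open import Defs using (Config; ⟨_,_⟩; Vertex; degree; grains; Unstable; Stable; addGrain; send; TopplingRule)
  open Sums
  open Goodness
  open Toppling
  open Sandpile

  module _ {m n : ℕ} where

    good-addGrain : ∀ v (c : Config m n) → GoodConfig c → GoodConfig (addGrain v c)
    good-addGrain v c = good-mono (addGrain-≽ v c ∘ inj₁) (addGrain-≽ v c ∘ inj₂)

    good-send : ∀ v S (c : Config m n) → Unstable c v → GoodConfig c → GoodConfig (send v S c)
    good-send v@(inj₁ i) S c cv = send-top-good i (lookup S)
      (λ i′ i′≢i → trans (send-other v S (inj₁ i′) c (i′≢i ∘ inj₁-injective)) (+-identityʳ _))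
      (trans (send-self v S c) (cong (top c i ∸_) (∣S∣≡size S)))
      cv
      (λ j → send-other v S (inj₂ j) c λ ())
    good-send v@(inj₂ j) S c cv = send-bottom-good j K
      (λ i → send-other v S (inj₁ i) c λ ())
      (λ j′ j′≢j → trans (send-other v S (inj₂ j′) c (j′≢j ∘ inj₂-injective)) (+-identityʳ _))
      (≤-trans (m+n≤o⇒m≤o∸n (size (not ∘ K)) (≤-trans enough cv)) (≤-reflexive (sym (send-self v S c))))
      where
        K : Fin m → Bool
        K = lookup S ∘ suc
        enough : size (not ∘ K) + ∣ S ∣ ≤ suc m
        enough = begin
          size (not ∘ K) + ∣ S ∣                          ≡⟨ cong (size (not ∘ K) +_) (∣S∣≡size S) ⟩
          size (not ∘ K) + (χ (lookup S zero) + size K)   ≤⟨ +-monoʳ-≤ (size (not ∘ K)) (+-monoˡ-≤ (size K) (χ≤1 (lookup S zero))) ⟩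
          size (not ∘ K) + suc (size K)                   ≡⟨ +-suc _ _ ⟩
          suc (size (not ∘ K) + size K)                   ≡⟨ cong suc (size-not K) ⟩
          suc m                                           ∎
          where open ≤-Reasoning

    config : (Vertex m n → ℕ) → Config m n
    config f = ⟨ tabulate (f ∘ inj₁) , tabulate (f ∘ inj₂) ⟩

    grains-config : ∀ f v → grains (config f) v ≡ f v
    grains-config f (inj₁ i) = lookup∘tabulate (f ∘ inj₁) i
    grains-config f (inj₂ j) = lookup∘tabulate (f ∘ inj₂) j

    unsend : (v : Vertex m n) → Subset (degree v) → Config m n → Vertex m n → ℕ
    unsend v S c w with w ≟ᵛ v
    ... | yes _ = grains c w + ∣ S ∣
    ... | no  _ = grains c w ∸ received v S w

    unsend-self : ∀ v S c → unsend v S c v ≡ grains c v + ∣ S ∣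
    unsend-self v S c with v ≟ᵛ v
    ... | yes _  = refl
    ... | no v≢v = contradiction refl v≢v

    unsend-other : ∀ v S c w → w ≢ v → unsend v S c w ≡ grains c w ∸ received v S w
    unsend-other v S c w w≢v with w ≟ᵛ v
    ... | yes w≡v = contradiction w≡v w≢v
    ... | no _    = refl

    untopple : (v : Vertex m n) → Subset (degree v) → Config m n → Config m n
    untopple v S c = config (unsend v S c)

    untopple-self : ∀ v S c → grains (untopple v S c) v ≡ grains c v + ∣ S ∣
    untopple-self v S c = trans (grains-config (unsend v S c) v) (unsend-self v S c)

    untopple-other : ∀ v S c w → w ≢ v → grains (untopple v S c) w ≡ grains c w ∸ received v S w
    untopple-other v S c w w≢v = trans (grains-config (unsend v S c) w) (unsend-other v S c w w≢v)

    -- The bound ensures that the subtraction in `untopple` is not truncated, so that sending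
    -- restores what was taken.
    send-untopple : ∀ v S c → (∀ w → w ≢ v → received v S w ≤ grains c w) → send v S (untopple v S c) ≡ c
    send-untopple v S c enough = config-ext pointwise
      where
        x = untopple v S c
        pointwise : ∀ w → grains (send v S x) w ≡ grains c w
        pointwise w with w ≟ᵛ v
        ... | yes refl = trans (send-self w S x) (trans (cong (_∸ ∣ S ∣) (untopple-self w S c)) (m+n∸n≡m (grains c w) ∣ S ∣))
        ... | no  w≢v  = trans (send-other v S w x w≢v)
                           (trans (cong (_+ received v S w) (untopple-other v S c w w≢v)) (m∸n+n≡m (enough w w≢v)))

    infix 4 _↠_
    _↠_ : Config m n → Config m n → Set
    z ↠ c = ∃[ l ] Topples c l z

    ↠-untopple : ∀ v S {c d} → (∀ w → w ≢ v → received v S w ≤ grains c w) → degree v ≤ grains c v + ∣ S ∣ →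
                 c ↠ d → untopple v S c ↠ d
    ↠-untopple v S {c} {d} enough unst (l , p) =
      suc l , toppling v S (≤-trans unst (≤-reflexive (sym (untopple-self v S c))))
                (subst (Topples d l) (sym (send-untopple v S c enough)) p)

    untopple-bottom : ∀ {c d : Config m n} j → GoodConfig c → c ↠ d →
      ∃[ x ] x ↠ d × GoodConfig x × bottom c j < bottom x j × (∀ j′ → bottom c j′ ≤ bottom x j′)
    untopple-bottom {c} {d} j good c↠d
      -- Taking back the sink's grain and one from each of the m - b_j richest top vertices brings j
      -- to m + 1 grains, just enough to be unstable. The minimum with m covers b_j ≥ m, where only
      -- the sink's grain is taken.
      with v , J₀ , sz , sep ← ∃-separator (top c) (m ⊓ bottom c j) (m⊓n≤m m (bottom c j))
      = untopple (inj₂ j) S c , ↠-untopple (inj₂ j) S enough unst c↠d ,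
        untopple-good (λ i → trans (untopple-other (inj₂ j) S c (inj₁ i) λ ()) (cong (top c i ∸_) (received≡ i)))
                      others (≤-trans (+-monoʳ-≤ (bottom c j) (n≤1+n (size K))) (≤-reflexive (sym self))) ,
        ≤-trans (≤-trans (≤-reflexive (+-comm 1 (bottom c j))) (+-monoʳ-≤ (bottom c j) (s≤s z≤n))) (≤-reflexive (sym self)) ,
        grow
      where
        which : size (not ∘ J₀) ≡ 0 ⊎ size J₀ ≡ bottom c j
        which with ≤-total m (bottom c j)
        ... | inj₁ m≤b = inj₁ (+-cancelʳ-≡ (size J₀) _ _ (trans (size-not J₀) (sym (trans sz (m≤n⇒m⊓n≡m m≤b)))))
        ... | inj₂ b≤m = inj₂ (trans sz (m≥n⇒m⊓n≡n b≤m))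
        open Untopple good j sep which
        S : Subset (suc m)
        S = true ∷ tabulate K
        received≡ : ∀ i → received (inj₂ j) S (inj₁ i) ≡ χ (K i)
        received≡ i = cong χ (lookup∘tabulate K i)
        ∣S∣≡ : ∣ S ∣ ≡ suc (size K)
        ∣S∣≡ = trans (∣S∣≡size S) (cong suc (sum-cong-≗ (λ i → cong χ (lookup∘tabulate K i))))
        self : bottom (untopple (inj₂ j) S c) j ≡ bottom c j + suc (size K)
        self = trans (untopple-self (inj₂ j) S c) (cong (bottom c j +_) ∣S∣≡)
        others : ∀ j′ → j′ ≢ j → bottom (untopple (inj₂ j) S c) j′ ≡ bottom c j′
        others j′ j′≢j = untopple-other (inj₂ j) S c (inj₂ j′) (j′≢j ∘ inj₂-injective)
        grow : ∀ j′ → bottom c j′ ≤ bottom (untopple (inj₂ j) S c) j′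
        grow j′ with j′ Fin.≟ j
        ... | yes refl = ≤-trans (m≤m+n _ _) (≤-reflexive (sym self))
        ... | no  j′≢j = ≤-reflexive (sym (others j′ j′≢j))
        enough : ∀ w → w ≢ inj₂ j → received (inj₂ j) S w ≤ grains c w
        enough (inj₁ i) _ = ≤-trans (≤-reflexive (received≡ i)) (member (K i) (positive i))
          where
            member : ∀ k → (T k → 1 ≤ top c i) → χ k ≤ top c i
            member true  h = h _
            member false h = z≤n
        enough (inj₂ j′) _ = z≤n
        unst : suc m ≤ bottom c j + ∣ S ∣
        unst = begin
          suc m                          ≡⟨ cong suc (size-not J₀) ⟨
          suc (size K + size J₀)         ≤⟨ s≤s (+-monoʳ-≤ (size K) (≤-trans (≤-reflexive sz) (m⊓n≤n m (bottom c j)))) ⟩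
          suc (size K + bottom c j)      ≡⟨ +-comm (suc (size K)) (bottom c j) ⟩
          bottom c j + suc (size K)      ≡⟨ cong (bottom c j +_) ∣S∣≡ ⟨
          bottom c j + ∣ S ∣             ∎
          where open ≤-Reasoning

    Raised : Config m n → Config m n → Fin n → ℕ → Config m n → Set
    Raised c d j B x = x ↠ d × GoodConfig x × B ≤ bottom x j × (∀ j′ → bottom c j′ ≤ bottom x j′)

    raise-bottom : ∀ {c d : Config m n} j B → GoodConfig c → c ↠ d → ∃[ x ] Raised c d j B x
    raise-bottom {c} j zero    good c↠d = c , c↠d , good , z≤n , λ _ → ≤-refl
    raise-bottom {c} {d} j (suc B) good c↠d = raise (raise-bottom j B good c↠d)
      where
        raise : ∃[ x ] Raised c d j B x → ∃[ x ] Raised c d j (suc B) x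
        raise (x , x↠d , goodx , B≤ , c≤x) = extend (untopple-bottom j goodx x↠d)
          where
            extend : ∃[ y ] y ↠ d × GoodConfig y × bottom x j < bottom y j × (∀ j′ → bottom x j′ ≤ bottom y j′) →
                     ∃[ y ] Raised c d j (suc B) y
            extend (y , y↠d , goody , x<y , x≤y) = y , y↠d , goody , ≤-<-trans B≤ x<y , λ j′ → ≤-trans (c≤x j′) (x≤y j′)

    raise-bottoms : ∀ {c d : Config m n} js B → GoodConfig c → c ↠ d →
      ∃[ x ] x ↠ d × GoodConfig x × (∀ j → j ∈ js → B ≤ bottom x j)
    raise-bottoms {c} []       B good c↠d = c , c↠d , good , λ _ ()
    raise-bottoms {c} (j ∷ js) B good c↠d
      with x , x↠d , goodx , B≤ ← raise-bottoms js B good c↠d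
      with y , y↠d , goody , B≤y , x≤y ← raise-bottom j B goodx x↠d
      = y , y↠d , goody , λ { _ (here refl) → B≤y ; j′ (there j′∈) → ≤-trans (B≤ j′ j′∈) (x≤y j′) }

    module _ .{{_ : NonZero n}} where

      -- Each untoppling takes one grain from every bottom vertex, hence the reserve k + R. It gives
      -- top vertex i exactly n grains, which makes i unstable whatever it held before and raises it
      -- by at least one.
      raise-top : ∀ {c d : Config m n} i k R → (∀ j → k + R ≤ bottom c j) → c ↠ d →
        ∃[ x ] x ↠ d × (∀ j → R ≤ bottom x j) × k ≤ top x i × (∀ i′ → top c i′ ≤ top x i′)
      raise-top {c} i zero    R R≤ c↠d = c , c↠d , R≤ , z≤n , λ _ → ≤-refl
      raise-top {c} i (suc k) R R≤ c↠d
        with x , x↠d , R<x , k≤ , c≤x ← raise-top i k (suc R) (λ j → subst (_≤ bottom c j) (sym (+-suc k R)) (R≤ j)) c↠d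
        = untopple v ⊤ x ,
          ↠-untopple v ⊤ (λ { (inj₁ _) _ → z≤n
                            ; (inj₂ j) _ → ≤-trans (χ≤1 (lookup (⊤ {n}) j)) (≤-trans (s≤s z≤n) (R<x j)) })
                         (≤-trans (≤-reflexive (sym (∣⊤∣≡n n))) (m≤n+m _ _)) x↠d ,
          (λ j → subst (R ≤_) (sym (untopple-other v ⊤ x (inj₂ j) λ ()))
                   (≤-trans (∸-monoˡ-≤ 1 (R<x j)) (∸-monoʳ-≤ (bottom x j) (χ≤1 (lookup (⊤ {n}) j))))) ,
          ≤-trans (≤-trans (≤-reflexive (+-comm 1 k)) (+-mono-≤ k≤ (≤-trans (>-nonZero⁻¹ n) (≤-reflexive (sym (∣⊤∣≡n n))))))
                  (≤-reflexive (sym (untopple-self v ⊤ x))) ,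
          λ i′ → ≤-trans (c≤x i′) (grow x i′)
        where
          v = inj₁ i
          grow : ∀ x i′ → top x i′ ≤ top (untopple v ⊤ x) i′
          grow x i′ with i′ Fin.≟ i
          ... | yes refl = ≤-trans (m≤m+n _ _) (≤-reflexive (sym (untopple-self v ⊤ x)))
          ... | no i′≢i  = ≤-reflexive (sym (untopple-other v ⊤ x (inj₁ i′) (i′≢i ∘ inj₁-injective)))

      raise-tops : ∀ {c d : Config m n} is k R → (∀ j → length is * k + R ≤ bottom c j) → c ↠ d →
        ∃[ x ] x ↠ d × (∀ j → R ≤ bottom x j) × (∀ i → i ∈ is → k ≤ top x i)
      raise-tops {c} []       k R R≤ c↠d = c , c↠d , R≤ , λ _ ()
      raise-tops {c} (i ∷ is) k R R≤ c↠d
        with x , x↠d , R≤x , k≤ ← raise-tops is k (k + R) (λ j → subst (_≤ bottom c j) (trans (cong (_+ R) (+-comm k (length is * k))) (+-assoc (length is * k) k R)) (R≤ j)) c↠d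
        with y , y↠d , R≤y , k≤y , x≤y ← raise-top i k R R≤x x↠d
        = y , y↠d , R≤y , λ { _ (here refl) → k≤y ; i′ (there i′∈) → ≤-trans (k≤ i′ i′∈) (x≤y i′) }

      dominating : ∀ {c : Config m n} W → GoodConfig c → ∃[ z ] z ↠ c × (∀ v → W ≤ grains z v)
      dominating {c} W good
        -- Raising the m top vertices by W each costs every bottom vertex m W grains, and W must
        -- remain.
        with x , x↠c , _ , B≤ ← raise-bottoms (List.allFin n) (length (List.allFin m) * W + W) good (0 , done)
        with z , z↠c , W≤b , W≤t ← raise-tops (List.allFin m) W W (λ j → B≤ j (∈-allFin j)) x↠c
        = z , z↠c , λ { (inj₁ i) → W≤t i (∈-allFin i) ; (inj₂ j) → W≤b j }

      -- No vertex of x holds more than `total x`, so a single z with at least W grains everywhere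
      -- lies above all these x, and its budget l + `total z` serves them all.
      reach-uniformly : ∀ (rule : TopplingRule m n) {c} W → Stable c → GoodConfig c →
        ∃[ L ] ∀ x → total x ≤ W → ∃[ k ] k ≤ L × Reaches rule c k x
      reach-uniformly rule {c} W st good
        with z , (l , p) , W≤ ← dominating W good
        = l + total z , λ x x≤W →
          reaches rule st (l + total z) (λ v → ≤-trans (grains≤total v x) (≤-trans x≤W (W≤ v))) p (m≤m+n _ (total x))

-- Inequalities in the ordered field and geometric decay

module Field {a ℓ₁ ℓ₂ ℓ₃} (ℝ : Reals a ℓ₁ ℓ₂ ℓ₃) where
  open import Algebra.Bundles using (CommutativeRing)
  open import Data.Nat as ℕ using (ℕ; zero; suc)
  open import Data.Product using (_×_; _,_; ∃-syntax)
  open import Data.Sum using (inj₁; inj₂)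
  open import Function using (module Equivalence)
  open import Relation.Binary.Bundles using (StrictPartialOrder)
  open import Relation.Binary.Structures using (IsStrictPartialOrder; IsPartialOrder)
  open import Relation.Nullary using (contradiction)
  open Reals ℝ
  open import Algebra.Apartness.Properties.HeytingCommutativeRing heytingCommutativeRing using (x-0≈x)

  strictPartialOrder : StrictPartialOrder _ _ _
  strictPartialOrder = record { isStrictPartialOrder = isStrictPartialOrder }

  reals : CommutativeRing _ _
  reals = record { isCommutativeRing = isCommutativeRing }

  open import Relation.Binary.Construct.StrictToNonStrict _≈_ _<_ as NonStrict using () public
  open NonStrict public using (_≤_; <⇒≤)
  open IsStrictPartialOrder isStrictPartialOrder public using (<-respˡ-≈; <-respʳ-≈)
    renaming (trans to <-trans; irrefl to <-irrefl)
  open IsPartialOrder (NonStrict.isPartialOrder isStrictPartialOrder) public using ()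
    renaming (refl to ≤-refl; trans to ≤-trans; reflexive to ≤-reflexive)
  module ≈-Reasoning where
    open import Relation.Binary.Reasoning.Setoid (CommutativeRing.setoid reals) public
  module ≤-Reasoning where
    open import Relation.Binary.Reasoning.StrictPartialOrder strictPartialOrder public
  open import Algebra.Properties.Semiring.Exp (CommutativeRing.semiring reals) public using (_^_)
  open import Algebra.Solver.Ring.NaturalCoefficients.Default (CommutativeRing.commutativeSemiring reals) public
    using (solve; _:+_; _:*_; _:=_; con)

  +-mono-≤ : ∀ {w x y z} → w ≤ x → y ≤ z → w + y ≤ x + z
  +-mono-≤ {w} {x} {y} {z} p q = ≤-trans (left p) (right q)
    where
      left : w ≤ x → w + y ≤ x + y
      left (inj₁ w<x) = inj₁ (+-monoˡ-< y w<x)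
      left (inj₂ w≈x) = inj₂ (+-congʳ w≈x)
      right : y ≤ z → x + y ≤ x + z
      right (inj₁ y<z) = inj₁ (<-respˡ-≈ (+-comm y x) (<-respʳ-≈ (+-comm z x) (+-monoˡ-< x y<z)))
      right (inj₂ y≈z) = inj₂ (+-congˡ y≈z)

  +-monoˡ-≤ : ∀ z {x y} → x ≤ y → x + z ≤ y + z
  +-monoˡ-≤ z p = +-mono-≤ p ≤-refl

  +-monoʳ-≤ : ∀ z {x y} → x ≤ y → z + x ≤ z + y
  +-monoʳ-≤ z p = +-mono-≤ ≤-refl p

  +-nonneg : ∀ {x y} → 0# ≤ x → 0# ≤ y → 0# ≤ x + y
  +-nonneg p q = ≤-trans (≤-reflexive (sym (+-identityˡ 0#))) (+-mono-≤ p q)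

  x≤x+y : ∀ {x y} → 0# ≤ y → x ≤ x + y
  x≤x+y {x} p = ≤-trans (≤-reflexive (sym (+-identityʳ x))) (+-monoʳ-≤ x p)

  x+y-y≈x : ∀ x y → x + y + - y ≈ x
  x+y-y≈x x y = trans (+-assoc x y (- y)) (trans (+-congˡ (-‿inverseʳ y)) (+-identityʳ x))

  sub-add : ∀ x y → x - y + y ≈ x
  sub-add x y = trans (+-assoc x (- y) y) (trans (+-congˡ (-‿inverseˡ y)) (+-identityʳ x))

  +-cancelʳ-≤ : ∀ z {x y} → x + z ≤ y + z → x ≤ y
  +-cancelʳ-≤ z {x} {y} p = begin
    x             ≈⟨ x+y-y≈x x z ⟨
    x + z + - z   ≤⟨ +-monoˡ-≤ (- z) p ⟩
    y + z + - z   ≈⟨ x+y-y≈x y z ⟩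
    y             ∎
    where open ≤-Reasoning

  +-cancelʳ-< : ∀ z {x y} → x + z < y + z → x < y
  +-cancelʳ-< z {x} {y} p = begin-strict
    x             ≈⟨ x+y-y≈x x z ⟨
    x + z + - z   <⟨ +-monoˡ-< (- z) p ⟩
    y + z + - z   ≈⟨ x+y-y≈x y z ⟩
    y             ∎
    where open ≤-Reasoning

  x≤y⇒0≤y-x : ∀ {x y} → x ≤ y → 0# ≤ y - x
  x≤y⇒0≤y-x {x} p = ≤-trans (≤-reflexive (sym (-‿inverseʳ x))) (+-monoˡ-≤ (- x) p)

  x<y⇒0<y-x : ∀ {x y} → x < y → 0# < y - x
  x<y⇒0<y-x {x} p = <-respˡ-≈ (-‿inverseʳ x) (+-monoˡ-< (- x) p)

  *-nonneg : ∀ {x y} → 0# ≤ x → 0# ≤ y → 0# ≤ x * y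
  *-nonneg {x} {y} (inj₂ 0≈x) q     = inj₂ (trans (sym (zeroˡ y)) (*-congʳ 0≈x))
  *-nonneg {x} {y} (inj₁ p) (inj₂ q) = inj₂ (trans (sym (zeroʳ x)) (*-congˡ q))
  *-nonneg         (inj₁ p) (inj₁ q) = inj₁ (*-pos p q)

  *-monoˡ-≤ : ∀ {w x y} → 0# ≤ w → x ≤ y → w * x ≤ w * y
  *-monoˡ-≤ {w} {x} {y} 0≤w x≤y = begin
    w * x                 ≤⟨ x≤x+y (*-nonneg 0≤w (x≤y⇒0≤y-x x≤y)) ⟩
    w * x + w * (y - x)   ≈⟨ distribˡ w x (y - x) ⟨
    w * (x + (y - x))     ≈⟨ *-congˡ (trans (+-comm x (y - x)) (sub-add y x)) ⟩
    w * y                 ∎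
    where open ≤-Reasoning

  *-monoʳ-≤ : ∀ {w x y} → 0# ≤ w → x ≤ y → x * w ≤ y * w
  *-monoʳ-≤ {w} {x} {y} 0≤w x≤y =
    ≤-trans (≤-reflexive (*-comm x w)) (≤-trans (*-monoˡ-≤ 0≤w x≤y) (≤-reflexive (*-comm w y)))

  *-monoʳ-< : ∀ {w x y} → 0# < w → x < y → x * w < y * w
  *-monoʳ-< {w} {x} {y} 0<w x<y = begin-strict
    x * w                 ≈⟨ +-identityˡ (x * w) ⟨
    0# + x * w            <⟨ +-monoˡ-< (x * w) (*-pos (x<y⇒0<y-x x<y) 0<w) ⟩
    (y - x) * w + x * w   ≈⟨ distribʳ w (y - x) x ⟨
    (y - x + x) * w       ≈⟨ *-congʳ (sub-add y x) ⟩
    y * w                 ∎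
    where open ≤-Reasoning

  0≤1 : 0# ≤ 1#
  0≤1 = <⇒≤ 0<1

  ^-nonneg : ∀ {x} → 0# ≤ x → ∀ n → 0# ≤ x ^ n
  ^-nonneg p zero    = 0≤1
  ^-nonneg p (suc n) = *-nonneg p (^-nonneg p n)

  ^-pos : ∀ {x} → 0# < x → ∀ n → 0# < x ^ n
  ^-pos p zero    = 0<1
  ^-pos p (suc n) = *-pos p (^-pos p n)

  *-≤1 : ∀ {x y} → 0# ≤ y → x ≤ 1# → y ≤ 1# → x * y ≤ 1#
  *-≤1 {x} {y} 0≤y x≤1 y≤1 = ≤-trans (*-monoʳ-≤ 0≤y x≤1) (≤-trans (≤-reflexive (*-identityˡ y)) y≤1)

  ^-≤1 : ∀ {x} → 0# ≤ x → x ≤ 1# → ∀ n → x ^ n ≤ 1#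
  ^-≤1 p q zero    = ≤-refl
  ^-≤1 p q (suc n) = *-≤1 (^-nonneg p n) q (^-≤1 p q n)

  ^-anti : ∀ {x k n} → 0# ≤ x → x ≤ 1# → k ℕ.≤ n → x ^ n ≤ x ^ k
  ^-anti {n = n} p q ℕ.z≤n = ^-≤1 p q n
  ^-anti p q (ℕ.s≤s k≤n)   = *-monoˡ-≤ p (^-anti p q k≤n)

  fromℕ-nonneg : ∀ k → 0# ≤ fromℕ k
  fromℕ-nonneg zero    = ≤-refl
  fromℕ-nonneg (suc k) = +-nonneg 0≤1 (fromℕ-nonneg k)

  -- The inverse y is invertible, hence apart from 0, hence negative or positive; a negative y would
  -- give 1 < 0.
  positive-inverse : ∀ {x} → 0# < x → ∃[ y ] 0# < y × x * y ≈ 1#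
  positive-inverse {x} 0<x with #⇒invertible (Equivalence.from #⇔<⊎> (inj₂ 0<x))
  ... | y , yx≈1 , xy≈1 with Equivalence.to #⇔<⊎> (invertible⇒# {y} {0#} (x , trans (*-congˡ (x-0≈x y)) x*y , trans (*-congʳ (x-0≈x y)) (trans (*-comm y x) x*y)))
    where
      x*y : x * y ≈ 1#
      x*y = trans (*-congʳ (sym (x-0≈x x))) xy≈1
  ...   | inj₂ 0<y = y , 0<y , trans (*-congʳ (sym (x-0≈x x))) xy≈1
  ...   | inj₁ y<0 = contradiction (<-trans 0<1 1<0) (<-irrefl refl)
    where
      1<0 : 1# < 0#
      1<0 = begin-strict
        1#             ≈⟨ yx≈1 ⟨
        y * (x - 0#)   ≈⟨ *-congˡ (x-0≈x x) ⟩
        y * x          <⟨ *-monoʳ-< 0<x y<0 ⟩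
        0# * x         ≈⟨ zeroˡ x ⟩
        0#             ∎
        where open ≤-Reasoning

  module _ {q δ : Carrier} (0≤q : 0# ≤ q) (0<δ : 0# < δ) (q+δ≈1 : q + δ ≈ 1#) where

    ratio≤1 : q ≤ 1#
    ratio≤1 = ≤-trans (x≤x+y (<⇒≤ 0<δ)) (≤-reflexive q+δ≈1)

    -- Induction on R: q (1 + (R + 1) δ) = q (1 + R δ) + q δ is at most q + δ + R δ = 1 + R δ,
    -- because q ≤ 1.
    bernoulli-inequality : ∀ R → q ^ R * (1# + fromℕ R * δ) ≤ 1#
    bernoulli-inequality zero    = ≤-reflexive (trans (*-identityˡ _) (trans (+-congˡ (zeroˡ δ)) (+-identityʳ 1#)))
    bernoulli-inequality (suc R) = begin
      q * q ^ R * (1# + (1# + r) * δ)         ≈⟨ solve 4 (λ q x r δ → q :* x :* (con 1 :+ (con 1 :+ r) :* δ) := x :* (q :* (con 1 :+ r :* δ) :+ q :* δ)) refl q (q ^ R) r δ ⟩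
      q ^ R * (q * (1# + r * δ) + q * δ)      ≤⟨ *-monoˡ-≤ (^-nonneg 0≤q R) (+-monoʳ-≤ _ (*-monoʳ-≤ (<⇒≤ 0<δ) ratio≤1)) ⟩
      q ^ R * (q * (1# + r * δ) + 1# * δ)     ≈⟨ *-congˡ (solve 3 (λ q r δ → q :* (con 1 :+ r :* δ) :+ con 1 :* δ := q :+ δ :+ q :* (r :* δ)) refl q r δ) ⟩
      q ^ R * (q + δ + q * (r * δ))           ≤⟨ *-monoˡ-≤ (^-nonneg 0≤q R) (+-mono-≤ (≤-reflexive q+δ≈1)
                                                   (≤-trans (*-monoʳ-≤ (*-nonneg (fromℕ-nonneg R) (<⇒≤ 0<δ)) ratio≤1) (≤-reflexive (*-identityˡ (r * δ))))) ⟩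
      q ^ R * (1# + r * δ)                    ≤⟨ bernoulli-inequality R ⟩
      1#                                      ∎
      where
        open ≤-Reasoning
        r = fromℕ R

    -- The left side is at most k / (1 + R δ), so any R above k / (δ ε) will do; u and w are the
    -- inverses of δ ε and 1 + R δ.
    geometric-decay : ∀ k {ε} → 0# < ε → ∃[ R ] fromℕ k * q ^ R < ε
    geometric-decay k {ε} 0<ε
      with u , 0<u , δεu≈1 ← positive-inverse (*-pos 0<δ 0<ε)
      with R , ku<R ← archimedean (fromℕ k * u)
      with w , 0<w , denom*w≈1 ← positive-inverse {1# + fromℕ R * δ}
             (<-respˡ-≈ (+-identityˡ 0#) (NonStrict.<-≤-trans <-trans <-respʳ-≈ (+-monoˡ-< 0# 0<1)
               (+-monoʳ-≤ 1# (*-nonneg (fromℕ-nonneg R) (<⇒≤ 0<δ)))))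
      = R , (begin-strict
        fromℕ k * q ^ R                        ≈⟨ *-identityʳ _ ⟨
        fromℕ k * q ^ R * 1#                   ≈⟨ *-congˡ denom*w≈1 ⟨
        fromℕ k * q ^ R * (denom R * w)        ≈⟨ solve 4 (λ k x d w → k :* x :* (d :* w) := k :* (x :* d) :* w) refl (fromℕ k) (q ^ R) (denom R) w ⟩
        fromℕ k * (q ^ R * denom R) * w        ≤⟨ *-monoʳ-≤ (<⇒≤ 0<w) (*-monoˡ-≤ (fromℕ-nonneg k) (bernoulli-inequality R)) ⟩
        fromℕ k * 1# * w                       ≈⟨ *-congʳ (trans (*-congˡ (sym δεu≈1)) (solve 4 (λ k δ ε u → k :* (δ :* ε :* u) := k :* u :* (δ :* ε)) refl (fromℕ k) δ ε u)) ⟩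
        fromℕ k * u * (δ * ε) * w              <⟨ *-monoʳ-< 0<w (*-monoʳ-< (*-pos 0<δ 0<ε) ku<R) ⟩
        fromℕ R * (δ * ε) * w                  ≤⟨ *-monoʳ-≤ (<⇒≤ 0<w) (≤-trans (x≤x+y (<⇒≤ 0<ε))
                                                    (≤-reflexive (solve 3 (λ r δ ε → r :* (δ :* ε) :+ ε := ε :* (con 1 :+ r :* δ)) refl (fromℕ R) δ ε))) ⟩
        ε * denom R * w                        ≈⟨ *-assoc ε (denom R) w ⟩
        ε * (denom R * w)                      ≈⟨ *-congˡ denom*w≈1 ⟩
        ε * 1#                                 ≈⟨ *-identityʳ ε ⟩
        ε                                      ∎)
      where
        open ≤-Reasoning
        denom : ℕ → Carrier
        denom R = 1# + fromℕ R * δ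

-- Expectations over finitely supported distributions

module Expectation {a ℓ₁ ℓ₂ ℓ₃} (ℝ : Reals a ℓ₁ ℓ₂ ℓ₃) (p : Reals.Carrier ℝ) (p∈ : InUnitInterval ℝ p) where
  open import Data.Bool using (Bool; true; false; if_then_else_)
  open import Data.Fin as Fin using (Fin)
  open import Data.Fin.Subset using (Subset)
  open import Data.List as List using (List; []; _∷_; _++_)
  open import Data.List.Membership.Propositional using (_∈_)
  open import Data.List.Membership.Propositional.Properties using (∈-++⁺ˡ; ∈-++⁺ʳ; ∈-map⁺; ∈-allFin)
  open import Data.List.Properties using (length-map; length-++; length-tabulate)
  open import Data.List.Relation.Unary.All using (All; []; _∷_)
  open import Data.List.Relation.Unary.Any using (here; there)
  open import Data.Nat as ℕ using (ℕ; zero; suc; NonZero)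
  import Data.Nat.Properties as ℕ
  open import Data.Product using (_,_; proj₁; proj₂)
  open import Data.Sum using (inj₁; inj₂)
  open import Level using (_⊔_)
  open import Data.Vec using ([]; _∷_)
  open import Relation.Binary.PropositionalEquality as ≡ using (_≡_)
  open import Defs using (Vertex)
  open Reals ℝ
  open SSM ℝ p
  open Field ℝ

  𝔼 : ∀ {b} {A : Set b} → Dist A → (A → Carrier) → Carrier
  𝔼 d f = List.foldr (λ { (w , x) s → w * f x + s }) 0# d

  module _ {b} {A : Set b} where

    𝔼-cong : ∀ (d : Dist A) {f g} → (∀ x → f x ≈ g x) → 𝔼 d f ≈ 𝔼 d g
    𝔼-cong []            h = refl
    𝔼-cong ((w , x) ∷ d) h = +-cong (*-congˡ (h x)) (𝔼-cong d h)

    𝔼-++ : ∀ (d e : Dist A) f → 𝔼 (d ++ e) f ≈ 𝔼 d f + 𝔼 e f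
    𝔼-++ []            e f = sym (+-identityˡ _)
    𝔼-++ ((w , x) ∷ d) e f = trans (+-congˡ (𝔼-++ d e f)) (sym (+-assoc _ _ _))

    𝔼-return : ∀ (x : A) f → 𝔼 (return x) f ≈ f x
    𝔼-return x f = trans (+-identityʳ _) (*-identityˡ _)

    𝔼-+ : ∀ (d : Dist A) f g → 𝔼 d (λ x → f x + g x) ≈ 𝔼 d f + 𝔼 d g
    𝔼-+ []            f g = sym (+-identityˡ 0#)
    𝔼-+ ((w , x) ∷ d) f g = trans (+-congˡ (𝔼-+ d f g))
      (solve 5 (λ w a b s t → w :* (a :+ b) :+ (s :+ t) := w :* a :+ s :+ (w :* b :+ t)) refl w (f x) (g x) (𝔼 d f) (𝔼 d g))

    prob≈𝔼 : ∀ E (d : Dist A) → prob E d ≈ 𝔼 d (λ x → if E x then 1# else 0#)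
    prob≈𝔼 E []            = refl
    prob≈𝔼 E ((w , x) ∷ d) = +-cong (head (E x)) (prob≈𝔼 E d)
      where
        head : ∀ b → (if b then w else 0#) ≈ w * (if b then 1# else 0#)
        head true  = sym (*-identityʳ w)
        head false = sym (zeroʳ w)

    𝔼-*ʳ : ∀ (d : Dist A) f y → 𝔼 d (λ x → f x * y) ≈ 𝔼 d f * y
    𝔼-*ʳ []            f y = sym (zeroˡ y)
    𝔼-*ʳ ((w , x) ∷ d) f y = trans (+-cong (sym (*-assoc w (f x) y)) (𝔼-*ʳ d f y)) (sym (distribʳ y _ _))

    NonNegative : Dist A → Set _
    NonNegative = All (λ wx → 0# ≤ proj₁ wx)

    𝔼-mono : ∀ {d : Dist A} → NonNegative d → ∀ {f g} → (∀ x → f x ≤ g x) → 𝔼 d f ≤ 𝔼 d g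
    𝔼-mono []        h = ≤-refl
    𝔼-mono (w≥0 ∷ d) h = +-mono-≤ (*-monoˡ-≤ w≥0 (h _)) (𝔼-mono d h)

    𝔼-nonneg : ∀ {d : Dist A} → NonNegative d → ∀ {f} → (∀ x → 0# ≤ f x) → 0# ≤ 𝔼 d f
    𝔼-nonneg []        h = ≤-refl
    𝔼-nonneg (w≥0 ∷ d) h = +-nonneg (*-nonneg w≥0 (h _)) (𝔼-nonneg d h)

    -- The outcome x has weight at least α.
    Heavy : Carrier → A → Dist A → Set _
    Heavy α x d = ∀ {f} → (∀ y → 0# ≤ f y) → α * f x ≤ 𝔼 d f

    heavy-∈ : ∀ {w x} {d : Dist A} → NonNegative d → (w , x) ∈ d → Heavy w x d
    heavy-∈ (_ ∷ d)   (here ≡.refl) h = x≤x+y (𝔼-nonneg d h)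
    heavy-∈ (w≥0 ∷ d) (there x∈)    h = ≤-trans (heavy-∈ d x∈ h)
      (≤-trans (x≤x+y (*-nonneg w≥0 (h _))) (≤-reflexive (+-comm _ _)))

  module _ {b c} {A : Set b} {B : Set c} where

    𝔼-bind : ∀ (d : Dist A) (g : A → Dist B) f → 𝔼 (d >>= g) f ≈ 𝔼 d (λ x → 𝔼 (g x) f)
    𝔼-bind []            g f = refl
    𝔼-bind ((w , x) ∷ d) g f = trans (𝔼-++ (List.map _ (g x)) (d >>= g) f) (+-cong (scaled (g x)) (𝔼-bind d g f))
      where
        scaled : ∀ e → 𝔼 (List.map (λ { (w′ , y) → w * w′ , y }) e) f ≈ w * 𝔼 e f
        scaled []             = sym (zeroʳ w)
        scaled ((w′ , y) ∷ e) = trans (+-cong (*-assoc w w′ (f y)) (scaled e)) (sym (distribˡ w _ _))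

  -- Positivity is expressed as monotonicity of the expectation: through `𝔼-bind` it passes to
  -- composite distributions without tracing the weights of the list.
  record IsProbability {b} {A : Set b} (d : Dist A) : Set (b ⊔ a ⊔ ℓ₁ ⊔ ℓ₃) where
    field
      mono : ∀ {f g} → (∀ x → f x ≤ g x) → 𝔼 d f ≤ 𝔼 d g
      mass : 𝔼 d (λ _ → 1#) ≈ 1#

    𝔼-const : ∀ y → 𝔼 d (λ _ → y) ≈ y
    𝔼-const y = trans (𝔼-cong d (λ _ → sym (*-identityˡ y))) (trans (𝔼-*ʳ d (λ _ → 1#) y) (trans (*-congʳ mass) (*-identityˡ y)))

    𝔼-+const : ∀ f y → 𝔼 d (λ x → f x + y) ≈ 𝔼 d f + y
    𝔼-+const f y = trans (𝔼-+ d f (λ _ → y)) (+-congˡ (𝔼-const y))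

    𝔼≤1 : ∀ {f} → (∀ x → f x ≤ 1#) → 𝔼 d f ≤ 1#
    𝔼≤1 h = ≤-trans (mono h) (≤-reflexive mass)

    𝔼≥1 : ∀ {f} → (∀ x → 1# ≤ f x) → 1# ≤ 𝔼 d f
    𝔼≥1 h = ≤-trans (≤-reflexive (sym mass)) (mono h)

    -- Heaviness is applied to the non-negative function f - 1, whose expectation is that of f less
    -- 1.
    heavy-lower : ∀ {α x} → 0# ≤ α → Heavy α x d → ∀ {f r} → (∀ y → 1# ≤ f y) → 1# + r ≤ f x → 1# + α * r ≤ 𝔼 d f
    heavy-lower {α} {x} 0≤α heavy {f} {r} f≥1 fx≥ = begin
      1# + α * r                    ≤⟨ +-monoʳ-≤ 1# (*-monoˡ-≤ 0≤α r≤) ⟩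
      1# + α * (f x - 1#)           ≤⟨ +-monoʳ-≤ 1# (heavy (λ y → x≤y⇒0≤y-x (f≥1 y))) ⟩
      1# + 𝔼 d (λ y → f y - 1#)     ≈⟨ +-comm 1# _ ⟩
      𝔼 d (λ y → f y - 1#) + 1#     ≈⟨ 𝔼-+const (λ y → f y - 1#) 1# ⟨
      𝔼 d (λ y → f y - 1# + 1#)     ≈⟨ 𝔼-cong d (λ y → sub-add (f y) 1#) ⟩
      𝔼 d f                         ∎
      where
        open ≤-Reasoning
        r≤ : r ≤ f x - 1#
        r≤ = +-cancelʳ-≤ 1# (≤-trans (≤-reflexive (+-comm r 1#)) (≤-trans fx≥ (≤-reflexive (sym (sub-add (f x) 1#)))))

    heavy-upper : ∀ {α x} → 0# ≤ α → Heavy α x d → ∀ {f r} → (∀ y → f y ≤ 1#) → f x + r ≤ 1# → 𝔼 d f + α * r ≤ 1#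
    heavy-upper {α} {x} 0≤α heavy {f} {r} f≤1 fx≤ = begin
      𝔼 d f + α * r                          ≤⟨ +-monoʳ-≤ _ (*-monoˡ-≤ 0≤α r≤) ⟩
      𝔼 d f + α * (1# - f x)                 ≤⟨ +-monoʳ-≤ _ (heavy (λ y → x≤y⇒0≤y-x (f≤1 y))) ⟩
      𝔼 d f + 𝔼 d (λ y → 1# - f y)           ≈⟨ 𝔼-+ d f (λ y → 1# - f y) ⟨
      𝔼 d (λ y → f y + (1# - f y))           ≈⟨ 𝔼-cong d (λ y → trans (+-comm (f y) _) (sub-add 1# (f y))) ⟩
      𝔼 d (λ _ → 1#)                         ≈⟨ mass ⟩
      1#                                     ∎
      where
        open ≤-Reasoning
        r≤ : r ≤ 1# - f x
        r≤ = +-cancelʳ-≤ (f x) (≤-trans (≤-reflexive (+-comm r (f x))) (≤-trans fx≤ (≤-reflexive (sym (sub-add 1# (f x))))))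

  return-probability : ∀ {b} {A : Set b} (x : A) → IsProbability (return x)
  return-probability x = record
    { mono = λ h → 𝔼-mono (0≤1 ∷ []) h
    ; mass = 𝔼-return x (λ _ → 1#)
    }

  bind-probability : ∀ {b c} {A : Set b} {B : Set c} {d : Dist A} {g : A → Dist B} →
                     IsProbability d → (∀ x → IsProbability (g x)) → IsProbability (d >>= g)
  bind-probability {d = d} {g} dp gp = record
    { mono = λ {f} {f′} h → ≤-trans (≤-reflexive (𝔼-bind d g f))
               (≤-trans (mono dp (λ x → mono (gp x) h)) (≤-reflexive (sym (𝔼-bind d g f′))))
    ; mass = trans (𝔼-bind d g (λ _ → 1#)) (trans (𝔼-cong d (λ x → mass (gp x))) (mass dp))
    }
    where open IsProbability

  0≤p : 0# ≤ p
  0≤p = <⇒≤ (proj₁ p∈)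

  0<1-p : 0# < 1# - p
  0<1-p = x<y⇒0<y-x (proj₂ p∈)

  bernoulli-nonneg : NonNegative bernoulli
  bernoulli-nonneg = 0≤p ∷ <⇒≤ 0<1-p ∷ []

  bernoulli-probability : IsProbability bernoulli
  bernoulli-probability = record
    { mono = 𝔼-mono bernoulli-nonneg
    ; mass = trans (solve 2 (λ p r → p :* con 1 :+ (r :* con 1 :+ con 0) := r :+ p) refl p (1# - p)) (sub-add 1# p)
    }

  randomSubset-probability : ∀ k → IsProbability (randomSubset k)
  randomSubset-probability zero    = return-probability []
  randomSubset-probability (suc k) = bind-probability bernoulli-probability λ b →
    bind-probability (randomSubset-probability k) λ S → return-probability (b ∷ S)

  -- A lower bound for both p and 1 - p; their minimum need not be computable.
  q : Carrier
  q = p * (1# - p)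

  0<q : 0# < q
  0<q = *-pos (proj₁ p∈) 0<1-p

  p≤1 : p ≤ 1#
  p≤1 = <⇒≤ (proj₂ p∈)

  1-p≤1 : 1# - p ≤ 1#
  1-p≤1 = ≤-trans (x≤x+y 0≤p) (≤-reflexive (sub-add 1# p))

  q≤1-p : q ≤ 1# - p
  q≤1-p = ≤-trans (*-monoʳ-≤ (<⇒≤ 0<1-p) p≤1) (≤-reflexive (*-identityˡ _))

  q≤p : q ≤ p
  q≤p = ≤-trans (*-monoˡ-≤ 0≤p 1-p≤1) (≤-reflexive (*-identityʳ p))

  q≤1 : q ≤ 1#
  q≤1 = ≤-trans q≤p p≤1

  heavy-weaken : ∀ {b} {A : Set b} {α β} {x : A} {d} → α ≤ β → Heavy β x d → Heavy α x d
  heavy-weaken α≤β heavy h = ≤-trans (*-monoʳ-≤ (h _) α≤β) (heavy h)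

  bernoulli-heavy : ∀ b → Heavy q b bernoulli
  bernoulli-heavy true  = heavy-weaken {d = bernoulli} q≤p (heavy-∈ bernoulli-nonneg (here ≡.refl))
  bernoulli-heavy false = heavy-weaken {d = bernoulli} q≤1-p (heavy-∈ bernoulli-nonneg (there (here ≡.refl)))

  randomSubset-suc : ∀ k f → 𝔼 (randomSubset (suc k)) f ≈ 𝔼 bernoulli (λ b → 𝔼 (randomSubset k) (λ S → f (b ∷ S)))
  randomSubset-suc k f = trans (𝔼-bind bernoulli (λ b → randomSubset k >>= λ S → return (b ∷ S)) f) (𝔼-cong bernoulli λ b →
    trans (𝔼-bind (randomSubset k) (λ S → return (b ∷ S)) f) (𝔼-cong (randomSubset k) λ S → 𝔼-return (b ∷ S) f))

  randomSubset-heavy : ∀ {k} (S : Subset k) → Heavy (q ^ k) S (randomSubset k)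
  randomSubset-heavy [] {f} h = ≤-reflexive (trans (*-identityˡ _) (sym (𝔼-return [] f)))
  randomSubset-heavy {suc k} (b ∷ S) {f} h = begin
    q * q ^ k * f (b ∷ S)                                              ≈⟨ *-assoc q (q ^ k) _ ⟩
    q * (q ^ k * f (b ∷ S))                                            ≤⟨ *-monoˡ-≤ (<⇒≤ 0<q) (randomSubset-heavy S (λ S′ → h (b ∷ S′))) ⟩
    q * 𝔼 (randomSubset k) (λ S′ → f (b ∷ S′))                         ≤⟨ bernoulli-heavy b (λ b′ → nonneg (λ S′ → h (b′ ∷ S′))) ⟩
    𝔼 bernoulli (λ b′ → 𝔼 (randomSubset k) (λ S′ → f (b′ ∷ S′)))       ≈⟨ randomSubset-suc k f ⟨
    𝔼 (randomSubset (suc k)) f                                         ∎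
    where
      open ≤-Reasoning
      open IsProbability (randomSubset-probability k)
      nonneg : ∀ {g} → (∀ S′ → 0# ≤ g S′) → 0# ≤ 𝔼 (randomSubset k) g
      nonneg h = ≤-trans (≤-reflexive (sym (𝔼-const 0#))) (mono h)

  0<1/ℕ : ∀ k .{{_ : NonZero k}} → 0# < 1/ℕ k
  0<1/ℕ k with y , 0<y , ky≈1 ← positive-inverse (0<fromℕ k) = <-respʳ-≈ (begin
      y                       ≈⟨ *-identityˡ y ⟨
      1# * y                  ≈⟨ *-congʳ (fromℕ*1/ℕ k) ⟨
      fromℕ k * 1/ℕ k * y     ≈⟨ solve 3 (λ k w y → k :* w :* y := w :* (k :* y)) refl (fromℕ k) (1/ℕ k) y ⟩
      1/ℕ k * (fromℕ k * y)   ≈⟨ *-congˡ ky≈1 ⟩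
      1/ℕ k * 1#              ≈⟨ *-identityʳ _ ⟩
      1/ℕ k                   ∎) 0<y
    where open ≈-Reasoning

  uniform : ∀ {b} {A : Set b} → Carrier → List A → Dist A
  uniform w = List.map (λ x → w , x)

  module _ {b} {A : Set b} {w : Carrier} where

    uniform-mass : ∀ (xs : List A) → 𝔼 (uniform w xs) (λ _ → 1#) ≈ fromℕ (List.length xs) * w
    uniform-mass []       = sym (zeroˡ w)
    uniform-mass (x ∷ xs) = trans (+-cong (trans (*-identityʳ w) (sym (*-identityˡ w))) (uniform-mass xs))
                                  (sym (distribʳ w 1# _))

    uniform-nonneg : 0# ≤ w → ∀ (xs : List A) → NonNegative (uniform w xs)
    uniform-nonneg 0≤w []       = []
    uniform-nonneg 0≤w (x ∷ xs) = 0≤w ∷ uniform-nonneg 0≤w xs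

  module _ (m n : ℕ) .{{_ : NonZero n}} where

    instance
      m+n≢0 : NonZero (m ℕ.+ n)
      m+n≢0 = ℕ.>-nonZero (ℕ.<-≤-trans (ℕ.>-nonZero⁻¹ n) (ℕ.m≤n+m n m))

    vertices : List (Vertex m n)
    vertices = List.map inj₁ (List.allFin m) ++ List.map inj₂ (List.allFin n)

    vertex-∈ : ∀ v → v ∈ vertices
    vertex-∈ (inj₁ i) = ∈-++⁺ˡ (∈-map⁺ inj₁ (∈-allFin i))
    vertex-∈ (inj₂ j) = ∈-++⁺ʳ (List.map inj₁ (List.allFin m)) (∈-map⁺ inj₂ (∈-allFin j))

    length-vertices : List.length vertices ≡ m ℕ.+ n
    length-vertices = ≡.trans (length-++ (List.map inj₁ (List.allFin m)))
      (≡.cong₂ ℕ._+_ (≡.trans (length-map inj₁ (List.allFin m)) (length-tabulate {n = m} (λ i → i)))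
                     (≡.trans (length-map inj₂ (List.allFin n)) (length-tabulate {n = n} (λ j → j))))

    randomVertex-nonneg : NonNegative (uniform (1/ℕ (m ℕ.+ n)) vertices)
    randomVertex-nonneg = uniform-nonneg (<⇒≤ (0<1/ℕ (m ℕ.+ n))) vertices

  randomVertex-probability : ∀ m n .{{_ : NonZero n}} → IsProbability (randomVertex m n)
  randomVertex-probability m n@(suc _) = record
    { mono = 𝔼-mono (randomVertex-nonneg m n)
    ; mass = trans (uniform-mass (vertices m n)) (trans (*-congʳ (reflexive (≡.cong fromℕ (length-vertices m n))))
                                                        (fromℕ*1/ℕ (m ℕ.+ n) {{m+n≢0 m n}}))
    }

  randomVertex-heavy : ∀ {m n} .{{_ : NonZero n}} v → Heavy (1/ℕ (m ℕ.+ n) {{m+n≢0 m n}}) v (randomVertex m n)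
  randomVertex-heavy {m} {n@(suc _)} v = heavy-∈ (randomVertex-nonneg m n) (∈-map⁺ _ (vertex-∈ m n v))

-- Recurrence of good configurations, transience of the others

module Recurrence {a ℓ₁ ℓ₂ ℓ₃} (ℝ : Reals a ℓ₁ ℓ₂ ℓ₃) (p : Reals.Carrier ℝ) (p∈ : InUnitInterval ℝ p)
                  {m n : ℕ} .{{_ : NonZero n}} (rule : TopplingRule m n) (c : Config m n) where
  open import Data.Bool using (Bool; true; false; if_then_else_)
  open import Data.Fin as Fin using (Fin)
  import Data.Fin.Properties as Fin
  open import Data.Fin.Subset using (Subset)
  open import Data.List as List using (List; []; _∷_)
  open import Data.List.Properties using (filter-accept; filter-reject)
  open import Data.Maybe using (Maybe; just; nothing; maybe′)
  open import Data.Nat as ℕ using (zero; suc; _∸_; _≤ᵇ_)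
  import Data.Nat.Properties as ℕ
  open import Data.Product using (_×_; _,_; ∃-syntax)
  open import Data.Sum using (inj₁; inj₂)
  open import Data.Sum.Properties using (inj₂-injective)
  open import Function using (_∘_)
  open import Relation.Binary.PropositionalEquality as ≡ using (_≡_; _≢_)
  open import Relation.Nullary using (¬_; Dec; yes; no; does; contradiction)
  open import Defs using (Vertex; degree; Stable; stable?; _≟_; addGrain; send)
  open Sums using (∑; ∑-update)
  open Goodness using (good-full)
  open Sandpile
  open Reachability
  open Reals ℝ
  open SSM ℝ p
  open Field ℝ
  open Expectation ℝ p p∈
  open TopplingRule rule
  open IsProbability

  State : Set
  State = Config m n

  -- Sealed copies of the decision procedures, whose unfolding is expensive.
  abstract
    isStable? : (x : State) → Dec (Stable x)
    isStable? = stable?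

    here? : (x : State) → Dec (c ≡ x)
    here? = c ≟_

  u : Carrier
  u = 1/ℕ (m ℕ.+ n) {{m+n≢0 m n}}

  0<u : 0# < u
  0<u = 0<1/ℕ (m ℕ.+ n) {{m+n≢0 m n}}

  u≤1 : u ≤ 1#
  u≤1 = ≤-trans (≤-trans (≤-reflexive (sym (*-identityʳ u)))
    (randomVertex-heavy {m} {n} (inj₂ (Fin.fromℕ< (ℕ.>-nonZero⁻¹ n))) {λ _ → 1#} (λ _ → 0≤1)))
    (≤-reflexive (mass (randomVertex-probability m n)))

  -- One step of the chain whose states also record the unstable configurations
  -- met during a stabilisation.
  advance : (State → Carrier) → State → Carrier
  advance f x with isStable? x
  ... | yes _ = 𝔼 (randomVertex m n) (λ v → f (addGrain v x))
  ... | no _  = 𝔼 (randomSubset (degree (pick x))) (λ S → f (send (pick x) S x))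

  advance-+const : ∀ f y x → advance (λ z → f z + y) x ≈ advance f x + y
  advance-+const f y x with isStable? x
  ... | yes _ = 𝔼-+const (randomVertex-probability m n) (λ v → f (addGrain v x)) y
  ... | no _  = 𝔼-+const (randomSubset-probability (degree (pick x))) (λ S → f (send (pick x) S x)) y

  -- Closed under the finer chain: a stable state has at most m n + n (m + 1) grains, adding a grain
  -- to it contributes one more, and topplings never increase the total.
  Bounded : State → Set
  Bounded x = total x ℕ.≤ suc (m ℕ.* n ℕ.+ n ℕ.* suc m)

  bounded-stable : ∀ {x} → Stable x → Bounded x
  bounded-stable sx = ℕ.m≤n⇒m≤1+n (total-stable sx)

  bounded-add : ∀ v {x} → Stable x → Bounded (addGrain v x)
  bounded-add v {x} sx = ℕ.≤-trans (ℕ.≤-reflexive (total-addGrain v x)) (ℕ.s≤s (total-stable sx))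

  bounded-send : ∀ {x} S → ¬ Stable x → Bounded x → Bounded (send (pick x) S x)
  bounded-send {x} S ¬sx = ℕ.≤-trans (total-send-≤ (pick x) S x (legal x ¬sx))

  advance-≥1 : ∀ {f x} → Bounded x → (∀ z → Bounded z → 1# ≤ f z) → 1# ≤ advance f x
  advance-≥1 {f} {x} bx h with isStable? x
  ... | yes sx = 𝔼≥1 (randomVertex-probability m n) (λ v → h (addGrain v x) (bounded-add v sx))
  ... | no ¬sx = 𝔼≥1 (randomSubset-probability (degree (pick x))) (λ S → h (send (pick x) S x) (bounded-send S ¬sx bx))

  -- A common lower bound for the probability of any single outcome of a step. The exponent exceeds
  -- every degree, so α is at most each `q ^ degree v` and also at most u.
  α : Carrier
  α = q ^ (suc m ℕ.+ n) * u

  0<α : 0# < α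
  0<α = *-pos (^-pos 0<q (suc m ℕ.+ n)) 0<u

  α≤u : α ≤ u
  α≤u = ≤-trans (*-monoʳ-≤ (<⇒≤ 0<u) (^-≤1 (<⇒≤ 0<q) q≤1 (suc m ℕ.+ n))) (≤-reflexive (*-identityˡ u))

  α≤1 : α ≤ 1#
  α≤1 = ≤-trans α≤u u≤1

  degree≤ : (v : Vertex m n) → degree v ℕ.≤ suc m ℕ.+ n
  degree≤ (inj₁ _) = ℕ.m≤n+m n (suc m)
  degree≤ (inj₂ _) = ℕ.m≤m+n (suc m) n

  α≤q^ : ∀ v → α ≤ q ^ degree v
  α≤q^ v = ≤-trans (≤-trans (*-monoˡ-≤ (^-nonneg (<⇒≤ 0<q) (suc m ℕ.+ n)) u≤1) (≤-reflexive (*-identityʳ _)))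
                   (^-anti (<⇒≤ 0<q) q≤1 (degree≤ v))

  advance-add : ∀ {f x r} v → Stable x → (∀ z → Bounded z → 1# ≤ f z) → 1# + r ≤ f (addGrain v x) →
                1# + α * r ≤ advance f x
  advance-add {f} {x} {r} v sx h hv with isStable? x
  ... | no ¬sx = contradiction sx ¬sx
  ... | yes _  = heavy-lower (randomVertex-probability m n) (<⇒≤ 0<α)
                   (heavy-weaken {d = randomVertex m n} α≤u (randomVertex-heavy {m} {n} v))
                   {λ v → f (addGrain v x)} (λ w → h (addGrain w x) (bounded-add w sx)) hv

  advance-send : ∀ {f x r} S → ¬ Stable x → Bounded x → (∀ z → Bounded z → 1# ≤ f z) →
                 1# + r ≤ f (send (pick x) S x) → 1# + α * r ≤ advance f x
  advance-send {f} {x} {r} S ¬sx bx h hS with isStable? x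
  ... | yes sx = contradiction sx ¬sx
  ... | no _   = heavy-lower (randomSubset-probability (degree (pick x))) (<⇒≤ 0<α)
                   (heavy-weaken {d = randomSubset (degree (pick x))} (α≤q^ (pick x)) (randomSubset-heavy S))
                   {λ S → f (send (pick x) S x)} (λ S′ → h (send (pick x) S′ x) (bounded-send S′ ¬sx bx)) hS

  -- The probability of leaving c at least k times within L steps.
  departures : (L k : ℕ) → State → Carrier
  departures L       zero    x = 1#
  departures zero    (suc k) x = 0#
  departures (suc L) (suc k) x = advance (departures L (if does (here? x) then k else suc k)) x

  advance-nonneg : ∀ {f} x → (∀ z → 0# ≤ f z) → 0# ≤ advance f x
  advance-nonneg {f} x h with isStable? x
  ... | yes _ = ≤-trans (≤-reflexive (sym (𝔼-const (randomVertex-probability m n) 0#))) (mono (randomVertex-probability m n) (λ v → h (addGrain v x)))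
  ... | no _  = ≤-trans (≤-reflexive (sym (𝔼-const (randomSubset-probability (degree (pick x))) 0#)))
                        (mono (randomSubset-probability (degree (pick x))) (λ S → h (send (pick x) S x)))

  departures-nonneg : ∀ L k x → 0# ≤ departures L k x
  departures-nonneg L       zero    x = 0≤1
  departures-nonneg zero    (suc k) x = ≤-refl
  departures-nonneg (suc L) (suc k) x = advance-nonneg x (departures-nonneg L (if does (here? x) then k else suc k))

  module _ {L k : ℕ} {e s : Carrier} (0≤s : 0# ≤ s)
           (few  : ∀ L′ x → L ℕ.≤ L′ → Bounded x → 1# ≤ departures L′ k x + e)
           (many : ∀ L′ x → L ℕ.≤ L′ → Bounded x → 1# ≤ departures L′ (suc k) x + (e + s)) where

    -- Let failing to depart k times cost at most e, and failing k + 1 times at most e + s. With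
    -- probability at least α ^ j the chain follows the given path to c, after which only the error
    -- e remains, so the excess s drops by α ^ j s. Meeting c earlier only helps. The horizon leaves
    -- j steps to arrive, one to depart and L for the remainder.
    hit : ∀ {j x} L′ → Reaches rule c j x → Bounded x → L ℕ.+ suc j ℕ.≤ L′ →
          1# + α ^ j * s ≤ departures L′ (suc k) x + (e + s)
    hit {j} zero r bx L≤ = contradiction (ℕ.≤-trans (ℕ.m≤n+m (suc j) L) L≤) (λ ())
    hit {j} {x} (suc L′) r bx L≤ with here? x
    ... | yes _ = begin
      1# + α ^ j * s                              ≤⟨ +-mono-≤ leave (≤-trans (*-monoʳ-≤ 0≤s (^-≤1 (<⇒≤ 0<α) α≤1 j)) (≤-reflexive (*-identityˡ s))) ⟩
      advance (departures L′ k) x + e + s         ≈⟨ +-assoc _ e s ⟩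
      advance (departures L′ k) x + (e + s)       ∎
      where
        open ≤-Reasoning
        L≤L′ : L ℕ.≤ L′
        L≤L′ = ℕ.≤-trans (ℕ.m≤m+n L j) (ℕ.≤-pred (ℕ.≤-trans (ℕ.≤-reflexive (≡.sym (ℕ.+-suc L j))) L≤))
        leave : 1# ≤ advance (departures L′ k) x + e
        leave = ≤-trans (advance-≥1 bx (λ z → few L′ z L≤L′)) (≤-reflexive (advance-+const (departures L′ k) e x))
    ... | no c≢x = approach r
      where
        L≤L′ : L ℕ.≤ L′
        L≤L′ = ℕ.≤-trans (ℕ.m≤m+n L j) (ℕ.≤-pred (ℕ.≤-trans (ℕ.≤-reflexive (≡.sym (ℕ.+-suc L j))) L≤))
        f : State → Carrier
        f z = departures L′ (suc k) z + (e + s)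
        shorter : ∀ {i} → L ℕ.+ suc (suc i) ℕ.≤ suc L′ → L ℕ.+ suc i ℕ.≤ L′
        shorter {i} h = ℕ.≤-pred (ℕ.≤-trans (ℕ.≤-reflexive (≡.sym (ℕ.+-suc L (suc i)))) h)
        finish : ∀ i → 1# + α * (α ^ i * s) ≤ advance f x →
                 1# + α ^ suc i * s ≤ advance (departures L′ (suc k)) x + (e + s)
        finish i h = ≤-trans (≤-reflexive (+-congˡ (*-assoc α (α ^ i) s)))
                             (≤-trans h (≤-reflexive (advance-+const (departures L′ (suc k)) (e + s) x)))
        approach : Reaches rule c j x → 1# + α ^ j * s ≤ advance (departures L′ (suc k)) x + (e + s)
        approach done            = contradiction ≡.refl c≢x
        approach (add {i} v sx r′) = finish i (advance-add v sx (λ z → many L′ z L≤L′)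
                                               (hit L′ r′ (bounded-add v sx) (shorter L≤)))
        approach (toppling {i} S ¬sx r′) = finish i (advance-send S ¬sx bx (λ z → many L′ z L≤L′)
                                               (hit L′ r′ (bounded-send S ¬sx bx) (shorter L≤)))

  module Decay (M : ℕ) (reach : ∀ x → Bounded x → ∃[ j ] j ℕ.≤ M × Reaches rule c j x) where

    δ : Carrier
    δ = α ^ M

    0<δ : 0# < δ
    0<δ = ^-pos 0<α M

    miss : Carrier
    miss = 1# - δ

    miss+δ≈1 : miss + δ ≈ 1#
    miss+δ≈1 = sub-add 1# δ

    0≤miss : 0# ≤ miss
    0≤miss = x≤y⇒0≤y-x (^-≤1 (<⇒≤ 0<α) α≤1 M)

    -- The bound is demanded for all horizons from L on, so that it can be used in the middle of a
    -- longer run without comparing horizons.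
    AtLeast : ℕ → Carrier → Set _
    AtLeast k e = ∃[ L ] ∀ L′ x → L ℕ.≤ L′ → Bounded x → 1# ≤ departures L′ k x + e

    -- R counts attempts to reach c once more. With none the excess error is 1, which makes the
    -- claim trivial; each attempt multiplies it by `miss`, at the price of M + 1 further steps.
    again : ∀ {k e} R → 0# ≤ e → AtLeast k e → AtLeast (suc k) (e + miss ^ R)
    again {k} zero 0≤e _ = 0 , λ L′ x _ _ → ≤-trans (≤-trans (x≤x+y (+-nonneg (departures-nonneg L′ (suc k) x) 0≤e))
      (≤-reflexive (+-comm 1# _))) (≤-reflexive (+-assoc _ _ 1#))
    again {k} {e} (suc R) 0≤e (L₁ , few) = improve (again R 0≤e (L₁ , few))
      where
        improve : AtLeast (suc k) (e + miss ^ R) → AtLeast (suc k) (e + miss ^ suc R)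
        improve (L₂ , many) = L ℕ.+ suc M , λ L′ x L≤ bx → late L′ x L≤ bx (reach x bx)
          where
            L = L₁ ℕ.⊔ L₂
            s = miss ^ R
            0≤s : 0# ≤ s
            0≤s = ^-nonneg 0≤miss R
            late : ∀ L′ x → L ℕ.+ suc M ℕ.≤ L′ → Bounded x → (∃[ j ] j ℕ.≤ M × Reaches rule c j x) →
                   1# ≤ departures L′ (suc k) x + (e + miss * s)
            late L′ x L≤ bx (j , j≤M , r) = +-cancelʳ-≤ (δ * s) (begin
              1# + δ * s                                   ≤⟨ +-monoʳ-≤ 1# (*-monoʳ-≤ 0≤s (^-anti (<⇒≤ 0<α) α≤1 j≤M)) ⟩
              1# + α ^ j * s                               ≤⟨ hit {L} 0≤s
                (λ L″ z L≤L″ → few L″ z (ℕ.≤-trans (ℕ.m≤m⊔n L₁ L₂) L≤L″))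
                (λ L″ z L≤L″ → many L″ z (ℕ.≤-trans (ℕ.m≤n⊔m L₁ L₂) L≤L″))
                L′ r bx (ℕ.≤-trans (ℕ.+-monoʳ-≤ L (ℕ.s≤s j≤M)) L≤) ⟩
              d + (e + s)                                  ≈⟨ +-congˡ (+-congˡ (trans (sym (*-identityˡ s)) (*-congʳ (sym miss+δ≈1)))) ⟩
              d + (e + (miss + δ) * s)                     ≈⟨ solve 5 (λ d e q δ s → d :+ (e :+ (q :+ δ) :* s) := d :+ (e :+ q :* s) :+ δ :* s) refl d e miss δ s ⟩
              d + (e + miss * s) + δ * s                   ∎)
              where
                open ≤-Reasoning
                d = departures L′ (suc k) x

    -- Each of the k departures is given R attempts and contributes one error `miss ^ R`.
    eventually : ∀ k R → AtLeast k (fromℕ k * miss ^ R)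
    eventually zero    R = 0 , λ L′ x _ _ → x≤x+y (≤-reflexive (sym (zeroˡ _)))
    eventually (suc k) R = rewritten (again R (*-nonneg (fromℕ-nonneg k) (^-nonneg 0≤miss R)) (eventually k R))
      where
        rewritten : AtLeast (suc k) (fromℕ k * miss ^ R + miss ^ R) → AtLeast (suc k) (fromℕ (suc k) * miss ^ R)
        rewritten (L , h) = L , λ L′ x L≤ bx → ≤-trans (h L′ x L≤ bx) (≤-reflexive (+-congˡ
          (solve 2 (λ k x → k :* x :+ x := (con 1 :+ k) :* x) refl (fromℕ k) (miss ^ R))))

  indicator : Bool → Carrier
  indicator b = if b then 1# else 0#

  0≤indicator : ∀ b → 0# ≤ indicator b
  0≤indicator true  = 0≤1
  0≤indicator false = ≤-refl

  indicator≤1 : ∀ b → indicator b ≤ 1#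
  indicator≤1 true  = ≤-refl
  indicator≤1 false = 0≤1

  visited : ℕ → List State → Carrier
  visited k X = indicator (k ≤ᵇ visits rule c X)

  visited-here : ∀ k {x} X → c ≡ x → visited (suc k) (x ∷ X) ≡ visited k X
  visited-here k {x} X c≡x = ≡.trans
    (≡.cong (λ Y → indicator (suc k ≤ᵇ List.length Y)) (filter-accept (c ≟_) {x} {X} c≡x))
    (≡.cong indicator (suc≤ᵇsuc k (visits rule c X)))
    where
      suc≤ᵇsuc : ∀ k l → (suc k ≤ᵇ suc l) ≡ (k ≤ᵇ l)
      suc≤ᵇsuc zero    l = ≡.refl
      suc≤ᵇsuc (suc k) l = ≡.refl

  visited-elsewhere : ∀ k {x} X → c ≢ x → visited k (x ∷ X) ≡ visited k X
  visited-elsewhere k {x} X c≢x =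
    ≡.cong (λ Y → indicator (k ≤ᵇ List.length Y)) (filter-reject (c ≟_) {x} {X} c≢x)

  follow : ℕ → ℕ → Maybe State → Dist (List State)
  follow T N = maybe′ (λ x → trajectory rule T N x >>= λ X → return (x ∷ X)) (return [])

  -- The chain started in the middle of a stabilisation.
  resume : ℕ → ℕ → ℕ → State → Dist (List State)
  resume T′ T N x = stabilise rule T′ x >>= follow T N

  stabilise-stable : ∀ {T x} → Stable x → stabilise rule T x ≡ return (just x)
  stabilise-stable {T} {x} sx with stable? x
  ... | yes _  = ≡.refl
  ... | no ¬sx = contradiction sx ¬sx

  stabilise-zero : ∀ {x} → ¬ Stable x → stabilise rule 0 x ≡ return nothing
  stabilise-zero {x} ¬sx with stable? x
  ... | yes sx = contradiction sx ¬sx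
  ... | no _   = ≡.refl

  stabilise-suc : ∀ {T x} → ¬ Stable x → stabilise rule (suc T) x ≡ (topple (pick x) x >>= stabilise rule T)
  stabilise-suc {T} {x} ¬sx with stable? x
  ... | yes sx = contradiction sx ¬sx
  ... | no _   = ≡.refl

  resume-stable : ∀ {T′ T N x} → Stable x → ∀ f → 𝔼 (resume T′ T N x) f ≈ 𝔼 (trajectory rule T N x) (λ X → f (x ∷ X))
  resume-stable {T′} {T} {N} {x} sx f = begin
    𝔼 (resume T′ T N x) f                        ≡⟨ ≡.cong (λ d → 𝔼 (d >>= follow T N) f) (stabilise-stable {T′} sx) ⟩
    𝔼 (return (just x) >>= follow T N) f         ≈⟨ 𝔼-bind (return (just x)) (follow T N) f ⟩
    𝔼 (return (just x)) (λ y → 𝔼 (follow T N y) f) ≈⟨ 𝔼-return (just x) (λ y → 𝔼 (follow T N y) f) ⟩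
    𝔼 (trajectory rule T N x >>= λ X → return (x ∷ X)) f ≈⟨ 𝔼-bind (trajectory rule T N x) (λ X → return (x ∷ X)) f ⟩
    𝔼 (trajectory rule T N x) (λ X → 𝔼 (return (x ∷ X)) f) ≈⟨ 𝔼-cong (trajectory rule T N x) (λ X → 𝔼-return (x ∷ X) f) ⟩
    𝔼 (trajectory rule T N x) (λ X → f (x ∷ X))  ∎
    where open ≈-Reasoning

  resume-zero : ∀ {T N x} → ¬ Stable x → ∀ f → 𝔼 (resume 0 T N x) f ≈ f []
  resume-zero {T} {N} {x} ¬sx f = begin
    𝔼 (resume 0 T N x) f                         ≡⟨ ≡.cong (λ d → 𝔼 (d >>= follow T N) f) (stabilise-zero ¬sx) ⟩
    𝔼 (return nothing >>= follow T N) f          ≈⟨ 𝔼-bind (return nothing) (follow T N) f ⟩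
    𝔼 (return nothing) (λ y → 𝔼 (follow T N y) f) ≈⟨ 𝔼-return nothing (λ y → 𝔼 (follow T N y) f) ⟩
    𝔼 (return []) f                              ≈⟨ 𝔼-return [] f ⟩
    f []                                         ∎
    where open ≈-Reasoning

  resume-suc : ∀ {T′ T N x} → ¬ Stable x → ∀ f → 𝔼 (resume (suc T′) T N x) f ≈
               𝔼 (randomSubset (degree (pick x))) (λ S → 𝔼 (resume T′ T N (send (pick x) S x)) f)
  resume-suc {T′} {T} {N} {x} ¬sx f = begin
    𝔼 (resume (suc T′) T N x) f                  ≡⟨ ≡.cong (λ d → 𝔼 (d >>= follow T N) f) (stabilise-suc {T′} ¬sx) ⟩
    𝔼 (topple (pick x) x >>= stabilise rule T′ >>= follow T N) f
      ≈⟨ 𝔼-bind (topple (pick x) x >>= stabilise rule T′) (follow T N) f ⟩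
    𝔼 (topple (pick x) x >>= stabilise rule T′) g
      ≈⟨ 𝔼-bind (topple (pick x) x) (stabilise rule T′) g ⟩
    𝔼 (topple (pick x) x) (λ y → 𝔼 (stabilise rule T′ y) g)
      ≈⟨ 𝔼-bind (randomSubset (degree (pick x))) (λ S → return (send (pick x) S x)) (λ y → 𝔼 (stabilise rule T′ y) g) ⟩
    𝔼 (randomSubset (degree (pick x))) (λ S → 𝔼 (return (send (pick x) S x)) (λ y → 𝔼 (stabilise rule T′ y) g))
      ≈⟨ 𝔼-cong (randomSubset (degree (pick x))) (λ S → trans (𝔼-return (send (pick x) S x) (λ y → 𝔼 (stabilise rule T′ y) g))
                                                            (sym (𝔼-bind (stabilise rule T′ (send (pick x) S x)) (follow T N) f))) ⟩
    𝔼 (randomSubset (degree (pick x))) (λ S → 𝔼 (resume T′ T N (send (pick x) S x)) f) ∎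
    where
      open ≈-Reasoning
      g : Maybe State → Carrier
      g y = 𝔼 (follow T N y) f

  trajectory-suc : ∀ {T N x} f → 𝔼 (trajectory rule T (suc N) x) f ≈
                   𝔼 (randomVertex m n) (λ v → 𝔼 (resume T T N (addGrain v x)) f)
  trajectory-suc {T} {N} {x} f = begin
    𝔼 (step rule T x >>= follow T N) f                            ≈⟨ 𝔼-bind (step rule T x) (follow T N) f ⟩
    𝔼 (step rule T x) g                                           ≈⟨ 𝔼-bind (randomVertex m n) (λ v → stabilise rule T (addGrain v x)) g ⟩
    𝔼 (randomVertex m n) (λ v → 𝔼 (stabilise rule T (addGrain v x)) g)
      ≈⟨ 𝔼-cong (randomVertex m n) (λ v → sym (𝔼-bind (stabilise rule T (addGrain v x)) (follow T N) f)) ⟩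
    𝔼 (randomVertex m n) (λ v → 𝔼 (resume T T N (addGrain v x)) f) ∎
    where
      open ≈-Reasoning
      g : Maybe State → Carrier
      g y = 𝔼 (follow T N y) f

  stabilise-probability : ∀ T x → IsProbability (stabilise rule T x)
  stabilise-probability T x with isStable? x
  ... | yes sx = ≡.subst IsProbability (≡.sym (stabilise-stable {T} sx)) (return-probability (just x))
  stabilise-probability zero    x | no ¬sx =
    ≡.subst IsProbability (≡.sym (stabilise-zero ¬sx)) (return-probability nothing)
  stabilise-probability (suc T) x | no ¬sx =
    ≡.subst IsProbability (≡.sym (stabilise-suc {T} ¬sx))
      (bind-probability (bind-probability (randomSubset-probability (degree (pick x))) (λ S → return-probability (send (pick x) S x)))
                        (stabilise-probability T))

  mutual
    trajectory-probability : ∀ T N x → IsProbability (trajectory rule T N x)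
    trajectory-probability T zero    x = return-probability []
    trajectory-probability T (suc N) x =
      bind-probability {g = follow T N} (bind-probability (randomVertex-probability m n) (λ v → stabilise-probability T (addGrain v x)))
                       (follow-probability T N)

    follow-probability : ∀ T N y → IsProbability (follow T N y)
    follow-probability T N nothing  = return-probability []
    follow-probability T N (just x) = bind-probability (trajectory-probability T N x) (λ X → return-probability (x ∷ X))

  resume-probability : ∀ T′ T N x → IsProbability (resume T′ T N x)
  resume-probability T′ T N x = bind-probability (stabilise-probability T′ x) (follow-probability T N)

  -- A departure from c happens at a stable state, which the trajectory records as a visit. L steps
  -- contain at most L topplings and L added grains, so with all three bounds at least L the
  -- truncation cannot lose any of these visits.
  departures≤ : Stable c → ∀ L k {T′ T N} x → L ℕ.≤ T′ → L ℕ.≤ T → L ℕ.≤ N →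
                departures L k x ≤ 𝔼 (resume T′ T N x) (visited k)
  departures≤ sc L zero {T′} {T} {N} x _ _ _ = ≤-reflexive (sym (mass (resume-probability T′ T N x)))
  departures≤ sc zero (suc k) {T′} {T} {N} x _ _ _ = ≤-trans
    (≤-reflexive (sym (𝔼-const (resume-probability T′ T N x) 0#)))
    (mono (resume-probability T′ T N x) (λ X → 0≤indicator (suc k ≤ᵇ visits rule c X)))
  departures≤ sc (suc L) (suc k) {suc T′} {T} {suc N} x (ℕ.s≤s L≤T′) L<T (ℕ.s≤s L≤N) with isStable? x
  ... | no ¬sx = ≤-trans
    (mono (randomSubset-probability (degree (pick x))) (λ S → after (here? x) S))
    (≤-reflexive (sym (resume-suc {T′} {T} {suc N} ¬sx (visited (suc k)))))
    where
      after : (h : Dec (c ≡ x)) → ∀ S → departures L (if does h then k else suc k) (send (pick x) S x) ≤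
              𝔼 (resume T′ T (suc N) (send (pick x) S x)) (visited (suc k))
      after (yes c≡x) S = contradiction (≡.subst Stable c≡x sc) ¬sx
      after (no  _)   S = departures≤ sc L (suc k) (send (pick x) S x) L≤T′ (ℕ.<⇒≤ L<T) (ℕ.m≤n⇒m≤1+n L≤N)
  ... | yes sx = ≤-trans
    (mono (randomVertex-probability m n) (λ v → departures≤ sc L (if does (here? x) then k else suc k) (addGrain v x) (ℕ.<⇒≤ L<T) (ℕ.<⇒≤ L<T) L≤N))
    (≤-reflexive (trans (sym (trajectory-suc {T} {N} {x} (visited (if does (here? x) then k else suc k))))
      (trans (𝔼-cong (trajectory rule T (suc N) x) (λ X → reflexive (≡.sym (count (here? x) X))))
             (sym (resume-stable {suc T′} {T} {suc N} sx (visited (suc k)))))))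
    where
      count : (h : Dec (c ≡ x)) → ∀ X → visited (suc k) (x ∷ X) ≡ visited (if does h then k else suc k) X
      count (yes c≡x) X = visited-here k X c≡x
      count (no  c≢x) X = visited-elsewhere (suc k) X c≢x

  good⇒recurrent : Stable c → GoodConfig c → StochasticallyRecurrent rule c
  good⇒recurrent sc good k ε 0<ε = conclude (reach-uniformly rule _ sc good)
    where
      conclude : (∃[ M ] ∀ x → Bounded x → ∃[ j ] j ℕ.≤ M × Reaches rule c j x) →
                 ∃[ T ] ∃[ N ] 1# - ε < prob (λ X → k ≤ᵇ visits rule c X) (trajectory rule T N c)
      -- One departure more than k is needed: leaving the initial state c counts as a departure,
      -- while `trajectory` does not list X₀.
      conclude (M , reach) = choose (geometric-decay 0≤miss 0<δ miss+δ≈1 (suc k) 0<ε)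
        where
          open Decay M reach
          choose : (∃[ R ] fromℕ (suc k) * miss ^ R < ε) →
                   ∃[ T ] ∃[ N ] 1# - ε < prob (λ X → k ≤ᵇ visits rule c X) (trajectory rule T N c)
          choose (R , small) = bound (eventually (suc k) R)
            where
              bound : AtLeast (suc k) (fromℕ (suc k) * miss ^ R) →
                      ∃[ T ] ∃[ N ] 1# - ε < prob (λ X → k ≤ᵇ visits rule c X) (trajectory rule T N c)
              bound (L , h) = L , L , +-cancelʳ-< ε (begin-strict
                1# - ε + ε                                              ≈⟨ sub-add 1# ε ⟩
                1#                                                      ≤⟨ h L c ℕ.≤-refl (bounded-stable sc) ⟩
                departures L (suc k) c + e                              ≤⟨ +-monoˡ-≤ e (departures≤ sc L (suc k) {L} {L} {L} c ℕ.≤-refl ℕ.≤-refl ℕ.≤-refl) ⟩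
                𝔼 (resume L L L c) (visited (suc k)) + e                ≈⟨ +-congʳ (resume-stable {L} {L} {L} sc (visited (suc k))) ⟩
                𝔼 (trajectory rule L L c) (λ X → visited (suc k) (c ∷ X)) + e
                  ≈⟨ +-congʳ (𝔼-cong (trajectory rule L L c) (λ X → reflexive (visited-here k X ≡.refl))) ⟩
                𝔼 (trajectory rule L L c) (visited k) + e               ≈⟨ +-congʳ (prob≈𝔼 (λ X → k ≤ᵇ visits rule c X) (trajectory rule L L c)) ⟨
                P + e                                                   ≈⟨ +-comm P e ⟩
                e + P                                                   <⟨ +-monoˡ-< P small ⟩
                ε + P                                                   ≈⟨ +-comm ε P ⟩
                P + ε                                                   ∎)
                where
                  open ≤-Reasoning
                  e = fromℕ (suc k) * miss ^ R
                  P = prob (λ X → k ≤ᵇ visits rule c X) (trajectory rule L L c)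

  returns : ℕ → ℕ → ℕ → State → Carrier
  returns T′ T N x = 𝔼 (resume T′ T N x) (visited 1)

  module _ (bad : ¬ GoodConfig c) where

    -- Good states lead only to good states, and c is not one. The recursion is lexicographic: a
    -- toppling lowers T′, and a new grain lowers N while resetting T′ to T.
    good-avoids : ∀ N T′ T x → GoodConfig x → returns T′ T N x ≤ 0#
    good-avoids N T′ T x good with isStable? x
    good-avoids zero T′ T x good | yes sx = ≤-reflexive (trans (resume-stable {T′} {T} {0} sx (visited 1))
      (trans (𝔼-return [] (λ X → visited 1 (x ∷ X))) (reflexive (visited-elsewhere 1 {x} [] (λ { ≡.refl → bad good })))))
    good-avoids (suc N) T′ T x good | yes sx = begin
      returns T′ T (suc N) x                                                   ≈⟨ resume-stable {T′} {T} {suc N} sx (visited 1) ⟩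
      𝔼 (trajectory rule T (suc N) x) (λ X → visited 1 (x ∷ X))                ≈⟨ 𝔼-cong (trajectory rule T (suc N) x)
        (λ X → reflexive (visited-elsewhere 1 {x} X (λ { ≡.refl → bad good }))) ⟩
      𝔼 (trajectory rule T (suc N) x) (visited 1)                              ≈⟨ trajectory-suc {T} {N} {x} (visited 1) ⟩
      𝔼 (randomVertex m n) (λ v → returns T T N (addGrain v x))                ≤⟨ mono (randomVertex-probability m n)
        (λ v → good-avoids N T T (addGrain v x) (good-addGrain v x good)) ⟩
      𝔼 (randomVertex m n) (λ _ → 0#)                                          ≈⟨ 𝔼-const (randomVertex-probability m n) 0# ⟩
      0#                                                                       ∎
      where open ≤-Reasoning
    good-avoids N zero T x good | no ¬sx = ≤-reflexive (resume-zero {T} {N} ¬sx (visited 1))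
    good-avoids N (suc T′) T x good | no ¬sx = begin
      returns (suc T′) T N x                                                   ≈⟨ resume-suc {T′} {T} {N} ¬sx (visited 1) ⟩
      𝔼 (randomSubset (degree (pick x))) (λ S → returns T′ T N (send (pick x) S x))
        ≤⟨ mono (randomSubset-probability (degree (pick x)))
             (λ S → good-avoids N T′ T (send (pick x) S x) (good-send (pick x) S x (legal x ¬sx) good)) ⟩
      𝔼 (randomSubset (degree (pick x))) (λ _ → 0#)                            ≈⟨ 𝔼-const (randomSubset-probability (degree (pick x))) 0# ⟩
      0#                                                                       ∎
      where open ≤-Reasoning

    returns≤1 : ∀ T′ T N x → returns T′ T N x ≤ 1#
    returns≤1 T′ T N x = 𝔼≤1 (resume-probability T′ T N x) (λ X → indicator≤1 (1 ≤ᵇ visits rule c X))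

    -- The number of grains missing until every bottom vertex holds m, the most that stability
    -- allows and enough for `good-full`.
    deficit : State → ℕ
    deficit x = ∑ {n} (λ j → m ∸ bottom x j)

    deficit-add : ∀ x j → bottom x j ℕ.< m → suc (deficit (addGrain (inj₂ j) x)) ≡ deficit x
    deficit-add x j b<m = ℕ.+-cancelʳ-≡ (m ∸ bottom x′ j) _ _ (≡.trans
      (≡.sym (ℕ.+-suc (deficit x′) _))
      (≡.trans (≡.cong (deficit x′ ℕ.+_) (≡.trans (≡.cong (λ y → suc (m ∸ y)) (addGrain-self (inj₂ j) x))
                                           (≡.sym (ℕ.+-∸-assoc 1 b<m))))
        (∑-update (λ i → m ∸ bottom x′ i) (λ i → m ∸ bottom x i) j
          (λ i i≢j → ≡.cong (m ∸_) (addGrain-other (inj₂ j) (inj₂ i) x (i≢j ∘ inj₂-injective))))))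
      where x′ = addGrain (inj₂ j) x

    add-stable : ∀ {x : State} j → Stable x → bottom x j ℕ.< m → Stable (addGrain (inj₂ j) x)
    add-stable {x} j sx b<m w with w ≟ᵛ inj₂ j
    ... | yes ≡.refl = ℕ.≤-trans (ℕ.≤-reflexive (≡.cong suc (addGrain-self (inj₂ j) x))) (ℕ.s≤s b<m)
    ... | no  w≢     = ℕ.≤-trans (ℕ.≤-reflexive (≡.cong suc (addGrain-other (inj₂ j) w x w≢))) (sx w)

    -- Each time, with probability at least u, a grain is added to a bottom
    -- vertex that remains stable, until the configuration is good.
    escape : ∀ M T N x → Stable x → total c ℕ.≤ total x → deficit x ℕ.≤ M →
             𝔼 (trajectory rule T N x) (visited 1) + u ^ M ≤ 1#
    escape M T zero x sx _ _ = ≤-trans (+-mono-≤ (≤-reflexive (𝔼-return [] (visited 1))) (^-≤1 (<⇒≤ 0<u) u≤1 M))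
                                       (≤-reflexive (+-identityˡ 1#))
    escape M T (suc N) x sx c≤x ≤M = ≤-trans (+-monoˡ-≤ (u ^ M) (≤-reflexive (trajectory-suc {T} {N} {x} (visited 1))))
                                             (go M ≤M (Fin.any? (λ (j : Fin n) → bottom x j ℕ.<? m)))
      where
        go : ∀ M → deficit x ℕ.≤ M → Dec (∃[ j ] bottom x j ℕ.< m) →
             𝔼 (randomVertex m n) (λ v → returns T T N (addGrain v x)) + u ^ M ≤ 1#
        go M ≤M (no ¬low) = ≤-trans (+-mono-≤ (≤-trans (mono (randomVertex-probability m n)
              (λ v → good-avoids N T T (addGrain v x) (good-addGrain v x (good-full {t = top x} {bottom x} (λ j → ℕ.≮⇒≥ (λ lt → ¬low (j , lt)))))))
              (≤-reflexive (𝔼-const (randomVertex-probability m n) 0#)))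
            (^-≤1 (<⇒≤ 0<u) u≤1 M)) (≤-reflexive (+-identityˡ 1#))
        go zero    ≤M (yes (j , b<m)) = contradiction (ℕ.≤-trans (ℕ.≤-reflexive (deficit-add x j b<m)) ≤M) (λ ())
        go (suc M) ≤M (yes (j , b<m)) = heavy-upper (randomVertex-probability m n) (<⇒≤ 0<u) (randomVertex-heavy {m} {n} (inj₂ j))
          {λ v → returns T T N (addGrain v x)} (λ v → returns≤1 T T N (addGrain v x))
          (≤-trans (+-monoˡ-≤ (u ^ M) (≤-reflexive (trans (resume-stable {T} {T} {N} sx′ (visited 1))
                     (𝔼-cong (trajectory rule T N x′) (λ X → reflexive (visited-elsewhere 1 {x′} X c≢x′))))))
                   (escape M T N x′ sx′ (ℕ.<⇒≤ c<x′)
                     (ℕ.≤-pred (ℕ.≤-trans (ℕ.≤-reflexive (deficit-add x j b<m)) ≤M))))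
          where
            x′ = addGrain (inj₂ j) x
            sx′ = add-stable j sx b<m
            -- No toppling occurs on the way up, so the total stays above that of c, and c is not
            -- met before the state becomes good.
            c<x′ : total c ℕ.< total x′
            c<x′ = ℕ.≤-trans (ℕ.s≤s c≤x) (ℕ.≤-reflexive (≡.sym (total-addGrain (inj₂ j) x)))
            c≢x′ : c ≢ x′
            c≢x′ c≡x′ = ℕ.<⇒≢ c<x′ (≡.cong total c≡x′)

    not-recurrent : Stable c → ¬ StochasticallyRecurrent rule c
    not-recurrent sc recurrent = contradict (recurrent 1 (u ^ M) (^-pos 0<u M))
      where
        M = deficit c
        contradict : ¬ (∃[ T ] ∃[ N ] 1# - u ^ M < prob (λ X → 1 ≤ᵇ visits rule c X) (trajectory rule T N c))
        contradict (T , N , high) = <-irrefl refl (begin-strict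
          1#                                                    ≈⟨ sub-add 1# (u ^ M) ⟨
          1# - u ^ M + u ^ M                                    <⟨ +-monoˡ-< (u ^ M) high ⟩
          prob (λ X → 1 ≤ᵇ visits rule c X) (trajectory rule T N c) + u ^ M
                                                                ≈⟨ +-congʳ (prob≈𝔼 (λ X → 1 ≤ᵇ visits rule c X) (trajectory rule T N c)) ⟩
          𝔼 (trajectory rule T N c) (visited 1) + u ^ M         ≤⟨ escape M T N c sc ℕ.≤-refl ℕ.≤-refl ⟩
          1#                                                    ∎)
          where open ≤-Reasoning

-- Combination of the test, recurrence and the time bound

open import Data.Bool as Bool using (true)
open import Data.Maybe using (just)
open import Data.Maybe.Properties using (≡-dec)
open import Data.Nat using (_+_; _*_; _≤_)
open import Data.Product using (_×_; _,_; ∃-syntax)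
open import Function using (_⇔_; mk⇔; module Equivalence)
open import Relation.Binary.PropositionalEquality using (_≡_)
open import Relation.Nullary.Decidable using (decidable-stable)

theorem2p5 : ∀ {a ℓ₁ ℓ₂ ℓ₃} (ℝ : Reals a ℓ₁ ℓ₂ ℓ₃) →
    (∀ (p : Reals.Carrier ℝ) → InUnitInterval ℝ p →
    ∀ (m n : ℕ) .{{_ : NonZero n}} (rule : TopplingRule m n)
    (c : Config m n) → Stable c →
    RAM.result (RAM.runAlgorithm c) ≡ just true ⇔ SSM.StochasticallyRecurrent ℝ p rule c)
    ×
    (∃[ K ] ∀ (m n : ℕ) .{{_ : NonZero n}} (c : Config m n) → Stable c →
    RAM.time (RAM.runAlgorithm c) ≤ K * (m + n))
theorem2p5 ℝ = (λ p p∈ m n rule c sc →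
    let open RAMProgram.Analysis c sc
        open Recurrence ℝ p p∈ rule c
        open Equivalence algorithm⇔good
    in mk⇔ (λ returns-true → good⇒recurrent sc (to returns-true))
           -- `not-recurrent` only refutes badness. The double negation is removed on the result of
           -- the algorithm, where equality is decidable.
           (λ recurrent → decidable-stable (≡-dec Bool._≟_ (RAM.result (RAM.runAlgorithm c)) (just true))
             (λ returns-other → not-recurrent (λ good → returns-other (from good)) sc recurrent)))
  , 79 , λ m n c sc → RAMProgram.Analysis.algorithm-time c sc
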